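{- Let $n\ge 2$ and $t\ge 3$. Under the action of the collineation group of $\Lambda=PG(2n-1,q^t)$, the maximum scattered $\mathbb{F}_q$-linear sets of $\Lambda$ of pseudoregulus type fall into exactly $\varphi(t)/2$ orbits, where $\varphi$ denotes Euler's totient function.
   Context: For an $\mathbb{F}_q$-subspace $U$ of the $2n$-dimensional $\mathbb{F}_{q^t}$-space $V$ with $\Lambda=PG(V,\mathbb{F}_{q^t})$, $L_U=\{\langle\mathbf u\rangle_{q^t}:\mathbf u\in U\setminus\{\mathbf 0\}\}$ is the $\mathbb{F}_q$-linear set defined by $U$, of rank $\dim_{\mathbb F_q}U$; the weight of a subspace $PG(W,\mathbb{F}_{q^t})$ in $L_U$ is $\dim_{\mathbb F_q}(W\cap U)$; $L_U$ is scattered if every point has weight 1, and maximum scattered in $PG(2n-1,q^t)$ if it is scattered of rank $tn$. Pseudoregulus type: a scattered $\mathbb{F}_q$-linear set $L$ of $\Lambda$ of rank $tn$ such that (i) there exist $(q^{nt}-1)/(q^t-1)$ pairwise disjoint lines $s_i$ each of weight $t$ in $L$, and (ii) there exist exactly two $(n-1)$-dimensional subspaces $T_1,T_2$ disjoint from $L$ with $T_j\cap s_i\ne\emptyset$ for all $i,j$. -}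

module Defs where

open import Level using (0ℓ)
open import Algebra.Bundles using (CommutativeRing)
open import Algebra.Morphism.Structures using (module RingMorphisms)
open import Algebra.Structures using (IsCommutativeRing)
open import Data.Fin.Base using (Fin)
open import Data.List.Base using (length; filter; upTo) renaming (map to mapᴸ)
open import Data.Nat.Base using (ℕ; suc; _∸_; _^_) renaming (_*_ to _*ℕ_)
open import Data.Nat.Coprimality using (coprime?)
open import Data.Product.Base using (∃-syntax; Σ-syntax; _×_)
open import Data.Sum.Base using (_⊎_)
open import Data.Vec.Base using (Vec; []; _∷_; map; zipWith; replicate)
open import Data.Vec.Relation.Unary.All using (All)
open import Function.Base using (id)
open import Function.Bundles using (Inverse; _↔_; _⇔_)
open import Relation.Binary.Bundles using (Setoid)
import Relation.Binary.Construct.On as On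
open import Relation.Binary.PropositionalEquality.Core using (_≡_; _≢_)
open import Relation.Nullary.Negation.Core using (¬_)
open import Relation.Unary using (Pred; Decidable; _∈_; _∩_; _≐_)
open import Relation.Unary.Relation.Binary.Equality using (≐-setoid)

φ : ℕ → ℕ
φ t = length (filter (λ k → coprime? k t) (mapᴸ suc (upTo t)))

-- Equality in the field is _≡_: every finite field is isomorphic to one whose
-- carrier is Fin q, so working up to a setoid would add no generality.
record FiniteField (q : ℕ) : Set₁ where
  infixl 7 _*_
  infixl 6 _+_
  field
    Carrier           : Set
    _+_ _*_           : Carrier → Carrier → Carrier
    -_                : Carrier → Carrier
    0# 1#             : Carrier
    isCommutativeRing : IsCommutativeRing _≡_ _+_ _*_ -_ 0# 1#
    1≢0               : 1# ≢ 0#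
    inverse           : ∀ x → x ≢ 0# → ∃[ y ] x * y ≡ 1#
    enumeration       : Carrier ↔ Fin q

  commutativeRing : CommutativeRing 0ℓ 0ℓ
  commutativeRing = record { isCommutativeRing = isCommutativeRing }

  open CommutativeRing commutativeRing public using (rawRing)

-- F_q ⊆ F_{q^t}. That q is a prime power follows from the existence of F.
record FieldExtension (q t : ℕ) : Set₁ where
  field
    F : FiniteField q
    K : FiniteField (q ^ t)

  private
    module F = FiniteField F
    module K = FiniteField K

  field
    ι              : F.Carrier → K.Carrier
    isHomomorphism : RingMorphisms.IsRingHomomorphism F.rawRing K.rawRing ι

-- The vector space K^N.
module Vectors {r : ℕ} (K : FiniteField r) (N : ℕ) where
  open FiniteField K

  V : Set
  V = Vec Carrier N

  0ᵥ : V
  0ᵥ = replicate N 0#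

  infixl 6 _+ᵥ_
  _+ᵥ_ : V → V → V
  _+ᵥ_ = zipWith _+_

  infixr 7 _*ᵥ_
  _*ᵥ_ : Carrier → V → V
  a *ᵥ v = map (a *_) v

-- K^N as a vector space over S, where S acts through e : S → K.
module Subspaces {r s : ℕ} (K : FiniteField r) (N : ℕ)
                 (S : FiniteField s)
                 (e : FiniteField.Carrier S → FiniteField.Carrier K) where
  open Vectors K N
  private module S = FiniteField S

  -- Decidability of membership expresses that the predicate is a subset, in
  -- the classical sense, of the finite set V.
  record Subspace : Set₁ where
    field
      member   : Pred V 0ℓ
      member?  : Decidable member
      0-closed : 0ᵥ ∈ member
      +-closed : ∀ {u v} → u ∈ member → v ∈ member → u +ᵥ v ∈ member
      *-closed : ∀ a {v} → v ∈ member → e a *ᵥ v ∈ member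

  combination : ∀ {d} → Vec S.Carrier d → Vec V d → V
  combination []       []       = 0ᵥ
  combination (a ∷ as) (b ∷ bs) = e a *ᵥ b +ᵥ combination as bs

  record IsBasis (W : Pred V 0ℓ) {d : ℕ} (b : Vec V d) : Set where
    field
      inside      : All (_∈ W) b
      independent : ∀ c → combination c b ≡ 0ᵥ → c ≡ replicate d S.0#
      spanning    : ∀ {w} → w ∈ W → ∃[ c ] combination c b ≡ w

  HasDim : Pred V 0ℓ → ℕ → Set
  HasDim W d = ∃[ b ] IsBasis W {d} b

-- PG(N-1, K), of vector dimension N.
module Projective {r : ℕ} (K : FiniteField r) (N : ℕ) where
  open Vectors K N public
  open Subspaces K N K id

  record Point : Set where
    constructor point
    field
      vec    : V
      vec≢0ᵥ : vec ≢ 0ᵥ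

  ⟨_⟩ : Point → Pred V 0ℓ
  ⟨ p ⟩ w = ∃[ a ] w ≡ a *ᵥ Point.vec p

  -- Points are compared as one-dimensional subspaces.
  pointSetoid : Setoid 0ℓ 0ℓ
  pointSetoid = On.setoid (≐-setoid V 0ℓ) ⟨_⟩

  open Setoid pointSetoid public using () renaming (_≈_ to _≈ₚ_)

  -- Subspaces of Λ, indexed by vector dimension: projective dimension d - 1.
  record Flat (d : ℕ) : Set₁ where
    field
      subspace : Subspace
      hasDim   : HasDim (Subspace.member subspace) d

    open Subspace subspace public using (member)

  Line : Set₁
  Line = Flat 2

  infix 4 _on_
  _on_ : ∀ {d} → Point → Flat d → Set
  p on T = Point.vec p ∈ Flat.member T

  Collinear : Point → Point → Point → Set₁
  Collinear a b c = Σ[ ℓ ∈ Line ] a on ℓ × b on ℓ × c on ℓ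

  record Collineation : Set₁ where
    field
      bijection : Inverse pointSetoid pointSetoid

    open Inverse bijection public using (to)

    field
      collinear : ∀ a b c → Collinear a b c ⇔ Collinear (to a) (to b) (to c)

  -- f maps the point set L onto L′.
  infix 4 _≅_
  _≅_ : Pred Point 0ℓ → Pred Point 0ℓ → Set₁
  L ≅ L′ = ∃[ f ] ∀ p → p ∈ L ⇔ Collineation.to f p ∈ L′

module LinearSets {q t : ℕ} (E : FieldExtension q t) (n : ℕ) where
  open FieldExtension E
  open Projective K (2 *ℕ n) public

  private module OverF = Subspaces K (2 *ℕ n) F ι

  open OverF public using () renaming (Subspace to FSubspace; HasDim to HasDimF)

  member : FSubspace → Pred V 0ℓ
  member = OverF.Subspace.member

  L[_] : FSubspace → Pred Point 0ℓ
  L[ U ] p = ∃[ u ] Point.vec u ∈ member U × u ≈ₚ p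

  Weight : FSubspace → Pred V 0ℓ → ℕ → Set
  Weight U W w = HasDimF (W ∩ member U) w

  Scattered : FSubspace → Set
  Scattered U = ∀ p → p ∈ L[ U ] → Weight U ⟨ p ⟩ 1

  MaximumScattered : FSubspace → Set
  MaximumScattered U = Scattered U × HasDimF (member U) (t *ℕ n)

  record Transversal (U : FSubspace) {m : ℕ} (s : Fin m → Line) (T : Flat n) : Set where
    field
      disjoint : ∀ p → p ∈ L[ U ] → ¬ p on T
      meets    : ∀ i → ∃[ p ] p on T × p on s i

  infix 4 _≐ᶠ_
  _≐ᶠ_ : Flat n → Flat n → Set
  T ≐ᶠ T′ = Flat.member T ≐ Flat.member T′

  record PseudoregulusType (L : Pred Point 0ℓ) : Set₁ where
    field
      U                : FSubspace
      L≐L[U]           : L ≐ L[ U ]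
      maximumScattered : MaximumScattered U

      -- m = (q^{nt} - 1) / (q^t - 1)
      m                : ℕ
      m-value          : m *ℕ (q ^ t ∸ 1) ≡ q ^ (n *ℕ t) ∸ 1
      s                : Fin m → Line
      s-disjoint       : ∀ i j → i ≢ j → ¬ (∃[ p ] p on s i × p on s j)
      s-weight         : ∀ i → Weight U (Flat.member (s i)) t

      T₁ T₂            : Flat n
      T₁-transversal   : Transversal U s T₁
      T₂-transversal   : Transversal U s T₂
      T₁≢T₂            : ¬ (T₁ ≐ᶠ T₂)
      only-T₁-T₂       : ∀ T → Transversal U s T → T ≐ᶠ T₁ ⊎ T ≐ᶠ T₂

  -- The sets of pseudoregulus type fall into exactly k orbits: there is a
  -- system of k representatives.
  record HasExactlyOrbits (k : ℕ) : Set₁ where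
    field
      representative : Fin k → Pred Point 0ℓ
      isPseudo       : ∀ i → PseudoregulusType (representative i)
      inequivalent   : ∀ i j → representative i ≅ representative j → i ≡ j
      complete       : ∀ L → PseudoregulusType L → ∃[ i ] L ≅ representative i

{-# OPTIONS --safe #-}

-- Write Frob k for x ↦ x^{q^k}. If U defines a set of pseudoregulus type with transversals T₁, T₂, counting
-- shows that the lines s i cover T₁, T₂ and U. Hence U, embedded in V / T₁ and in V / T₂, inherits two
-- K-structures with the same one-dimensional subspaces; they differ by an automorphism σ of K over F.
-- A common point of T₁ and T₂ would make σ the identity and U not scattered, so V = T₁ ⊕ T₂ and U is the
-- graph of a σ-semilinear map T₁ → T₂, with Fix σ = F. Such a σ is Frob k with k coprime to t: up to a linear
-- map, the set is {⟨(x, Frob k x)⟩}, and exchanging T₁ and T₂ replaces k by t − k.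
--
-- Conversely, a collineation between the sets of Frob k and Frob k′ preserves the lines meeting the set in
-- more than q + 1 points, hence the pair {T₁, T₂}. Instead of the fundamental theorem of projective geometry
-- it suffices that its action θ on a coordinate of T₁ is multiplicative, by von Staudt's construction of
-- products: θ then commutes with powers, and θ ∘ Frob k = Frob k′ ∘ θ (or θ = Frob k′ ∘ θ ∘ Frob k) forces
-- k = k′ (or t ∣ k + k′).

module Submission where

open import Defs
open import Algebra.Bundles using (CommutativeRing; RawRing)
import Algebra.Morphism.Construct.Identity as Identity
open import Algebra.Morphism.Structures using (module RingMorphisms)
import Algebra.Solver.Ring
open import Algebra.Solver.Ring.AlmostCommutativeRing using (AlmostCommutativeRing; fromCommutativeRing; _-Raw-AlmostCommutative⟶_)
open import Data.Empty using (⊥; ⊥-elim)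
open import Data.Fin.Base using (Fin; zero; suc; toℕ; inject≤; punchIn; punchOut; combine; remQuot; splitAt; _↑ˡ_; _↑ʳ_)
open import Data.Fin.Permutation using (Permutation)
open import Data.Fin.Properties using (any?; injective⇒≤; punchOut-injective; punchIn-injective; punchInᵢ≢i; combine-remQuot; remQuot-combine; suc-injective; toℕ-injective; toℕ<n; inject≤-injective; splitAt-↑ˡ; splitAt-↑ʳ; splitAt⁻¹-↑ˡ; splitAt⁻¹-↑ʳ) renaming (_≟_ to _≟ᶠ_)
open import Data.List.Base as List using (List)
open import Data.List.Membership.Propositional using () renaming (_∈_ to _∈ˡ_)
import Data.List.Membership.Propositional.Properties as Membership
import Data.List.Relation.Unary.All as Allˡ
import Data.List.Relation.Unary.AllPairs as AllPairs
import Data.List.Relation.Unary.Any as Any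
import Data.List.Relation.Unary.Any.Properties as Anyₚ
open import Data.List.Relation.Unary.Unique.Propositional using (Unique)
import Data.List.Relation.Unary.Unique.Propositional.Properties as Uniqueₚ
open import Data.Maybe.Base using (Maybe; just; nothing)
open import Data.Nat.Base as ℕ using (ℕ; zero; suc; _≤_; _<_; z≤n; s≤s; _∸_; NonZero)
open import Data.Nat.Coprimality using (Coprime; coprime?; coprime-Bézout)
open import Data.Nat.DivMod using (_/_; m*n/n≡m)
open import Data.Nat.Divisibility as Divisibility using (_∣_; divides)
open import Data.Nat.GCD using (module Bézout)
import Data.Nat.Properties as ℕₚ
open import Data.Product.Base using (∃; ∃-syntax; Σ-syntax; _×_; _,_; proj₁; proj₂)
open import Data.Sum.Base using (_⊎_; inj₁; inj₂)
open import Data.Unit.Base using (tt) renaming (⊤ to Unit)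
open import Data.Vec.Base as Vec using (Vec; []; _∷_; map; zipWith; replicate; _++_)
open import Data.Vec.Properties using (∷-injectiveˡ; ∷-injectiveʳ; ≡-dec; map-++; zipWith-++; ++-injectiveˡ; ++-injectiveʳ)
open import Data.Vec.Relation.Unary.All as All using (All; []; _∷_)
import Data.Vec.Relation.Unary.All.Properties as Allₚ
open import Function.Base using (_∘_; id)
open import Function.Bundles using (Inverse; _↔_; _⇔_; mk⇔; mk↔ₛ′; Equivalence)
open import Level using (0ℓ)
open import Relation.Binary.Bundles using (Setoid)
open import Relation.Binary.Definitions using (DecidableEquality; tri<; tri≈; tri>)
open import Relation.Binary.PropositionalEquality using (_≡_; _≢_; refl; sym; trans; cong; cong₂; subst; subst₂; module ≡-Reasoning)
open import Relation.Nullary using (¬_; Dec; yes; no; contradiction)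
open import Relation.Nullary.Decidable using (map′; ¬?; decidable-stable)
open import Relation.Unary using (Pred; Decidable; _∈_; _∩_)

-- The bound `t ≥ 3` gives a line s i more than q + 1 points of the set, which tells it apart from
-- the lines meeting the set in a subline over F. It also excludes k = t - k, so the exponents
-- really fall into pairs. The bound `n ≥ 2` provides a second line s i, across which the scalars of
-- the two K-structures are compared by looking at u, v and u + v.
--
-- A collineation is given as a bijection of points that respects collinearity, so it brings no
-- semilinear map and no field automorphism. The map θ is shown to be multiplicative, not additive.
-- This is enough at an element g with t distinct conjugates: the power maps in the intertwining
-- equation move inside θ, and injectivity cancels θ without identifying it.
--
-- As everything is finite, surjectivity, bases and dimensions come from counting: an injection
-- between sets of equal size is onto, and a subspace with s^d elements over a field of order s has
-- dimension d. Galois theory is reduced to bounds on the number of roots of polynomial functions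
-- with a known leading coefficient.

-- Finite sets and counting

Inj : {A B : Set} → (A → B) → Set
Inj f = ∀ {x y} → f x ≡ f y → x ≡ y

to-inj : {A B : Set} (e : A ↔ B) → Inj (Inverse.to e)
to-inj e {x} {y} eq = trans (sym (Inverse.strictlyInverseʳ e x))
  (trans (cong (Inverse.from e) eq) (Inverse.strictlyInverseʳ e y))

from-inj : {A B : Set} (e : A ↔ B) → Inj (Inverse.from e)
from-inj e {x} {y} eq = trans (sym (Inverse.strictlyInverseˡ e x))
  (trans (cong (Inverse.to e) eq) (Inverse.strictlyInverseˡ e y))

fin-inj⇒surj : ∀ {n} {f : Fin n → Fin n} → Inj f → ∀ y → ∃[ x ] f x ≡ y
fin-inj⇒surj {n} {f} inj y with any? (λ x → f x ≟ᶠ y)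
... | yes p = p
fin-inj⇒surj {suc n} {f} inj y | no ¬p =
  contradiction (injective⇒≤ {f = g} g-inj) (ℕₚ.<⇒≱ ℕₚ.≤-refl)
  where
  y≢f : ∀ x → y ≢ f x
  y≢f x eq = ¬p (x , sym eq)
  g : Fin (suc n) → Fin n
  g x = punchOut (y≢f x)
  g-inj : Inj g
  g-inj {i} {j} eq = inj (punchOut-injective (y≢f i) (y≢f j) eq)

inj⇒surj : ∀ {A B : Set} {n} → A ↔ Fin n → B ↔ Fin n → {f : A → B} → Inj f → ∀ y → ∃[ x ] f x ≡ y
inj⇒surj a b {f} inj y
  with x , eq ← fin-inj⇒surj {f = Inverse.to b ∘ f ∘ Inverse.from a}
                  (λ e → from-inj a (inj (to-inj b e))) (Inverse.to b y)
  = Inverse.from a x , to-inj b eq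

inj⇒≤ : ∀ {A B : Set} {m n} → A ↔ Fin m → B ↔ Fin n → {f : A → B} → Inj f → m ≤ n
inj⇒≤ a b inj = injective⇒≤ (λ e → from-inj a (inj (to-inj b e)))

search : ∀ {A : Set} {n} → A ↔ Fin n → {P : A → Set} → (∀ x → Dec (P x)) → Dec (∃ P)
search a {P} P? = map′ (λ (i , p) → Inverse.from a i , p)
  (λ (x , p) → Inverse.to a x , subst P (sym (Inverse.strictlyInverseʳ a x)) p)
  (any? (λ i → P? (Inverse.from a i)))

↔-dec : ∀ {A : Set} {n} → A ↔ Fin n → DecidableEquality A
↔-dec a x y = map′ (to-inj a) (cong (Inverse.to a)) (Inverse.to a x ≟ᶠ Inverse.to a y)

vec↔ : ∀ {A : Set} {r} → A ↔ Fin r → ∀ n → Vec A n ↔ Fin (r ℕ.^ n)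
vec↔ a zero = mk↔ₛ′ (λ _ → zero) (λ _ → []) (λ { zero → refl }) (λ { [] → refl })
vec↔ {A} {r} a (suc n) = mk↔ₛ′ to from to-from from-to
  where
  module V = Inverse (vec↔ a n)
  module I = Inverse a
  to : Vec A (suc n) → Fin (r ℕ.^ suc n)
  to (x ∷ xs) = combine (I.to x) (V.to xs)
  pair : Fin r × Fin (r ℕ.^ n) → Vec A (suc n)
  pair (j , k) = I.from j ∷ V.from k
  from : Fin (r ℕ.^ suc n) → Vec A (suc n)
  from i = pair (remQuot (r ℕ.^ n) i)
  to-from : ∀ i → to (from i) ≡ i
  to-from i = trans (cong₂ combine (I.strictlyInverseˡ _) (V.strictlyInverseˡ _)) (combine-remQuot {r} (r ℕ.^ n) i)
  from-to : ∀ v → from (to v) ≡ v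
  from-to (x ∷ xs) = trans (cong pair (remQuot-combine (I.to x) (V.to xs)))
    (cong₂ _∷_ (I.strictlyInverseʳ x) (V.strictlyInverseʳ xs))

-- A jointly injective family of maps between pointed finite sets that preserve
-- and reflect the base point is jointly surjective when the counts agree.
cover : ∀ {A B : Set} {a b m} → A ↔ Fin a → B ↔ Fin b → (o : A) (z : B) →
        (f : Fin m → A → B) → (∀ i x → f i x ≡ z → x ≡ o) →
        (∀ i j x y → x ≢ o → f i x ≡ f j y → i ≡ j × x ≡ y) →
        m ℕ.* (a ∸ 1) ≡ b ∸ 1 → ∀ y → y ≢ z → ∃[ i ] ∃[ x ] x ≢ o × f i x ≡ y
cover {a = zero} eA eB o = contradiction (Inverse.to eA o) λ ()
cover {b = zero} eA eB o z = contradiction (Inverse.to eB z) λ ()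
cover {A} {B} {suc a} {suc b} {m} eA eB o z f f0 finj eq y y≢z = result (fin-inj⇒surj g′-inj (Inverse.to eB y))
  where
  o′ = Inverse.to eA o
  nz : Fin a → A
  nz k = Inverse.from eA (punchIn o′ k)
  nz≢o : ∀ k → nz k ≢ o
  nz≢o k e = punchInᵢ≢i o′ k (trans (sym (Inverse.strictlyInverseˡ eA _)) (cong (Inverse.to eA) e))
  h : Fin m × Fin a → B
  h (i , k) = f i (nz k)
  g : Fin (suc (m ℕ.* a)) → B
  g zero    = z
  g (suc l) = h (remQuot {m} a l)
  g-inj : Inj g
  g-inj {zero}  {zero}  e = refl
  g-inj {zero}  {suc l} e = contradiction (f0 _ _ (sym e)) (nz≢o _)
  g-inj {suc k} {zero}  e = contradiction (f0 _ _ e) (nz≢o _)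
  g-inj {suc k} {suc l} e
    with p , q ← finj _ _ _ _ (nz≢o _) e
    = cong suc (trans (sym (combine-remQuot {m} a k))
        (trans (cong₂ combine p (punchIn-injective o′ _ _ (from-inj eA q))) (combine-remQuot {m} a l)))
  g′ : Fin (suc b) → Fin (suc b)
  g′ l = Inverse.to eB (g (subst Fin (cong suc (sym eq)) l))
  subst-inj : ∀ {m n} (e : m ≡ n) → Inj (subst Fin e)
  subst-inj refl e = e
  g′-inj : Inj g′
  g′-inj e = subst-inj (cong suc (sym eq)) (g-inj (to-inj eB e))
  split : ∀ l → g l ≡ y → ∃[ i ] ∃[ x ] x ≢ o × f i x ≡ y
  split zero    e = contradiction (sym e) y≢z
  split (suc l) e = _ , _ , nz≢o _ , e
  result : ∃[ l ] g′ l ≡ Inverse.to eB y → ∃[ i ] ∃[ x ] x ≢ o × f i x ≡ y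
  result (l , e) = split (subst Fin (cong suc (sym eq)) l) (to-inj eB e)

-- Ring identities with integer coefficients

module IntegerSolver (R : CommutativeRing 0ℓ 0ℓ) where
  open CommutativeRing R hiding (refl; sym; trans)
  open import Algebra.Properties.Ring ring
  open import Algebra.Properties.Semiring.Mult semiring renaming (_×_ to _·_)
  open import Relation.Binary.Reasoning.Setoid setoid
  open import Algebra.Properties.CommutativeSemigroup +-commutativeSemigroup using (interchange)

  -- Integer coefficients: (a , b) stands for a − b.
  private
    Coeff : RawRing 0ℓ 0ℓ
    Coeff = record
      { Carrier = ℕ × ℕ
      ; _≈_ = _≡_
      ; _+_ = λ (a , b) (c , d) → a ℕ.+ c , b ℕ.+ d
      ; _*_ = λ (a , b) (c , d) → a ℕ.* c ℕ.+ b ℕ.* d , a ℕ.* d ℕ.+ b ℕ.* c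
      ; -_  = λ (a , b) → b , a
      ; 0#  = 0 , 0
      ; 1#  = 1 , 0
      }

    ⟦_⟧ᶜ : ℕ × ℕ → Carrier
    ⟦ a , b ⟧ᶜ = a · 1# + - (b · 1#)

    R′ : AlmostCommutativeRing 0ℓ 0ℓ
    R′ = fromCommutativeRing R

    +-homo : ∀ x y → ⟦ RawRing._+_ Coeff x y ⟧ᶜ ≈ ⟦ x ⟧ᶜ + ⟦ y ⟧ᶜ
    +-homo (a , b) (c , d) = begin
      (a ℕ.+ c) · 1# + - ((b ℕ.+ d) · 1#)
        ≈⟨ +-cong (×-homo-+ 1# a c) (-‿cong (×-homo-+ 1# b d)) ⟩
      a · 1# + c · 1# + - (b · 1# + d · 1#)  ≈⟨ +-congˡ (-‿+-comm _ _) ⟨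
      a · 1# + c · 1# + (- (b · 1#) + - (d · 1#)) ≈⟨ interchange _ _ _ _ ⟩
      ⟦ a , b ⟧ᶜ + ⟦ c , d ⟧ᶜ ∎

    *-homo : ∀ x y → ⟦ RawRing._*_ Coeff x y ⟧ᶜ ≈ ⟦ x ⟧ᶜ * ⟦ y ⟧ᶜ
    *-homo (a , b) (c , d) = begin
      (a ℕ.* c ℕ.+ b ℕ.* d) · 1# + - ((a ℕ.* d ℕ.+ b ℕ.* c) · 1#)
        ≈⟨ +-cong (×-homo-+ 1# (a ℕ.* c) (b ℕ.* d)) (-‿cong (×-homo-+ 1# (a ℕ.* d) (b ℕ.* c))) ⟩
      (a ℕ.* c) · 1# + (b ℕ.* d) · 1# + - ((a ℕ.* d) · 1# + (b ℕ.* c) · 1#)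
        ≈⟨ +-cong (+-cong (×1-homo-* a c) (×1-homo-* b d))
             (-‿cong (+-cong (×1-homo-* a d) (×1-homo-* b c))) ⟩
      A * C + B * D + - (A * D + B * C)      ≈⟨ +-congˡ (-‿+-comm _ _) ⟨
      A * C + B * D + (- (A * D) + - (B * C)) ≈⟨ interchange _ _ _ _ ⟩
      A * C + - (A * D) + (B * D + - (B * C)) ≈⟨ +-congˡ (+-comm _ _) ⟩
      A * C + - (A * D) + (- (B * C) + B * D)
        ≈⟨ +-cong (+-congˡ (-‿distribʳ-* A D)) (+-cong (-‿distribˡ-* B C) (lem B D)) ⟩
      A * C + A * - D + (- B * C + - B * - D)
        ≈⟨ +-cong (distribˡ A C (- D)) (distribˡ (- B) C (- D)) ⟨
      A * (C + - D) + - B * (C + - D)        ≈⟨ distribʳ _ _ _ ⟨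
      (A + - B) * (C + - D) ∎
      where
      A = a · 1#
      B = b · 1#
      C = c · 1#
      D = d · 1#
      lem : ∀ x y → x * y ≈ - x * - y
      lem x y = begin
        x * y         ≈⟨ -‿involutive _ ⟨
        - (- (x * y)) ≈⟨ -‿cong (-‿distribʳ-* x y) ⟩
        - (x * - y)   ≈⟨ -‿distribˡ-* x (- y) ⟩
        - x * - y     ∎

    -‿homo : ∀ x → ⟦ RawRing.-_ Coeff x ⟧ᶜ ≈ - ⟦ x ⟧ᶜ
    -‿homo (a , b) = begin
      b · 1# + - (a · 1#)         ≈⟨ +-comm _ _ ⟩
      - (a · 1#) + b · 1#         ≈⟨ +-congˡ (-‿involutive _) ⟨
      - (a · 1#) + - (- (b · 1#)) ≈⟨ -‿+-comm _ _ ⟩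
      - ⟦ a , b ⟧ᶜ                ∎

    -- 0# and 1# are denoted by themselves, so that solver goals mention them directly.
    ⟦_⟧ : ℕ × ℕ → Carrier
    ⟦ 0 , 0 ⟧ = 0#
    ⟦ 1 , 0 ⟧ = 1#
    ⟦ x ⟧     = ⟦ x ⟧ᶜ

    canonical : ∀ x → ⟦ x ⟧ ≈ ⟦ x ⟧ᶜ
    canonical (0 , 0)           = Setoid.sym setoid (-‿inverseʳ 0#)
    canonical (0 , suc b)       = Setoid.refl setoid
    canonical (1 , 0)           = begin
      1#               ≈⟨ +-identityʳ 1# ⟨
      1# + 0#          ≈⟨ +-congˡ (-‿inverseʳ 0#) ⟨
      1# + (0# + - 0#) ≈⟨ +-assoc _ _ _ ⟨
      1# + 0# + - 0#   ∎
    canonical (1 , suc b)       = Setoid.refl setoid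
    canonical (suc (suc a) , b) = Setoid.refl setoid

    morphism : Coeff -Raw-AlmostCommutative⟶ R′
    morphism = record
      { ⟦_⟧ = ⟦_⟧
      ; +-homo = λ x y → begin
          ⟦ RawRing._+_ Coeff x y ⟧ ≈⟨ canonical (RawRing._+_ Coeff x y) ⟩
          _              ≈⟨ +-homo x y ⟩
          _              ≈⟨ +-cong (canonical x) (canonical y) ⟨
          ⟦ x ⟧ + ⟦ y ⟧ ∎
      ; *-homo = λ x y → begin
          ⟦ RawRing._*_ Coeff x y ⟧ ≈⟨ canonical (RawRing._*_ Coeff x y) ⟩
          _              ≈⟨ *-homo x y ⟩
          _              ≈⟨ *-cong (canonical x) (canonical y) ⟨
          ⟦ x ⟧ * ⟦ y ⟧ ∎
      ; -‿homo = λ x → begin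
          ⟦ RawRing.-_ Coeff x ⟧ ≈⟨ canonical (RawRing.-_ Coeff x) ⟩
          _              ≈⟨ -‿homo x ⟩
          _              ≈⟨ -‿cong (canonical x) ⟨
          - ⟦ x ⟧        ∎
      ; 0-homo = Setoid.refl setoid
      ; 1-homo = Setoid.refl setoid }

    -- Two pairs denote the same integer when a + d = c + b. In positive characteristic different
    -- integers may still agree in the ring, so a failed test decides nothing.
    decide : ∀ x y → Maybe (⟦ x ⟧ ≈ ⟦ y ⟧)
    decide x@(a , b) y@(c , d) with a ℕ.+ d ℕₚ.≟ c ℕ.+ b
    ... | no _ = nothing
    ... | yes e = just (begin
      ⟦ x ⟧               ≈⟨ canonical x ⟩
      A + - B             ≈⟨ +-identityʳ _ ⟨
      A + - B + 0#        ≈⟨ +-congˡ (-‿inverseʳ D) ⟨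
      A + - B + (D + - D) ≈⟨ interchange _ _ _ _ ⟩
      A + D + (- B + - D) ≈⟨ +-congʳ (×-homo-+ 1# a d) ⟨
      (a ℕ.+ d) · 1# + (- B + - D) ≈⟨ +-congʳ (×-congˡ e) ⟩
      (c ℕ.+ b) · 1# + (- B + - D) ≈⟨ +-congʳ (×-homo-+ 1# c b) ⟩
      C + B + (- B + - D) ≈⟨ +-congˡ (+-comm _ _) ⟩
      C + B + (- D + - B) ≈⟨ interchange _ _ _ _ ⟩
      C + - D + (B + - B) ≈⟨ +-congˡ (-‿inverseʳ B) ⟩
      C + - D + 0#        ≈⟨ +-identityʳ _ ⟩
      C + - D             ≈⟨ canonical y ⟨
      ⟦ y ⟧               ∎)
      where
      A = a · 1#
      B = b · 1#
      C = c · 1#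
      D = d · 1#

  open Algebra.Solver.Ring Coeff R′ morphism decide public
    using (solve; _:=_; _:+_; _:*_; :-_; _:-_; con; Polynomial)

  :0 :1 : ∀ {n} → Polynomial n
  :0 = con (0 , 0)
  :1 = con (1 , 0)

-- Arithmetic, polynomial functions and Fermat's identity in a finite field

module Field {r : ℕ} (K : FiniteField r) where
  open FiniteField K public
  open CommutativeRing commutativeRing public
    using (+-assoc; +-comm; +-identityˡ; +-identityʳ; -‿inverseˡ; -‿inverseʳ;
           *-assoc; *-comm; *-identityˡ; *-identityʳ; distribˡ; distribʳ; zeroˡ; zeroʳ)
  open CommutativeRing commutativeRing
    using (ring; semiring; commutativeSemiring; *-commutativeMonoid)
  open IntegerSolver commutativeRing public
  open import Algebra.Properties.Semiring.Exp semiring public using (_^_; ^-homo-*; ^-assocʳ)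
  open import Algebra.Properties.CommutativeSemiring.Exp commutativeSemiring public using (^-distrib-*)
  open ≡-Reasoning

  infixl 6 _-_
  _-_ : Carrier → Carrier → Carrier
  x - y = x + - y

  infix 4 _≟_
  _≟_ : DecidableEquality Carrier
  _≟_ = ↔-dec enumeration

  inv : ∀ x → x ≢ 0# → Carrier
  inv x x≢0 = proj₁ (inverse x x≢0)

  inv-r : ∀ x x≢0 → x * inv x x≢0 ≡ 1#
  inv-r x x≢0 = proj₂ (inverse x x≢0)

  inv≢0 : ∀ x x≢0 → inv x x≢0 ≢ 0#
  inv≢0 x x≢0 e = 1≢0 (trans (sym (inv-r x x≢0)) (trans (cong (x *_) e) (zeroʳ x)))

  *-zero⇒ : ∀ {x y} → x * y ≡ 0# → x ≢ 0# → y ≡ 0#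
  *-zero⇒ {x} {y} e x≢0 = begin
    y                   ≡⟨ *-identityˡ y ⟨
    1# * y              ≡⟨ cong (_* y) (inv-r x x≢0) ⟨
    x * inv x x≢0 * y   ≡⟨ solve 3 (λ x i y → x :* i :* y := i :* (x :* y)) refl x _ y ⟩
    inv x x≢0 * (x * y) ≡⟨ cong (_ *_) e ⟩
    inv x x≢0 * 0#      ≡⟨ zeroʳ _ ⟩
    0# ∎

  *-≢0 : ∀ {x y} → x ≢ 0# → y ≢ 0# → x * y ≢ 0#
  *-≢0 x≢0 y≢0 e = y≢0 (*-zero⇒ e x≢0)

  -≡0⇒ : ∀ {x y} → x - y ≡ 0# → x ≡ y
  -≡0⇒ {x} {y} e = begin
    x         ≡⟨ solve 2 (λ x y → x := x :- y :+ y) refl x y ⟩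
    x - y + y ≡⟨ cong (_+ y) e ⟩
    0# + y    ≡⟨ +-identityˡ y ⟩
    y ∎

  ≡⇒-≡0 : ∀ {x y} → x ≡ y → x - y ≡ 0#
  ≡⇒-≡0 refl = -‿inverseʳ _

  *-cancelˡ : ∀ {x y z} → x ≢ 0# → x * y ≡ x * z → y ≡ z
  *-cancelˡ {x} {y} {z} x≢0 e = -≡0⇒ (*-zero⇒
    (trans (solve 3 (λ x y z → x :* (y :- z) := x :* y :- x :* z) refl x y z) (≡⇒-≡0 e)) x≢0)

  *-cancelʳ : ∀ {x y z} → x ≢ 0# → y * x ≡ z * x → y ≡ z
  *-cancelʳ x≢0 e = *-cancelˡ x≢0 (trans (*-comm _ _) (trans e (*-comm _ _)))

  div : ∀ {x} → x ≢ 0# → ∀ y → ∃[ z ] x * z ≡ y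
  div {x} x≢0 y = inv x x≢0 * y , trans (sym (*-assoc _ _ _)) (trans (cong (_* y) (inv-r x x≢0)) (*-identityˡ y))

  1^ : ∀ n → 1# ^ n ≡ 1#
  1^ zero    = refl
  1^ (suc n) = trans (*-identityˡ _) (1^ n)

  0^ : ∀ n → 0# ^ suc n ≡ 0#
  0^ n = zeroˡ _

  1<order : 1 < r
  1<order = injective⇒≤ {f = Inverse.to enumeration ∘ bit} (λ e → bit-inj (to-inj enumeration e))
    where
    bit : Fin 2 → Carrier
    bit zero       = 0#
    bit (suc zero) = 1#
    bit-inj : Inj bit
    bit-inj {zero}     {zero}     e = refl
    bit-inj {zero}     {suc zero} e = contradiction (sym e) 1≢0
    bit-inj {suc zero} {zero}     e = contradiction e 1≢0
    bit-inj {suc zero} {suc zero} e = refl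

  -- Top d c f: f is a polynomial function of degree at most d whose
  -- coefficient in degree d is c, presented in Horner form.
  Top : ℕ → Carrier → (Carrier → Carrier) → Set
  Top zero    c f = ∀ x → f x ≡ c
  Top (suc d) c f = ∃[ b ] ∃[ g ] Top d c g × (∀ x → f x ≡ b + x * g x)

  top-cong : ∀ d {c f g} → (∀ x → g x ≡ f x) → Top d c f → Top d c g
  top-cong zero    e t             = λ x → trans (e x) (t x)
  top-cong (suc d) e (b , h , t , p) = b , h , t , λ x → trans (e x) (p x)

  top-0 : ∀ d → Top d 0# (λ _ → 0#)
  top-0 zero    = λ _ → refl
  top-0 (suc d) = 0# , _ , top-0 d , λ x → sym (trans (+-identityˡ _) (zeroʳ x))

  top-const : ∀ d c → Top (suc d) 0# (λ _ → c)
  top-const d c = c , _ , top-0 d , λ x → sym (trans (cong (c +_) (zeroʳ x)) (+-identityʳ c))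

  top-+ : ∀ d {c c′ f g} → Top d c f → Top d c′ g → Top d (c + c′) (λ x → f x + g x)
  top-+ zero    s t = λ x → cong₂ _+_ (s x) (t x)
  top-+ (suc d) (b , h , s , p) (b′ , h′ , t , p′) = b + b′ , _ , top-+ d s t , λ x →
    trans (cong₂ _+_ (p x) (p′ x))
      (solve 5 (λ b x h b′ h′ → b :+ x :* h :+ (b′ :+ x :* h′) := b :+ b′ :+ x :* (h :+ h′)) refl b x (h x) b′ (h′ x))

  top-scale : ∀ d k {c f} → Top d c f → Top d (k * c) (λ x → k * f x)
  top-scale zero    k t = λ x → cong (k *_) (t x)
  top-scale (suc d) k (b , h , t , p) = k * b , _ , top-scale d k t , λ x →
    trans (cong (k *_) (p x))
      (solve 4 (λ k b x h → k :* (b :+ x :* h) := k :* b :+ x :* (k :* h)) refl k b x (h x))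

  top-up : ∀ {d c f} → Top d c f → Top (suc d) 0# f
  top-up {zero}  {c} t = top-cong 1 t (top-const 0 c)
  top-up {suc d} (b , h , t , p) = b , h , top-up t , p

  top-raise : ∀ {d e c f} → d < e → Top d c f → Top e 0# f
  top-raise {e = suc e} (s≤s d≤e) t with ℕₚ.m≤n⇒m<n∨m≡n d≤e
  ... | inj₁ d<e  = top-up (top-raise d<e t)
  ... | inj₂ refl = top-up t

  top-minus : ∀ {d e c c′ f g} → Top d c f → e < d → Top e c′ g → Top d c (λ x → f x - g x)
  top-minus {d} {c = c} {f = f} {g} s e<d t = subst (λ z → Top d z (λ x → f x - g x))
    (solve 1 (λ c → c :+ (:- :1) :* :0 := c) refl c)
    (top-cong d (λ x → solve 2 (λ f g → f :- g := f :+ (:- :1) :* g) refl (f x) (g x))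
      (top-+ d s (top-scale d (- 1#) (top-raise e<d t))))

  top-shift : ∀ {d c f} → Top d c f → Top (suc d) c (λ x → x * f x)
  top-shift t = 0# , _ , t , λ x → sym (+-identityˡ _)

  top-* : ∀ d e {c c′ f g} → Top d c f → Top e c′ g → Top (d ℕ.+ e) (c * c′) (λ x → f x * g x)
  top-* zero    e {c} s t = top-cong e (λ x → cong (_* _) (s x)) (top-scale e c t)
  top-* (suc d) e {c} {c′} {f} {g} (b , h , s , p) t = subst (λ z → Top (suc (d ℕ.+ e)) z _)
    (+-identityˡ _)
    (top-cong (suc (d ℕ.+ e))
      (λ x → trans (cong (_* g x) (p x))
        (solve 4 (λ b x h g → (b :+ x :* h) :* g := b :* g :+ x :* (h :* g)) refl b x (h x) (g x)))
      (top-+ (suc (d ℕ.+ e)) (top-raise (s≤s (ℕₚ.m≤n+m e d)) (top-scale e b t)) (top-shift (top-* d e s t))))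

  top-^ : ∀ n {d c f} → Top d c f → Top (n ℕ.* d) (c ^ n) (λ x → f x ^ n)
  top-^ zero        t = λ _ → refl
  top-^ (suc n) {d} t = top-* d (n ℕ.* d) t (top-^ n t)

  top-monic-^ : ∀ n {d f} → Top d 1# f → Top (n ℕ.* d) 1# (λ x → f x ^ n)
  top-monic-^ n {d} {f} t = subst (λ z → Top (n ℕ.* d) z (λ x → f x ^ n)) (1^ n) (top-^ n t)

  top-id : Top 1 1# id
  top-id = 0# , (λ _ → 1#) , (λ _ → refl) , λ x → sym (trans (+-identityˡ _) (*-identityʳ x))

  top-power : ∀ n → Top n 1# (_^ n)
  top-power n = subst (λ d → Top d 1# (_^ n)) (ℕₚ.*-identityʳ n) (top-monic-^ n top-id)

  -- Synthetic division along the Horner form. The quotient keeps the coefficient `c`, so that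
  -- repeated division brings `c` down to degree zero, where it is a value of the function.
  top-divide : ∀ d {c f} → Top (suc d) c f → ∀ a → ∃[ g ] Top d c g × (∀ x → f x - f a ≡ (x - a) * g x)
  top-divide zero    {c} (b , h , t , p) a = (λ _ → c) , (λ _ → refl) , λ x →
    trans (cong₂ _-_ (trans (p x) (cong (λ z → b + x * z) (t x))) (trans (p a) (cong (λ z → b + a * z) (t a))))
      (solve 4 (λ b x a c → b :+ x :* c :- (b :+ a :* c) := (x :- a) :* c) refl b x a c)
  top-divide (suc d) {c} {f} (b , h , t , p) a with g , s , e ← top-divide d t a =
    (λ x → h x + a * g x) ,
    subst (λ z → Top (suc d) z (λ x → h x + a * g x)) (+-identityʳ c) (top-+ (suc d) t (top-up (top-scale d a s))) ,
    λ x → begin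
      f x - f a                         ≡⟨ cong₂ _-_ (p x) (p a) ⟩
      b + x * h x - (b + a * h a)
        ≡⟨ solve 5 (λ b x a hx ha → b :+ x :* hx :- (b :+ a :* ha) := (x :- a) :* hx :+ a :* (hx :- ha)) refl b x a (h x) (h a) ⟩
      (x - a) * h x + a * (h x - h a)   ≡⟨ cong (λ z → (x - a) * h x + a * z) (e x) ⟩
      (x - a) * h x + a * ((x - a) * g x)
        ≡⟨ solve 4 (λ x a hx gx → (x :- a) :* hx :+ a :* ((x :- a) :* gx) := (x :- a) :* (hx :+ a :* gx)) refl x a (h x) (g x) ⟩
      (x - a) * (h x + a * g x)         ∎

  -- Induction on the degree: dividing by one root leaves a quotient that vanishes at the others.
  -- The first conclusion refutes monic functions with too many roots; the second extends identities
  -- from few points to the whole field.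
  top-roots : ∀ d {c f} → Top d c f → (ρ : Fin (suc d) → Carrier) → Inj ρ → (∀ i → f (ρ i) ≡ 0#) →
              c ≡ 0# × (∀ x → f x ≡ 0#)
  top-roots zero    t ρ inj z = c≡0 , λ x → trans (t x) c≡0
    where c≡0 = trans (sym (t (ρ zero))) (z zero)
  top-roots (suc d) {c} {f} t ρ inj z with g , s , e ← top-divide d t (ρ zero) = proj₁ ih , λ x → begin
    f x                  ≡⟨ solve 1 (λ f → f := f :- :0) refl (f x) ⟩
    f x - 0#             ≡⟨ cong (λ w → f x - w) (z zero) ⟨
    f x - f (ρ zero)     ≡⟨ e x ⟩
    (x - ρ zero) * g x   ≡⟨ cong (_ *_) (proj₂ ih x) ⟩
    (x - ρ zero) * 0#    ≡⟨ zeroʳ _ ⟩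
    0#                   ∎
    where
    g-root : ∀ i → g (ρ (suc i)) ≡ 0#
    g-root i = *-zero⇒ (trans (sym (e _)) (trans (cong₂ _-_ (z (suc i)) (z zero)) (-‿inverseʳ 0#)))
      λ eq → contradiction (inj (-≡0⇒ eq)) λ ()
    ih = top-roots d s (ρ ∘ suc) (λ eq → suc-injective (inj eq)) g-root

  top-drop : ∀ d {f} → Top (suc d) 0# f → ∃[ c ] Top d c f
  top-drop zero    (b , h , t , p) = b , λ x → trans (p x) (trans (cong (λ z → b + x * z) (t x))
    (trans (cong (b +_) (zeroʳ x)) (+-identityʳ b)))
  top-drop (suc d) (b , h , t , p) with c , s ← top-drop d t = c , b , h , s , p

  -- The product of x ≢ 0 over all of K is unchanged by x ↦ a x.
  module Fermat where
    open import Algebra.Properties.CommutativeMonoid.Sum *-commutativeMonoid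
      renaming (sum to prod; sum-cong-≗ to prod-cong; sum-permute to prod-permute; sum-remove to prod-remove;
                ∑-distrib-+ to prod-*; sum-replicate to prod-replicate)

    fermat : ∀ {s} (e : Carrier ↔ Fin s) a → a ^ s ≡ a
    fermat {zero}  e a = contradiction (Inverse.to e a) λ ()
    fermat {suc s} e a with a ≟ 0#
    ... | yes refl = 0^ s
    ... | no a≢0 = begin
      a * a ^ s          ≡⟨ cong (a *_) a^s≡1 ⟩
      a * 1#             ≡⟨ *-identityʳ a ⟩
      a ∎
      where
      open Inverse e using (to; from; strictlyInverseˡ; strictlyInverseʳ)
      b = inv a a≢0
      -- Zero contributes the factor 1, so the product of the values of `h` is nonzero and can be
      -- cancelled. `k x` is the factor by which `h` changes under x ↦ a x: 1 at zero and `a` at the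
      -- remaining `s` elements.
      h : Carrier → Carrier
      h x with x ≟ 0#
      ... | yes _ = 1#
      ... | no _  = x
      k : Carrier → Carrier
      k x with x ≟ 0#
      ... | yes _ = 1#
      ... | no _  = a
      h≢0 : ∀ x → h x ≢ 0#
      h≢0 x with x ≟ 0#
      ... | yes _   = 1≢0
      ... | no x≢0 = x≢0
      h-mul : ∀ x → h (a * x) ≡ k x * h x
      h-mul x with x ≟ 0# | (a * x) ≟ 0#
      ... | yes _    | yes _ = sym (*-identityˡ 1#)
      ... | yes refl | no ¬p = contradiction (zeroʳ a) ¬p
      ... | no x≢0   | yes p = contradiction p (*-≢0 a≢0 x≢0)
      ... | no _     | no _  = refl
      π : Permutation (suc s) (suc s)
      π = mk↔ₛ′ (λ i → to (a * from i)) (λ i → to (b * from i)) (cancels a b (inv-r a a≢0))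
            (cancels b a (trans (*-comm b a) (inv-r a a≢0)))
        where
        cancels : ∀ a b → a * b ≡ 1# → ∀ i → to (a * from (to (b * from i))) ≡ i
        cancels a b ab≡1 i = begin
          to (a * from (to (b * from i))) ≡⟨ cong (λ z → to (a * z)) (strictlyInverseʳ _) ⟩
          to (a * (b * from i))           ≡⟨ cong to (*-assoc a b _) ⟨
          to (a * b * from i)             ≡⟨ cong (λ z → to (z * from i)) ab≡1 ⟩
          to (1# * from i)                ≡⟨ cong to (*-identityˡ _) ⟩
          to (from i)                     ≡⟨ strictlyInverseˡ i ⟩
          i                               ∎
      prod≢0 : ∀ {n} (f : Fin n → Carrier) → (∀ i → f i ≢ 0#) → prod f ≢ 0#
      prod≢0 {zero}  f nz = 1≢0
      prod≢0 {suc n} f nz = *-≢0 (nz zero) (prod≢0 (f ∘ suc) (nz ∘ suc))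
      P = prod {suc s} (h ∘ from)
      Q = prod {s} (λ j → k (from (punchIn (to 0#) j)))
      prod-k : prod {suc s} (k ∘ from) * P ≡ P
      prod-k = begin
        prod {suc s} (k ∘ from) * P                     ≡⟨ prod-* {suc s} (k ∘ from) (h ∘ from) ⟨
        prod {suc s} (λ i → k (from i) * h (from i))    ≡⟨ prod-cong {suc s} (λ i → h-mul (from i)) ⟨
        prod {suc s} (λ i → h (a * from i))             ≡⟨ prod-cong {suc s} (λ i → cong h (strictlyInverseʳ (a * from i))) ⟨
        prod {suc s} (λ i → h (from (to (a * from i)))) ≡⟨ prod-permute (h ∘ from) π ⟨
        P ∎
      prod-k≡1 : prod {suc s} (k ∘ from) ≡ 1#
      prod-k≡1 = *-cancelʳ (prod≢0 (h ∘ from) (λ i → h≢0 (from i))) (trans prod-k (sym (*-identityˡ P)))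
      k0 : k (from (to 0#)) ≡ 1#
      k0 with from (to 0#) ≟ 0#
      ... | yes _ = refl
      ... | no ¬p = contradiction (strictlyInverseʳ 0#) ¬p
      k1 : ∀ j → k (from (punchIn (to 0#) j)) ≡ a
      k1 j with from (punchIn (to 0#) j) ≟ 0#
      ... | no _  = refl
      ... | yes p = contradiction (trans (sym (strictlyInverseˡ _)) (cong to p)) (punchInᵢ≢i (to 0#) j)
      prod-const : ∀ n → prod {n} (λ _ → a) ≡ a ^ n
      prod-const zero    = refl
      prod-const (suc n) = cong (a *_) (prod-const n)
      a^s≡1 : a ^ s ≡ 1#
      a^s≡1 = begin
        a ^ s                    ≡⟨ prod-const s ⟨
        prod {s} (λ _ → a)       ≡⟨ prod-cong {s} k1 ⟨
        Q                        ≡⟨ *-identityˡ Q ⟨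
        1# * Q                   ≡⟨ cong (λ z → z * Q) k0 ⟨
        k (from (to 0#)) * Q     ≡⟨ prod-remove {i = to 0#} (k ∘ from) ⟨
        prod {suc s} (k ∘ from)  ≡⟨ prod-k≡1 ⟩
        1# ∎

  open Fermat public using (fermat)

-- Frobenius maps and the Galois group of K over F

module Extension {q t : ℕ} (E : FieldExtension q t) (3≤t : 3 ≤ t) where
  open FieldExtension E public using (F; K; ι)
  module F = Field F
  open Field K public
  open FieldExtension E using (isHomomorphism)
  open RingMorphisms.IsRingHomomorphism isHomomorphism using ()
    renaming (+-homo to ι-+; *-homo to ι-*; 0#-homo to ι-0; 1#-homo to ι-1; -‿homo to ι-neg) public
  open ≡-Reasoning

  ι-inj : Inj ι
  ι-inj {a} {b} e with a F.≟ b
  ... | yes p = p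
  ... | no ¬p = contradiction (begin
      1#                        ≡⟨ ι-1 ⟨
      ι F.1#                    ≡⟨ cong ι (F.inv-r (a F.- b) a-b≢0) ⟨
      ι ((a F.- b) F.* i)       ≡⟨ ι-* _ _ ⟩
      ι (a F.- b) * ι i         ≡⟨ cong (_* ι i) (trans (ι-+ a (F.- b)) (cong (ι a +_) (ι-neg b))) ⟩
      (ι a - ι b) * ι i         ≡⟨ cong (_* ι i) (≡⇒-≡0 e) ⟩
      0# * ι i                  ≡⟨ zeroˡ _ ⟩
      0# ∎) 1≢0
    where
    a-b≢0 : a F.- b ≢ F.0#
    a-b≢0 z = ¬p (F.-≡0⇒ z)
    i = F.inv (a F.- b) a-b≢0

  InF : Carrier → Set
  InF x = ∃[ c ] ι c ≡ x

  InF? : ∀ x → Dec (InF x)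
  InF? x = search F.enumeration (λ c → ι c ≟ x)

  2≤q : 2 ≤ q
  2≤q = F.1<order

  instance
    q≢0 : NonZero q
    q≢0 = ℕ.>-nonZero (ℕₚ.≤-trans (s≤s z≤n) 2≤q)

  2≤t : 2 ≤ t
  2≤t = ℕₚ.≤-trans (ℕₚ.n≤1+n 2) 3≤t

  q^-mono-< : ∀ {i j} → i < j → q ℕ.^ i < q ℕ.^ j
  q^-mono-< = ℕₚ.^-monoʳ-< q 2≤q

  q^n<q^1+n : ∀ n → q ℕ.^ n < q ℕ.^ suc n
  q^n<q^1+n n = q^-mono-< {n} {suc n} ℕₚ.≤-refl

  n<q^n : ∀ n → n < q ℕ.^ n
  n<q^n zero    = s≤s z≤n
  n<q^n (suc n) = ℕₚ.≤-<-trans (n<q^n n) (q^n<q^1+n n)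

  ι-^ : ∀ c n → ι (c F.^ n) ≡ ι c ^ n
  ι-^ c zero    = ι-1
  ι-^ c (suc n) = trans (ι-* _ _) (cong (ι c *_) (ι-^ c n))

  ι-^q : ∀ c → ι c ^ q ≡ ι c
  ι-^q c = trans (sym (ι-^ c q)) (cong ι (F.fermat F.enumeration c))

  ιFin : Fin q → Carrier
  ιFin i = ι (Inverse.from F.enumeration i)

  ιFin-inj : Inj ιFin
  ιFin-inj e = from-inj F.enumeration (ι-inj e)

  top-drop< : ∀ {d f} → 0 < d → Top d 0# f → ∃[ c ] Top (d ∸ 1) c f
  top-drop< {suc d} _ = top-drop d

  -- A zero coefficient in degree q means degree at most q - 1, and F supplies q roots.
  vanish-on-F : ∀ {f} → Top q 0# f → (∀ c → f (ι c) ≡ 0#) → ∀ x → f x ≡ 0#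
  vanish-on-F {f} t z with c , s ← top-drop< (ℕₚ.≤-trans (s≤s z≤n) 2≤q) t =
    proj₂ (top-roots (q ∸ 1) s (ιFin ∘ inject) (λ e → inject-inj (ιFin-inj e)) (λ i → z _))
    where
    suc-pred-q : suc (q ∸ 1) ≡ q
    suc-pred-q = ℕₚ.suc-pred q
    inject : Fin (suc (q ∸ 1)) → Fin q
    inject i = inject≤ i (ℕₚ.≤-reflexive suc-pred-q)
    inject-inj : Inj inject
    inject-inj = inject≤-injective _ _ _ _

  monic-nonvanishing : ∀ {d f} → Top d 1# f → d < q ℕ.^ t → (∀ x → f x ≡ 0#) → ⊥
  monic-nonvanishing {d} {f} s d<N z = 1≢0 (proj₁ (top-roots d s
    (λ i → Inverse.from enumeration (inject≤ i d<N))
    (λ e → inject≤-injective _ _ _ _ (from-inj enumeration e)) (λ i → z _)))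

  -- The q elements of F are already roots of X^q - X; a root outside F would be one too many for a
  -- monic function of degree q.
  InF-intro : ∀ {x} → x ^ q ≡ x → InF x
  InF-intro {x} e with InF? x
  ... | yes p = p
  ... | no ¬p = contradiction
      (proj₁ (top-roots q (top-minus (top-power q) 2≤q top-id) ρ ρ-inj ρ-root)) 1≢0
    where
    ρ : Fin (suc q) → Carrier
    ρ zero    = x
    ρ (suc i) = ιFin i
    ρ-inj : Inj ρ
    ρ-inj {zero}  {zero}  e = refl
    ρ-inj {zero}  {suc j} e = contradiction (_ , sym e) ¬p
    ρ-inj {suc i} {zero}  e = contradiction (_ , e) ¬p
    ρ-inj {suc i} {suc j} e = cong suc (ιFin-inj e)
    ρ-root : ∀ i → ρ i ^ q - ρ i ≡ 0#
    ρ-root zero    = ≡⇒-≡0 e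
    ρ-root (suc i) = ≡⇒-≡0 (ι-^q _)

  -- (X + 1)^q − X^q − 1 has degree below q and vanishes on the q elements of F.
  frobenius-+1 : ∀ x → (x + 1#) ^ q ≡ x ^ q + 1#
  frobenius-+1 x = -≡0⇒ (trans (lem ((x + 1#) ^ q) (x ^ q)) (vanish-on-F top-f roots x))
    where
    lem : ∀ a b → a - (b + 1#) ≡ a + (- 1#) * b + (- 1#)
    lem = solve 2 (λ a b → a :- (b :+ :1) := a :+ (:- :1) :* b :+ (:- :1)) refl
    f : Carrier → Carrier
    f x = (x + 1#) ^ q + (- 1#) * x ^ q + (- 1#)
    monic₁ : Top q 1# (λ x → (x + 1#) ^ q)
    monic₁ = subst (λ d → Top d 1# (λ x → (x + 1#) ^ q)) (ℕₚ.*-identityʳ q)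
      (top-monic-^ q (top-cong 1 (λ x → refl)
        (subst (λ c → Top 1 c (λ x → x + 1#)) (+-identityʳ 1#) (top-+ 1 top-id (top-const 0 1#)))))
    top-f : Top q 0# f
    top-f = subst (λ c → Top q c f) (trans (+-identityʳ _) (trans (cong (1# +_) (*-identityʳ _)) (-‿inverseʳ 1#)))
      (top-+ q (top-+ q monic₁ (top-scale q (- 1#) (top-power q)))
        (top-raise {0} (ℕₚ.≤-trans (s≤s z≤n) 2≤q) (λ _ → refl)))
    roots : ∀ c → f (ι c) ≡ 0#
    roots c = begin
      f (ι c) ≡⟨ lem ((ι c + 1#) ^ q) (ι c ^ q) ⟨
      (ι c + 1#) ^ q - (ι c ^ q + 1#)
        ≡⟨ cong₂ (λ a b → a - (b + 1#)) (trans (cong (_^ q) (sym ιc+1)) (trans (ι-^q _) ιc+1)) (ι-^q c) ⟩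
      ι c + 1# - (ι c + 1#) ≡⟨ -‿inverseʳ _ ⟩
      0# ∎
      where
      ιc+1 : ι (c F.+ F.1#) ≡ ι c + 1#
      ιc+1 = trans (ι-+ c F.1#) (cong (ι c +_) ι-1)

  0^q : 0# ^ q ≡ 0#
  0^q = trans (cong (0# ^_) (sym (ℕₚ.suc-pred q))) (0^ (ℕ.pred q))

  -- By homogeneity: x = y z reduces the claim to `frobenius-+1` at z, so neither the characteristic
  -- nor binomial coefficients enter.
  frobenius-+ : ∀ x y → (x + y) ^ q ≡ x ^ q + y ^ q
  frobenius-+ x y with y ≟ 0#
  ... | yes refl = trans (cong (_^ q) (+-identityʳ x)) (sym (trans (cong (x ^ q +_) 0^q) (+-identityʳ _)))
  ... | no y≢0 with z , refl ← div y≢0 x = begin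
      (y * z + y) ^ q        ≡⟨ cong (_^ q) (solve 2 (λ y z → y :* z :+ y := y :* (z :+ :1)) refl y z) ⟩
      (y * (z + 1#)) ^ q     ≡⟨ ^-distrib-* y _ q ⟩
      y ^ q * (z + 1#) ^ q   ≡⟨ cong (y ^ q *_) (frobenius-+1 z) ⟩
      y ^ q * (z ^ q + 1#)   ≡⟨ solve 2 (λ a b → a :* (b :+ :1) := a :* b :+ a) refl (y ^ q) (z ^ q) ⟩
      y ^ q * z ^ q + y ^ q  ≡⟨ cong (_+ y ^ q) (^-distrib-* y z q) ⟨
      (y * z) ^ q + y ^ q    ∎

  Frob : ℕ → Carrier → Carrier
  Frob k x = x ^ (q ℕ.^ k)

  Frob-suc : ∀ k x → Frob (suc k) x ≡ Frob k (x ^ q)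
  Frob-suc k x = sym (^-assocʳ x q (q ℕ.^ k))

  Frob-0 : ∀ x → Frob 0 x ≡ x
  Frob-0 x = *-identityʳ x

  Frob-1 : ∀ x → Frob 1 x ≡ x ^ q
  Frob-1 x = cong (x ^_) (ℕₚ.*-identityʳ q)

  Frob-∘ : ∀ k l x → Frob (k ℕ.+ l) x ≡ Frob l (Frob k x)
  Frob-∘ k l x = trans (cong (x ^_) (ℕₚ.^-distribˡ-+-* q k l)) (sym (^-assocʳ x (q ℕ.^ k) (q ℕ.^ l)))

  Frob-t : ∀ x → Frob t x ≡ x
  Frob-t = fermat enumeration

  Frob-+ : ∀ k x y → Frob k (x + y) ≡ Frob k x + Frob k y
  Frob-+ zero    x y = trans (Frob-0 _) (sym (cong₂ _+_ (Frob-0 x) (Frob-0 y)))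
  Frob-+ (suc k) x y = begin
    Frob (suc k) (x + y)            ≡⟨ Frob-suc k _ ⟩
    Frob k ((x + y) ^ q)            ≡⟨ cong (Frob k) (frobenius-+ x y) ⟩
    Frob k (x ^ q + y ^ q)          ≡⟨ Frob-+ k _ _ ⟩
    Frob k (x ^ q) + Frob k (y ^ q) ≡⟨ cong₂ _+_ (Frob-suc k x) (Frob-suc k y) ⟨
    Frob (suc k) x + Frob (suc k) y ∎

  Frob-* : ∀ k x y → Frob k (x * y) ≡ Frob k x * Frob k y
  Frob-* k x y = ^-distrib-* x y (q ℕ.^ k)

  Frob-ι : ∀ k c → Frob k (ι c) ≡ ι c
  Frob-ι zero    c = Frob-0 _
  Frob-ι (suc k) c = trans (Frob-suc k _) (trans (cong (Frob k) (ι-^q c)) (Frob-ι k c))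

  Frob-zero : ∀ k → Frob k 0# ≡ 0#
  Frob-zero k = trans (cong (Frob k) (sym ι-0)) (trans (Frob-ι k F.0#) ι-0)

  -- These are the generators of Gal(K / F).
  record Generator : Set where
    field
      σ σ⁻¹ : Carrier → Carrier
      σ-+   : ∀ x y → σ (x + y) ≡ σ x + σ y
      σ-*   : ∀ x y → σ (x * y) ≡ σ x * σ y
      σ-ι   : ∀ c → σ (ι c) ≡ ι c
      σσ⁻¹  : ∀ x → σ (σ⁻¹ x) ≡ x
      σ⁻¹σ  : ∀ x → σ⁻¹ (σ x) ≡ x
      fixed : ∀ {x} → σ x ≡ x → InF x

    σ-0 : σ 0# ≡ 0#
    σ-0 = trans (cong σ (sym ι-0)) (trans (σ-ι F.0#) ι-0)

    σ-1 : σ 1# ≡ 1#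
    σ-1 = trans (cong σ (sym ι-1)) (trans (σ-ι F.1#) ι-1)

    σ-inj : Inj σ
    σ-inj {x} {y} e = trans (sym (σ⁻¹σ x)) (trans (cong σ⁻¹ e) (σ⁻¹σ y))

    σ-≢0 : ∀ {x} → x ≢ 0# → σ x ≢ 0#
    σ-≢0 x≢0 e = x≢0 (σ-inj (trans e (sym σ-0)))

  Frob-inverse : ∀ k → k ≤ t → ∀ x → Frob (t ∸ k) (Frob k x) ≡ x
  Frob-inverse k k≤t x = trans (sym (Frob-∘ k (t ∸ k) x)) (trans (cong (λ j → Frob j x) (ℕₚ.m+[n∸m]≡n k≤t)) (Frob-t x))

  Frob-inverse′ : ∀ k → k ≤ t → ∀ x → Frob k (Frob (t ∸ k) x) ≡ x
  Frob-inverse′ k k≤t x = trans (sym (Frob-∘ (t ∸ k) k x)) (trans (cong (λ j → Frob j x) (ℕₚ.m∸n+n≡m k≤t)) (Frob-t x))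

  Frob-inj : ∀ k → k ≤ t → Inj (Frob k)
  Frob-inj k k≤t {x} {y} e = trans (sym (Frob-inverse k k≤t x)) (trans (cong (Frob (t ∸ k)) e) (Frob-inverse k k≤t y))

  Frob-multiple : ∀ k {x} → Frob k x ≡ x → ∀ m → Frob (m ℕ.* k) x ≡ x
  Frob-multiple k e zero    = Frob-0 _
  Frob-multiple k {x} e (suc m) = trans (Frob-∘ k (m ℕ.* k) x) (trans (cong (Frob (m ℕ.* k)) e) (Frob-multiple k e m))

  -- By Bézout some multiple of k and some multiple of t differ by 1. Both Frobenius powers fix x,
  -- hence so does x ↦ x^q, whose fixed elements form F.
  Frob-fixed : ∀ k → Coprime k t → ∀ {x} → Frob k x ≡ x → InF x
  Frob-fixed k cop {x} e = InF-intro (trans (sym (Frob-1 x)) (frob1 (coprime-Bézout cop)))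
    where
    step : ∀ a b → Frob a x ≡ x → Frob b x ≡ x → 1 ℕ.+ a ≡ b → Frob 1 x ≡ x
    step a b fa fb eq = begin
      Frob 1 x              ≡⟨ cong (Frob 1) fa ⟨
      Frob 1 (Frob a x)     ≡⟨ Frob-∘ a 1 x ⟨
      Frob (a ℕ.+ 1) x      ≡⟨ cong (λ j → Frob j x) (trans (ℕₚ.+-comm a 1) eq) ⟩
      Frob b x              ≡⟨ fb ⟩
      x ∎
    frob1 : Bézout.Identity 1 k t → Frob 1 x ≡ x
    frob1 (Bézout.+- a b eq) = step (b ℕ.* t) (a ℕ.* k) (Frob-multiple t (Frob-t x) b) (Frob-multiple k e a) eq
    frob1 (Bézout.-+ a b eq) = step (a ℕ.* k) (b ℕ.* t) (Frob-multiple k e a) (Frob-multiple t (Frob-t x) b) eq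

  frobenius : ∀ k → k ≤ t → Coprime k t → Generator
  frobenius k k≤t cop = record
    { σ = Frob k ; σ⁻¹ = Frob (t ∸ k) ; σ-+ = Frob-+ k ; σ-* = Frob-* k ; σ-ι = Frob-ι k
    ; σσ⁻¹ = Frob-inverse′ k k≤t ; σ⁻¹σ = Frob-inverse k k≤t ; fixed = Frob-fixed k cop }

  top-Frob-id : ∀ d → Top (q ℕ.^ suc d) 1# (λ x → Frob (suc d) x - x)
  top-Frob-id d = top-minus (top-power (q ℕ.^ suc d))
    (ℕₚ.≤-<-trans (s≤s z≤n) (ℕₚ.≤-<-trans (n<q^n d) (q^n<q^1+n d))) top-id

  -- The product of X^{q^d} − X over 0 < d < t has degree q + ⋯ + q^{t−1} < q^t,
  -- so some g lies in no proper intermediate field.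
  private
    moved-product : ℕ → Carrier → Carrier
    moved-product zero    x = 1#
    moved-product (suc j) x = (Frob (suc j) x - x) * moved-product j x

    degree : ℕ → ℕ
    degree zero    = 0
    degree (suc j) = q ℕ.^ suc j ℕ.+ degree j

    degree< : ∀ j → degree j < q ℕ.^ suc j
    degree< zero    = ℕₚ.≤-trans (s≤s z≤n) (ℕₚ.≤-trans 2≤q (ℕₚ.≤-reflexive (sym (ℕₚ.*-identityʳ q))))
    degree< (suc j) = ℕₚ.<-≤-trans (ℕₚ.+-monoʳ-< (q ℕ.^ suc j) (degree< j))
      (ℕₚ.≤-trans (ℕₚ.≤-reflexive (cong (q ℕ.^ suc j ℕ.+_) (sym (ℕₚ.+-identityʳ (q ℕ.^ suc j)))))
        (ℕₚ.*-monoˡ-≤ (q ℕ.^ suc j) 2≤q))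

    top-product : ∀ j → Top (degree j) 1# (moved-product j)
    top-product zero    = λ _ → refl
    top-product (suc j) = subst (λ c → Top (degree (suc j)) c (moved-product (suc j))) (*-identityˡ 1#)
      (top-* (q ℕ.^ suc j) (degree j) (top-Frob-id j) (top-product j))

    factor : ∀ j {x} → moved-product j x ≢ 0# → ∀ d → 0 < d → d ≤ j → Frob d x ≢ x
    factor zero    nz (suc d) 0<d ()
    factor (suc j) {x} nz d 0<d d≤j e with ℕₚ.m≤n⇒m<n∨m≡n d≤j
    ... | inj₁ (s≤s d≤j′) = factor j (λ z → nz (trans (cong (_ *_) z) (zeroʳ _))) d 0<d d≤j′ e
    ... | inj₂ refl = nz (trans (cong (_* moved-product j x) (≡⇒-≡0 e)) (zeroˡ _))

  ∃-primitive : ∃[ x ] (∀ d → 0 < d → d < t → Frob d x ≢ x)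
  ∃-primitive with search enumeration (λ x → ¬? (moved-product (ℕ.pred t) x ≟ 0#))
  ... | yes (x , nz) = x , λ d 0<d d<t → factor (ℕ.pred t) nz d 0<d (ℕₚ.≤-pred (subst (suc d ≤_) (sym t≡) d<t))
    where t≡ = ℕₚ.suc-pred t {{ℕ.>-nonZero (ℕₚ.≤-trans (s≤s z≤n) 3≤t)}}
  ... | no ¬p = ⊥-elim (monic-nonvanishing (top-product (ℕ.pred t))
      (subst (λ s → degree (ℕ.pred t) < q ℕ.^ s) (ℕₚ.suc-pred t {{ℕ.>-nonZero (ℕₚ.≤-trans (s≤s z≤n) 3≤t)}}) (degree< (ℕ.pred t)))
      λ x → decidable-stable (_ ≟ 0#) (λ nz → ¬p (x , nz)))

  g : Carrier
  g = proj₁ ∃-primitive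

  g-moved : ∀ d → 0 < d → d < t → Frob d g ≢ g
  g-moved = proj₂ ∃-primitive

  private
    distinct : ∀ {i j} → i < j → j < t → Frob i g ≢ Frob j g
    distinct {i} {j} i<j j<t e = g-moved (j ∸ i) (ℕₚ.m<n⇒0<n∸m i<j) (ℕₚ.≤-<-trans (ℕₚ.m∸n≤m j i) j<t)
      (Frob-inj i (ℕₚ.<⇒≤ (ℕₚ.<-trans i<j j<t)) (trans (sym (Frob-∘ (j ∸ i) i g))
        (trans (cong (λ k → Frob k g) (ℕₚ.m∸n+n≡m (ℕₚ.<⇒≤ i<j))) (sym e))))

  conjugates-distinct : ∀ {i j} → i < t → j < t → Frob i g ≡ Frob j g → i ≡ j
  conjugates-distinct {i} {j} i<t j<t e with ℕₚ.<-cmp i j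
  ... | tri≈ _ i≡j _ = i≡j
  ... | tri< i<j _ _ = contradiction e (distinct i<j j<t)
  ... | tri> _ _ j<i = contradiction (sym e) (distinct j<i i<t)

  -- Coefficients are listed from degree 0 upwards. For `d = t` and `x = g` these are the
  -- coordinates of K over F in the power basis 1, g, ..., g^(t-1).
  ev : ∀ {d} → Vec F.Carrier d → Carrier → Carrier
  ev []       x = 0#
  ev (c ∷ cs) x = ι c + x * ev cs x

  top-ev : ∀ {d} (cs : Vec F.Carrier (suc d)) → ∃[ c ] Top d c (ev cs)
  top-ev {zero}  (c ∷ []) = ι c , λ x → trans (cong (ι c +_) (zeroʳ x)) (+-identityʳ _)
  top-ev {suc d} (c ∷ cs) with l , s ← top-ev cs = l , ι c , ev cs , s , λ _ → refl

  ev-- : ∀ {d} (cs ds : Vec F.Carrier d) x → ev (zipWith F._-_ cs ds) x ≡ ev cs x - ev ds x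
  ev-- []       []       x = sym (-‿inverseʳ 0#)
  ev-- (c ∷ cs) (d ∷ ds) x = trans (cong₂ (λ a b → a + x * b) (trans (ι-+ c _) (cong (ι c +_) (ι-neg d))) (ev-- cs ds x))
    (solve 5 (λ c d x a b → c :- d :+ x :* (a :- b) := c :+ x :* a :- (d :+ x :* b)) refl (ι c) (ι d) x _ _)

  -- Too many roots make the polynomial vanish everywhere, in particular at 0, which kills the
  -- constant coefficient. As the roots are nonzero, the factor x can then be cancelled and the tail
  -- has one coefficient and one root less.
  ev-zero : ∀ {d} (cs : Vec F.Carrier d) (ρ : Fin d → Carrier) → Inj ρ → (∀ i → ρ i ≢ 0#) →
            (∀ i → ev cs (ρ i) ≡ 0#) → cs ≡ replicate d F.0#
  ev-zero []       ρ inj nz z = refl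
  ev-zero {suc d} (c ∷ cs) ρ inj nz z = cong₂ _∷_ c≡0 (ev-zero cs (ρ ∘ suc) (λ e → suc-injective (inj e)) (nz ∘ suc)
      λ i → *-zero⇒ (begin
        ρ (suc i) * ev cs (ρ (suc i))           ≡⟨ +-identityˡ _ ⟨
        0# + ρ (suc i) * ev cs (ρ (suc i))      ≡⟨ cong (_+ ρ (suc i) * ev cs (ρ (suc i))) (trans (cong ι c≡0) ι-0) ⟨
        ev (c ∷ cs) (ρ (suc i))                 ≡⟨ z (suc i) ⟩
        0# ∎) (nz (suc i)))
    where
    vanishes = proj₂ (top-roots d (proj₂ (top-ev (c ∷ cs))) ρ inj z)
    c≡0 : c ≡ F.0#
    c≡0 = ι-inj (begin
      ι c                ≡⟨ solve 2 (λ c e → c := c :+ :0 :* e) refl (ι c) (ev cs 0#) ⟩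
      ev (c ∷ cs) 0#     ≡⟨ vanishes 0# ⟩
      0#                 ≡⟨ ι-0 ⟨
      ι F.0# ∎)

  zipWith-≡ : ∀ {d} (cs ds : Vec F.Carrier d) → zipWith F._-_ cs ds ≡ replicate d F.0# → cs ≡ ds
  zipWith-≡ []       []       e = refl
  zipWith-≡ (c ∷ cs) (d ∷ ds) e = cong₂ _∷_ (F.-≡0⇒ (∷-injectiveˡ e)) (zipWith-≡ cs ds (∷-injectiveʳ e))

  record Endo (σ : Carrier → Carrier) : Set where
    field
      σ-+ : ∀ x y → σ (x + y) ≡ σ x + σ y
      σ-* : ∀ x y → σ (x * y) ≡ σ x * σ y
      σ-ι : ∀ c → σ (ι c) ≡ ι c

    σ-^ : ∀ x n → σ (x ^ n) ≡ σ x ^ n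
    σ-^ x zero    = trans (cong σ (sym ι-1)) (trans (σ-ι F.1#) ι-1)
    σ-^ x (suc n) = trans (σ-* x _) (cong (σ x *_) (σ-^ x n))

    σ-ev : ∀ {d} (cs : Vec F.Carrier d) x → σ (ev cs x) ≡ ev cs (σ x)
    σ-ev []       x = trans (cong σ (sym ι-0)) (trans (σ-ι F.0#) ι-0)
    σ-ev (c ∷ cs) x = trans (σ-+ _ _) (cong₂ _+_ (σ-ι c) (trans (σ-* x _) (cong (σ x *_) (σ-ev cs x))))

  Frob-endo : ∀ k → Endo (Frob k)
  Frob-endo k = record { σ-+ = Frob-+ k ; σ-* = Frob-* k ; σ-ι = Frob-ι k }

  conj : Fin t → Carrier
  conj i = Frob (toℕ i) g

  conj-inj : Inj conj
  conj-inj e = toℕ-injective (conjugates-distinct (toℕ<n _) (toℕ<n _) e)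

  -- Frobenius powers commute with `ev`, so a polynomial over F of degree below t that vanishes at g
  -- vanishes at its t distinct conjugates as well.
  ev-g-inj : ∀ {cs ds : Vec F.Carrier t} → ev cs g ≡ ev ds g → cs ≡ ds
  ev-g-inj {cs} {ds} e = zipWith-≡ cs ds (ev-zero (zipWith F._-_ cs ds) conj conj-inj conj≢0 λ i → begin
      ev (zipWith F._-_ cs ds) (conj i)          ≡⟨ Endo.σ-ev (Frob-endo (toℕ i)) (zipWith F._-_ cs ds) g ⟨
      Frob (toℕ i) (ev (zipWith F._-_ cs ds) g)  ≡⟨ cong (Frob (toℕ i)) (trans (ev-- cs ds g) (≡⇒-≡0 e)) ⟩
      Frob (toℕ i) 0#                            ≡⟨ Frob-zero (toℕ i) ⟩
      0# ∎)
    where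
    g≢0 : g ≢ 0#
    g≢0 z = g-moved 1 (s≤s z≤n) 2≤t (trans (cong (Frob 1) z) (trans (Frob-zero 1) (sym z)))
    conj≢0 : ∀ i → conj i ≢ 0#
    conj≢0 i z = g≢0 (Frob-inj (toℕ i) (ℕₚ.<⇒≤ (toℕ<n i)) (trans z (sym (Frob-zero (toℕ i)))))

  ev-g-surj : ∀ x → ∃[ cs ] ev {t} cs g ≡ x
  ev-g-surj = inj⇒surj (vec↔ F.enumeration t) enumeration ev-g-inj

  -- σ g is a root of the polynomial of degree t over F satisfied by g, whose roots are the conjugates of g.
  endo-frobenius : ∀ {σ} → Endo σ → ∃[ k ] k < t × (∀ x → σ x ≡ Frob k x)
  endo-frobenius {σ} endo with any? (λ i → σ g ≟ conj i)
  ... | yes (i , e) = toℕ i , toℕ<n i , λ x → let (cs , eq) = ev-g-surj x in begin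
      σ x                      ≡⟨ cong σ eq ⟨
      σ (ev cs g)              ≡⟨ Endo.σ-ev endo cs g ⟩
      ev cs (σ g)              ≡⟨ cong (ev cs) e ⟩
      ev cs (Frob (toℕ i) g)   ≡⟨ Endo.σ-ev (Frob-endo (toℕ i)) cs g ⟨
      Frob (toℕ i) (ev cs g)   ≡⟨ cong (Frob (toℕ i)) eq ⟩
      Frob (toℕ i) x ∎
  ... | no ¬p = contradiction (proj₁ (top-roots t top-f ρ ρ-inj ρ-root)) 1≢0
    where
    cs = proj₁ (ev-g-surj (g ^ t))
    f : Carrier → Carrier
    f x = x ^ t - ev cs x
    top-ev-< : ∀ {t} → 0 < t → (cs : Vec F.Carrier t) → ∃[ d ] ∃[ c ] d < t × Top d c (ev cs)
    top-ev-< {suc t} _ cs = t , proj₁ (top-ev cs) , ℕₚ.≤-refl , proj₂ (top-ev cs)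
    top-f : Top t 1# f
    top-f with d , c , d<t , s ← top-ev-< (ℕₚ.≤-trans (s≤s z≤n) 3≤t) cs = top-minus (top-power t) d<t s
    f-root : ∀ {τ} → Endo τ → f (τ g) ≡ 0#
    f-root {τ} en = ≡⇒-≡0 (begin
      τ g ^ t       ≡⟨ Endo.σ-^ en g t ⟨
      τ (g ^ t)     ≡⟨ cong τ (proj₂ (ev-g-surj (g ^ t))) ⟨
      τ (ev cs g)   ≡⟨ Endo.σ-ev en cs g ⟩
      ev cs (τ g)   ∎)
    ρ : Fin (suc t) → Carrier
    ρ zero    = σ g
    ρ (suc i) = conj i
    ρ-inj : Inj ρ
    ρ-inj {zero}  {zero}  e = refl
    ρ-inj {zero}  {suc j} e = contradiction (j , e) ¬p
    ρ-inj {suc i} {zero}  e = contradiction (i , sym e) ¬p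
    ρ-inj {suc i} {suc j} e = cong suc (conj-inj e)
    ρ-root : ∀ i → f (ρ i) ≡ 0#
    ρ-root zero    = f-root endo
    ρ-root (suc i) = f-root (Frob-endo (toℕ i))

  -- For a common divisor d of k and t, the trace Σ_j X^{q^{dj}} maps K into Fix(Frob k) = F,
  -- so its q-th power minus itself vanishes on K; the degree q^{t−d+1} then forces d ≤ 1.
  private
    Tr : ℕ → ℕ → Carrier → Carrier
    Tr d zero    x = 0#
    Tr d (suc j) x = Frob (j ℕ.* d) x + Tr d j x

    Tr-shift : ∀ d j x → Frob d (Tr d j x) + x ≡ Frob (j ℕ.* d) x + Tr d j x
    Tr-shift d zero    x = trans (cong (_+ x) (Frob-zero d)) (trans (+-comm 0# x) (cong (_+ 0#) (sym (Frob-0 x))))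
    Tr-shift d (suc j) x = begin
      Frob d (Frob (j ℕ.* d) x + Tr d j x) + x         ≡⟨ cong (_+ x) (Frob-+ d _ _) ⟩
      Frob d (Frob (j ℕ.* d) x) + Frob d (Tr d j x) + x ≡⟨ +-assoc _ _ _ ⟩
      Frob d (Frob (j ℕ.* d) x) + (Frob d (Tr d j x) + x)
        ≡⟨ cong₂ _+_ (sym (Frob-∘ (j ℕ.* d) d x)) (Tr-shift d j x) ⟩
      Frob (j ℕ.* d ℕ.+ d) x + (Frob (j ℕ.* d) x + Tr d j x)
        ≡⟨ cong (λ k → Frob k x + Tr d (suc j) x) (ℕₚ.+-comm (j ℕ.* d) d) ⟩
      Frob (suc j ℕ.* d) x + Tr d (suc j) x ∎

    top-Tr : ∀ d j → 0 < d → Top (q ℕ.^ (j ℕ.* d)) 1# (Tr d (suc j))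
    top-Tr d zero    0<d = top-cong 1 (λ x → trans (+-identityʳ _) (Frob-0 x)) top-id
    top-Tr d (suc j) 0<d = top-cong (q ℕ.^ (suc j ℕ.* d))
      (λ x → solve 2 (λ a b → a :+ b := a :- (:- :1) :* b) refl (Frob (suc j ℕ.* d) x) (Tr d (suc j) x))
      (top-minus (top-power (q ℕ.^ (suc j ℕ.* d))) (q^-mono-< {j ℕ.* d} {suc j ℕ.* d} (ℕₚ.+-monoˡ-≤ (j ℕ.* d) 0<d))
        (top-scale (q ℕ.^ (j ℕ.* d)) (- 1#) (top-Tr d j 0<d)))

  fixed⇒coprime : ∀ k → (∀ {x} → Frob k x ≡ x → InF x) → Coprime k t
  fixed⇒coprime k fix {zero} (_ , divides r eq) = contradiction (subst (3 ≤_) (trans eq (ℕₚ.*-zeroʳ r)) 3≤t) λ ()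
  fixed⇒coprime k fix {suc zero} _ = refl
  fixed⇒coprime k fix {d@(suc (suc _))} (_ , divides zero eq) = contradiction (subst (3 ≤_) eq 3≤t) λ ()
  fixed⇒coprime k fix {d@(suc (suc _))} (divides m k≡ , divides (suc j) t≡) =
    ⊥-elim (monic-nonvanishing top-f (subst (λ s → q ℕ.^ suc (j ℕ.* d) < q ℕ.^ s) (sym t≡)
      (q^-mono-< {suc (j ℕ.* d)} {suc j ℕ.* d} (s≤s (s≤s (ℕₚ.m≤n+m (j ℕ.* d) _))))) λ x → ≡⇒-≡0 (Tr^q x))
    where
    Tr-fixed : ∀ x → Frob d (Tr d (suc j) x) ≡ Tr d (suc j) x
    Tr-fixed x = begin
      Frob d T                                 ≡⟨ solve 2 (λ a x → a := a :+ x :- x) refl (Frob d T) x ⟩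
      Frob d T + x - x                         ≡⟨ cong (_- x) (Tr-shift d (suc j) x) ⟩
      Frob (suc j ℕ.* d) x + T - x
        ≡⟨ cong (λ z → z + T - x) (trans (cong (λ k → Frob k x) (sym t≡)) (Frob-t x)) ⟩
      x + T - x                                ≡⟨ solve 2 (λ a x → x :+ a :- x := a) refl T x ⟩
      T ∎
      where T = Tr d (suc j) x
    Tr^q : ∀ x → Tr d (suc j) x ^ q ≡ Tr d (suc j) x
    Tr^q x with c , e ← fix (trans (cong (λ k → Frob k (Tr d (suc j) x)) k≡) (Frob-multiple d (Tr-fixed x) m)) =
      trans (cong (_^ q) (sym e)) (trans (ι-^q c) e)
    top-f : Top (q ℕ.^ suc (j ℕ.* d)) 1# (λ x → Tr d (suc j) x ^ q - Tr d (suc j) x)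
    top-f = top-minus (top-monic-^ q (top-Tr d j (s≤s z≤n))) (q^n<q^1+n (j ℕ.* d)) (top-Tr d j (s≤s z≤n))

  ∃∉F : ∃[ x ] ¬ InF x
  ∃∉F = g , λ (c , e) → g-moved 1 (s≤s z≤n) 2≤t
    (trans (cong (Frob 1) (sym e)) (trans (Frob-ι 1 c) e))

-- Identities for coordinate vectors

module VectorLaws {r : ℕ} (K : FiniteField r) where
  open Field K
  open module Vec′ {N : ℕ} = Vectors K N public

  +ᵥ-assoc : ∀ {N} (u v w : V {N}) → u +ᵥ v +ᵥ w ≡ u +ᵥ (v +ᵥ w)
  +ᵥ-assoc []      []      []      = refl
  +ᵥ-assoc (x ∷ u) (y ∷ v) (z ∷ w) = cong₂ _∷_ (+-assoc x y z) (+ᵥ-assoc u v w)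

  +ᵥ-comm : ∀ {N} (u v : V {N}) → u +ᵥ v ≡ v +ᵥ u
  +ᵥ-comm []      []      = refl
  +ᵥ-comm (x ∷ u) (y ∷ v) = cong₂ _∷_ (+-comm x y) (+ᵥ-comm u v)

  +ᵥ-identityˡ : ∀ {N} (v : V {N}) → 0ᵥ +ᵥ v ≡ v
  +ᵥ-identityˡ []      = refl
  +ᵥ-identityˡ (x ∷ v) = cong₂ _∷_ (+-identityˡ x) (+ᵥ-identityˡ v)

  +ᵥ-identityʳ : ∀ {N} (v : V {N}) → v +ᵥ 0ᵥ ≡ v
  +ᵥ-identityʳ v = trans (+ᵥ-comm v 0ᵥ) (+ᵥ-identityˡ v)

  *ᵥ-distrib-+ᵥ : ∀ {N} a (u v : V {N}) → a *ᵥ (u +ᵥ v) ≡ a *ᵥ u +ᵥ a *ᵥ v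
  *ᵥ-distrib-+ᵥ a []      []      = refl
  *ᵥ-distrib-+ᵥ a (x ∷ u) (y ∷ v) = cong₂ _∷_ (distribˡ a x y) (*ᵥ-distrib-+ᵥ a u v)

  *ᵥ-distrib-+ : ∀ {N} a b (v : V {N}) → (a + b) *ᵥ v ≡ a *ᵥ v +ᵥ b *ᵥ v
  *ᵥ-distrib-+ a b []      = refl
  *ᵥ-distrib-+ a b (x ∷ v) = cong₂ _∷_ (distribʳ x a b) (*ᵥ-distrib-+ a b v)

  *ᵥ-assoc : ∀ {N} a b (v : V {N}) → (a * b) *ᵥ v ≡ a *ᵥ b *ᵥ v
  *ᵥ-assoc a b []      = refl
  *ᵥ-assoc a b (x ∷ v) = cong₂ _∷_ (*-assoc a b x) (*ᵥ-assoc a b v)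

  *ᵥ-identity : ∀ {N} (v : V {N}) → 1# *ᵥ v ≡ v
  *ᵥ-identity []      = refl
  *ᵥ-identity (x ∷ v) = cong₂ _∷_ (*-identityˡ x) (*ᵥ-identity v)

  *ᵥ-zeroˡ : ∀ {N} (v : V {N}) → 0# *ᵥ v ≡ 0ᵥ
  *ᵥ-zeroˡ []      = refl
  *ᵥ-zeroˡ (x ∷ v) = cong₂ _∷_ (zeroˡ x) (*ᵥ-zeroˡ v)

  *ᵥ-zeroʳ : ∀ {N} a → a *ᵥ 0ᵥ {N} ≡ 0ᵥ
  *ᵥ-zeroʳ {zero}  a = refl
  *ᵥ-zeroʳ {suc N} a = cong₂ _∷_ (zeroʳ a) (*ᵥ-zeroʳ a)

  infixl 6 _-ᵥ_
  -- Subtraction is the addition of a scalar multiple, so a subspace over K contains differences by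
  -- its two closure properties.
  _-ᵥ_ : ∀ {N} → V {N} → V → V
  u -ᵥ v = u +ᵥ (- 1#) *ᵥ v

  -ᵥ-self : ∀ {N} (v : V {N}) → v -ᵥ v ≡ 0ᵥ
  -ᵥ-self []      = refl
  -ᵥ-self (x ∷ v) = cong₂ _∷_ (solve 1 (λ x → x :+ (:- :1) :* x := :0) refl x) (-ᵥ-self v)

  -ᵥ-cancel : ∀ {N} (u v : V {N}) → u -ᵥ v +ᵥ v ≡ u
  -ᵥ-cancel []      []      = refl
  -ᵥ-cancel (x ∷ u) (y ∷ v) = cong₂ _∷_ (solve 2 (λ x y → x :+ (:- :1) :* y :+ y := x) refl x y) (-ᵥ-cancel u v)

  -ᵥ≡0⇒ : ∀ {N} {u v : V {N}} → u -ᵥ v ≡ 0ᵥ → u ≡ v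
  -ᵥ≡0⇒ {u = u} {v} e = trans (sym (-ᵥ-cancel u v)) (trans (cong (_+ᵥ v) e) (+ᵥ-identityˡ v))

  *ᵥ-≡0 : ∀ {N} {a} {v : V {N}} → a *ᵥ v ≡ 0ᵥ → a ≢ 0# → v ≡ 0ᵥ
  *ᵥ-≡0 {v = []}    e a≢0 = refl
  *ᵥ-≡0 {v = x ∷ v} e a≢0 = cong₂ _∷_ (*-zero⇒ (∷-injectiveˡ e) a≢0) (*ᵥ-≡0 (∷-injectiveʳ e) a≢0)

  *ᵥ-≢0 : ∀ {N} {a} {v : V {N}} → v ≢ 0ᵥ → a *ᵥ v ≡ 0ᵥ → a ≡ 0#
  *ᵥ-≢0 {a = a} v≢0 e = decidable-stable (a ≟ 0#) (λ a≢0 → v≢0 (*ᵥ-≡0 e a≢0))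

  *ᵥ-nonzero : ∀ {N} {a} {v : V {N}} → a ≢ 0# → v ≢ 0ᵥ → a *ᵥ v ≢ 0ᵥ
  *ᵥ-nonzero a≢0 v≢0 e = v≢0 (*ᵥ-≡0 e a≢0)

  *ᵥ-inv : ∀ {N} {a} (a≢0 : a ≢ 0#) {u v : V {N}} → u ≡ a *ᵥ v → v ≡ inv a a≢0 *ᵥ u
  *ᵥ-inv {a = a} a≢0 {u} {v} refl = sym (trans (sym (*ᵥ-assoc (inv a a≢0) a v))
    (trans (cong (_*ᵥ v) (trans (*-comm _ _) (inv-r a a≢0))) (*ᵥ-identity v)))

  scalar≢0 : ∀ {N} {a} {u v : V {N}} → u ≢ 0ᵥ → u ≡ a *ᵥ v → a ≢ 0#
  scalar≢0 u≢0 e refl = u≢0 (trans e (*ᵥ-zeroˡ _))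

  *ᵥ-cancelʳ : ∀ {N} {a b} {v : V {N}} → v ≢ 0ᵥ → a *ᵥ v ≡ b *ᵥ v → a ≡ b
  *ᵥ-cancelʳ {a = a} {b} {v} v≢0 e = -≡0⇒ (*ᵥ-≢0 v≢0 (trans (lemma v) (trans (cong (_-ᵥ b *ᵥ v) e) (-ᵥ-self _))))
    where
    lemma : ∀ {N} (v : V {N}) → (a - b) *ᵥ v ≡ a *ᵥ v -ᵥ b *ᵥ v
    lemma []      = refl
    lemma (x ∷ v) = cong₂ _∷_ (solve 3 (λ a b x → (a :- b) :* x := a :* x :+ (:- :1) :* (b :* x)) refl a b x) (lemma v)

  +ᵥ-cancelʳ : ∀ {N} (u v : V {N}) → u +ᵥ v -ᵥ v ≡ u
  +ᵥ-cancelʳ []      []      = refl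
  +ᵥ-cancelʳ (x ∷ u) (y ∷ v) = cong₂ _∷_ (solve 2 (λ x y → x :+ y :+ (:- :1) :* y := x) refl x y) (+ᵥ-cancelʳ u v)

  -ᵥ-cancelʳ : ∀ {N} (w w′ u : V {N}) → w -ᵥ u -ᵥ (w′ -ᵥ u) ≡ w -ᵥ w′
  -ᵥ-cancelʳ []      []        []      = refl
  -ᵥ-cancelʳ (x ∷ w) (x′ ∷ w′) (y ∷ u) = cong₂ _∷_
    (solve 3 (λ x x′ y → x :+ (:- :1) :* y :+ (:- :1) :* (x′ :+ (:- :1) :* y) := x :+ (:- :1) :* x′) refl x x′ y) (-ᵥ-cancelʳ w w′ u)

  -- For a subspace T, the condition w - a u ∈ T says that w represents a u modulo T. This identity
  -- and the next three give the calculus of that relation: sums of vectors, sums of scalars,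
  -- composition, and uniqueness of the scalar.
  -ᵥ-*ᵥ-sum : ∀ {N} a (w w′ u v : V {N}) → (w -ᵥ a *ᵥ u) +ᵥ (w′ -ᵥ a *ᵥ v) ≡ (w +ᵥ w′) -ᵥ a *ᵥ (u +ᵥ v)
  -ᵥ-*ᵥ-sum a []      []        []      []      = refl
  -ᵥ-*ᵥ-sum a (x ∷ w) (x′ ∷ w′) (y ∷ u) (z ∷ v) = cong₂ _∷_
    (solve 5 (λ a x x′ y z → x :+ (:- :1) :* (a :* y) :+ (x′ :+ (:- :1) :* (a :* z)) := x :+ x′ :+ (:- :1) :* (a :* (y :+ z))) refl a x x′ y z)
    (-ᵥ-*ᵥ-sum a w w′ u v)

  -ᵥ-*ᵥ-scalars : ∀ {N} a b (w w′ u : V {N}) → (w -ᵥ a *ᵥ u) +ᵥ (w′ -ᵥ b *ᵥ u) ≡ (w +ᵥ w′) -ᵥ (a + b) *ᵥ u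
  -ᵥ-*ᵥ-scalars a b []      []        []      = refl
  -ᵥ-*ᵥ-scalars a b (x ∷ w) (x′ ∷ w′) (y ∷ u) = cong₂ _∷_
    (solve 5 (λ a b x x′ y → x :+ (:- :1) :* (a :* y) :+ (x′ :+ (:- :1) :* (b :* y)) := x :+ x′ :+ (:- :1) :* ((a :+ b) :* y)) refl a b x x′ y)
    (-ᵥ-*ᵥ-scalars a b w w′ u)

  -ᵥ-*ᵥ-compose : ∀ {N} a b (z w u : V {N}) → (z -ᵥ b *ᵥ w) +ᵥ b *ᵥ (w -ᵥ a *ᵥ u) ≡ z -ᵥ (b * a) *ᵥ u
  -ᵥ-*ᵥ-compose a b []      []      []      = refl
  -ᵥ-*ᵥ-compose a b (x ∷ z) (y ∷ w) (v ∷ u) = cong₂ _∷_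
    (solve 5 (λ a b x y v → x :+ (:- :1) :* (b :* y) :+ b :* (y :+ (:- :1) :* (a :* v)) := x :+ (:- :1) :* (b :* a :* v)) refl a b x y v)
    (-ᵥ-*ᵥ-compose a b z w u)

  -ᵥ-*ᵥ-difference : ∀ {N} a b (w u : V {N}) → (w -ᵥ a *ᵥ u) -ᵥ (w -ᵥ b *ᵥ u) ≡ (b - a) *ᵥ u
  -ᵥ-*ᵥ-difference a b []      []      = refl
  -ᵥ-*ᵥ-difference a b (x ∷ w) (y ∷ u) = cong₂ _∷_
    (solve 4 (λ a b x y → x :+ (:- :1) :* (a :* y) :+ (:- :1) :* (x :+ (:- :1) :* (b :* y)) := (b :- a) :* y) refl a b x y)
    (-ᵥ-*ᵥ-difference a b w u)

  +ᵥ-exchange : ∀ {N} {u v u′ v′ : V {N}} → u +ᵥ v ≡ u′ +ᵥ v′ → u -ᵥ u′ ≡ v′ -ᵥ v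
  +ᵥ-exchange {u = u} {v} {u′} {v′} e = trans (sym (left u v u′)) (trans (cong (λ z → z -ᵥ v -ᵥ u′) e) (right u′ v′ v))
    where
    left : ∀ {N} (u v u′ : V {N}) → u +ᵥ v -ᵥ v -ᵥ u′ ≡ u -ᵥ u′
    left u v u′ = cong (_-ᵥ u′) (+ᵥ-cancelʳ u v)
    right : ∀ {N} (u v w : V {N}) → u +ᵥ v -ᵥ w -ᵥ u ≡ v -ᵥ w
    right []      []      []      = refl
    right (x ∷ u) (y ∷ v) (z ∷ w) = cong₂ _∷_ (solve 3 (λ x y z → x :+ y :+ (:- :1) :* z :+ (:- :1) :* x := y :+ (:- :1) :* z) refl x y z) (right u v w)

  -- Two expressions for one vector: when x ∈ T₁, y ∈ T₂, w represents a (x + y) modulo T₂ and b (x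
  -- + y) modulo T₁, the first shows it to lie in T₂ and the second in T₁.
  -ᵥ-*ᵥ-components : ∀ {N} a b (w x y : V {N}) →
    (w -ᵥ a *ᵥ (x +ᵥ y)) +ᵥ (a - b) *ᵥ y ≡ w -ᵥ (a *ᵥ x +ᵥ b *ᵥ y) ×
    (w -ᵥ b *ᵥ (x +ᵥ y)) +ᵥ (b - a) *ᵥ x ≡ w -ᵥ (a *ᵥ x +ᵥ b *ᵥ y)
  -ᵥ-*ᵥ-components a b []      []      []      = refl , refl
  -ᵥ-*ᵥ-components a b (w ∷ ws) (x ∷ xs) (y ∷ ys) = cong₂ _∷_
      (solve 5 (λ a b w x y → w :+ (:- :1) :* (a :* (x :+ y)) :+ (a :- b) :* y := w :+ (:- :1) :* (a :* x :+ b :* y)) refl a b w x y)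
      (proj₁ (-ᵥ-*ᵥ-components a b ws xs ys)) , cong₂ _∷_
      (solve 5 (λ a b w x y → w :+ (:- :1) :* (b :* (x :+ y)) :+ (b :- a) :* x := w :+ (:- :1) :* (a :* x :+ b :* y)) refl a b w x y)
      (proj₂ (-ᵥ-*ᵥ-components a b ws xs ys))

  +ᵥ-interchange : ∀ {N} (u v w z : V {N}) → u +ᵥ v +ᵥ (w +ᵥ z) ≡ u +ᵥ w +ᵥ (v +ᵥ z)
  +ᵥ-interchange []      []      []      []      = refl
  +ᵥ-interchange (a ∷ u) (b ∷ v) (c ∷ w) (d ∷ z) = cong₂ _∷_
    (solve 4 (λ a b c d → a :+ b :+ (c :+ d) := a :+ c :+ (b :+ d)) refl a b c d) (+ᵥ-interchange u v w z)

  -ᵥ-cancelˡ : ∀ {N} (u v w : V {N}) → u +ᵥ v -ᵥ (u +ᵥ w) ≡ v -ᵥ w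
  -ᵥ-cancelˡ []      []      []      = refl
  -ᵥ-cancelˡ (x ∷ u) (y ∷ v) (z ∷ w) = cong₂ _∷_
    (solve 3 (λ x y z → x :+ y :+ (:- :1) :* (x :+ z) := y :+ (:- :1) :* z) refl x y z) (-ᵥ-cancelˡ u v w)

  infix 4 _≟ᵥ_
  _≟ᵥ_ : ∀ {N} → DecidableEquality (V {N})
  _≟ᵥ_ = ≡-dec _≟_

-- Bases and dimension over a finite scalar field

module LinearAlgebra {r s : ℕ} (K : FiniteField r) (S : FiniteField s)
  (e : FiniteField.Carrier S → FiniteField.Carrier K)
  (e-hom : RingMorphisms.IsRingHomomorphism (FiniteField.rawRing S) (FiniteField.rawRing K) e) where
  open Field K
  open VectorLaws K
  private module S = Field S
  open module Sub {N : ℕ} = Subspaces K N S e public hiding (Subspace)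
  open RingMorphisms.IsRingHomomorphism e-hom using () renaming (+-homo to e-+; *-homo to e-*; 0#-homo to e-0; 1#-homo to e-1; -‿homo to e-neg)
  open ≡-Reasoning

  Coords : ℕ → Set
  Coords = Vec S.Carrier

  0ᶜ : ∀ {d} → Coords d
  0ᶜ = replicate _ S.0#

  coords↔ : ∀ d → Coords d ↔ Fin (s ℕ.^ d)
  coords↔ = vec↔ S.enumeration

  combination-+ : ∀ {N d} (c c′ : Coords d) (b : Vec (V {N}) d) →
                  combination (zipWith S._+_ c c′) b ≡ combination c b +ᵥ combination c′ b
  combination-+ []      []        []      = sym (+ᵥ-identityˡ 0ᵥ)
  combination-+ (x ∷ c) (x′ ∷ c′) (v ∷ b) = begin
    e (x S.+ x′) *ᵥ v +ᵥ combination (zipWith S._+_ c c′) b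
      ≡⟨ cong₂ (λ a w → a *ᵥ v +ᵥ w) (e-+ x x′) (combination-+ c c′ b) ⟩
    (e x + e x′) *ᵥ v +ᵥ (combination c b +ᵥ combination c′ b)
      ≡⟨ shuffle (e x) (e x′) v (combination c b) (combination c′ b) ⟩
    e x *ᵥ v +ᵥ combination c b +ᵥ (e x′ *ᵥ v +ᵥ combination c′ b) ∎
    where
    shuffle : ∀ {N} a b (u v w : V {N}) → (a + b) *ᵥ u +ᵥ (v +ᵥ w) ≡ a *ᵥ u +ᵥ v +ᵥ (b *ᵥ u +ᵥ w)
    shuffle a b []      []      []      = refl
    shuffle a b (x ∷ u) (y ∷ v) (z ∷ w) = cong₂ _∷_
      (solve 5 (λ a b x y z → (a :+ b) :* x :+ (y :+ z) := a :* x :+ y :+ (b :* x :+ z)) refl a b x y z) (shuffle a b u v w)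

  combination-* : ∀ {N d} a (c : Coords d) (b : Vec (V {N}) d) →
                  combination (map (a S.*_) c) b ≡ e a *ᵥ combination c b
  combination-* a []      []      = sym (*ᵥ-zeroʳ (e a))
  combination-* a (x ∷ c) (v ∷ b) = begin
    e (a S.* x) *ᵥ v +ᵥ combination (map (a S.*_) c) b
      ≡⟨ cong₂ (λ z w → z *ᵥ v +ᵥ w) (e-* a x) (combination-* a c b) ⟩
    (e a * e x) *ᵥ v +ᵥ e a *ᵥ combination c b   ≡⟨ cong (_+ᵥ e a *ᵥ combination c b) (*ᵥ-assoc (e a) (e x) v) ⟩
    e a *ᵥ e x *ᵥ v +ᵥ e a *ᵥ combination c b    ≡⟨ *ᵥ-distrib-+ᵥ (e a) _ _ ⟨
    e a *ᵥ (e x *ᵥ v +ᵥ combination c b)         ∎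

  combination-0 : ∀ {N d} (b : Vec (V {N}) d) → combination 0ᶜ b ≡ 0ᵥ
  combination-0 []      = refl
  combination-0 (v ∷ b) = trans (cong₂ (λ z w → z *ᵥ v +ᵥ w) e-0 (combination-0 b))
    (trans (+ᵥ-identityʳ _) (*ᵥ-zeroˡ v))

  Independent : ∀ {N d} → Vec (V {N}) d → Set
  Independent b = ∀ c → combination c b ≡ 0ᵥ → c ≡ 0ᶜ

  combination-inj : ∀ {N d} {b : Vec (V {N}) d} → Independent b → Inj (λ c → combination c b)
  combination-inj {b = b} ind {c} {c′} eq = VectorLaws.-ᵥ≡0⇒ S (ind _ (begin
    combination (zipWith S._+_ c (map ((S.- S.1#) S.*_) c′)) b      ≡⟨ combination-+ c _ b ⟩
    combination c b +ᵥ combination (map ((S.- S.1#) S.*_) c′) b     ≡⟨ cong (combination c b +ᵥ_) (combination-* _ c′ b) ⟩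
    combination c b +ᵥ e (S.- S.1#) *ᵥ combination c′ b
      ≡⟨ cong₂ (λ u a → u +ᵥ a *ᵥ combination c′ b) eq (trans (e-neg S.1#) (cong -_ e-1)) ⟩
    combination c′ b -ᵥ combination c′ b                            ≡⟨ -ᵥ-self _ ⟩
    0ᵥ ∎))

  Closed : ∀ {N} → Pred (V {N}) 0ℓ → Set
  Closed W = 0ᵥ ∈ W × (∀ {u v} → u ∈ W → v ∈ W → u +ᵥ v ∈ W) × (∀ a {v} → v ∈ W → e a *ᵥ v ∈ W)

  combination-∈ : ∀ {N d} {W : Pred (V {N}) 0ℓ} → Closed W → (c : Coords d) {b : Vec V d} → All (_∈ W) b → combination c b ∈ W
  combination-∈ (z , _ , _)          []      []       = z
  combination-∈ cl@(_ , plus , times) (x ∷ c) (p ∷ ps) = plus (times x p) (combination-∈ cl c ps)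

  Span : ∀ {N d} → Vec (V {N}) d → Pred V 0ℓ
  Span b w = ∃[ c ] combination c b ≡ w

  Span? : ∀ {N d} (b : Vec (V {N}) d) → Decidable (Span b)
  Span? b w = search (coords↔ _) (λ c → combination c b ≟ᵥ w)

  Span-inside : ∀ {N d} (b : Vec (V {N}) d) → All (_∈ Span b) b
  Span-inside []      = []
  Span-inside (v ∷ b) =
    (S.1# ∷ 0ᶜ , trans (cong₂ (λ z w → z *ᵥ v +ᵥ w) e-1 (combination-0 b)) (trans (+ᵥ-identityʳ _) (*ᵥ-identity v))) ∷
    All.map (λ (c , eq) → S.0# ∷ c , trans (cong₂ (λ z w → z *ᵥ v +ᵥ w) e-0 eq)
      (trans (cong (_+ᵥ _) (*ᵥ-zeroˡ v)) (+ᵥ-identityˡ _))) (Span-inside b)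

  Span-closed : ∀ {N d} (b : Vec (V {N}) d) → Closed (Span b)
  Span-closed b = (0ᶜ , combination-0 b) ,
    (λ (c , p) (c′ , p′) → zipWith S._+_ c c′ , trans (combination-+ c c′ b) (cong₂ _+ᵥ_ p p′)) ,
    (λ a (c , p) → map (a S.*_) c , trans (combination-* a c b) (cong (e a *ᵥ_) p))

  Span-basis : ∀ {N d} {b : Vec (V {N}) d} → Independent b → IsBasis (Span b) b
  Span-basis {b = b} ind = record { inside = Span-inside b ; independent = ind ; spanning = id }

  span-subspace : ∀ {N d} (b : Vec (V {N}) d) → Subspaces.Subspace K N S e
  span-subspace b = record
    { member = Span b ; member? = Span? b
    ; 0-closed = proj₁ (Span-closed b)
    ; +-closed = proj₁ (proj₂ (Span-closed b))
    ; *-closed = proj₂ (proj₂ (Span-closed b)) }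

  -- Independent vectors of the right number span, because an injection
  -- between the finite coordinate spaces is onto.
  independent⇒spanning : ∀ {N d} {W : Pred (V {N}) 0ℓ} → Closed W → HasDim W d → (b : Vec V d) →
                         All (_∈ W) b → Independent b → ∀ {w} → w ∈ W → Span b w
  independent⇒spanning {d = d} {W} cl (b₀ , basis) b b∈W ind {w} w∈W
    = let x , eq = inj⇒surj (coords↔ d) (coords↔ d) {f} f-inj (proj₁ (spanning w∈W))
      in x , trans (sym (proj₂ (spanning (combination-∈ cl x b∈W))))
               (trans (cong (λ c → combination c b₀) eq) (proj₂ (spanning w∈W)))
    where
    open IsBasis basis
    f : Coords d → Coords d
    f c = proj₁ (spanning (combination-∈ cl c b∈W))
    f-inj : Inj f
    f-inj {c} {c′} eq = combination-inj ind (trans (sym (proj₂ (spanning (combination-∈ cl c b∈W))))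
      (trans (cong (λ c → combination c b₀) eq) (proj₂ (spanning (combination-∈ cl c′ b∈W)))))

  independent-∷ : ∀ {N d} {v : V {N}} {b : Vec V d} → Independent b → ¬ Span b v → Independent (v ∷ b)
  independent-∷ {v = v} {b} ind v∉ (x ∷ c) eq with x S.≟ S.0#
  ... | yes refl = cong (S.0# ∷_) (ind c (trans (sym (trans (cong (λ z → z *ᵥ v +ᵥ combination c b) e-0)
          (trans (cong (_+ᵥ combination c b) (*ᵥ-zeroˡ v)) (+ᵥ-identityˡ _)))) eq))
  ... | no x≢0 = contradiction (map ((S.- i) S.*_) c , trans (combination-* (S.- i) c b) (begin
      e (S.- i) *ᵥ w                          ≡⟨ cong (_*ᵥ w) (e-neg i) ⟩
      (- e i) *ᵥ w                            ≡⟨ lemma (e i) (e x) v w ei*ex≡1 ⟩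
      v -ᵥ e i *ᵥ (e x *ᵥ v +ᵥ w)             ≡⟨ cong (λ z → v -ᵥ e i *ᵥ z) eq ⟩
      v -ᵥ e i *ᵥ 0ᵥ                          ≡⟨ cong (v -ᵥ_) (*ᵥ-zeroʳ (e i)) ⟩
      v -ᵥ 0ᵥ                                 ≡⟨ trans (cong (v +ᵥ_) (*ᵥ-zeroʳ _)) (+ᵥ-identityʳ v) ⟩
      v ∎)) v∉
    where
    i = S.inv x x≢0
    w = combination c b
    ei*ex≡1 : e i * e x ≡ 1#
    ei*ex≡1 = trans (sym (e-* i x)) (trans (cong e (trans (S.*-comm i x) (S.inv-r x x≢0))) e-1)
    lemma : ∀ {N} a b (u w : V {N}) → a * b ≡ 1# → (- a) *ᵥ w ≡ u -ᵥ a *ᵥ (b *ᵥ u +ᵥ w)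
    lemma a b []      []      ab≡1 = refl
    lemma a b (x ∷ u) (y ∷ w) ab≡1 = cong₂ _∷_ (begin
      (- a) * y                             ≡⟨ solve 3 (λ a x y → (:- a) :* y := x :+ (:- :1) :* (:1 :* x :+ a :* y)) refl a x y ⟩
      x + (- 1#) * (1# * x + a * y)         ≡⟨ cong (λ z → x + (- 1#) * (z * x + a * y)) ab≡1 ⟨
      x + (- 1#) * (a * b * x + a * y)
        ≡⟨ solve 4 (λ a b x y → x :+ (:- :1) :* (a :* b :* x :+ a :* y) := x :+ (:- :1) :* (a :* (b :* x :+ y))) refl a b x y ⟩
      x + (- 1#) * (a * (b * x + y)) ∎) (lemma a b u w ab≡1)

  ^-cancel-≤ : ∀ {m n} → s ℕ.^ m ≤ s ℕ.^ n → m ≤ n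
  ^-cancel-≤ {m} {n} le with m ℕₚ.≤? n
  ... | yes p = p
  ... | no ¬p = contradiction le (ℕₚ.<⇒≱ (ℕₚ.^-monoʳ-< s S.1<order {n} {m} (ℕₚ.≰⇒> ¬p)))

  -- By greedy extension of an independent family.
  hasDim-by-counting : ∀ {N d} {W : Pred (V {N}) 0ℓ} → Closed W → {A : Set} → A ↔ Fin (s ℕ.^ d) →
                       (f : A → V) → Inj f → (∀ a → f a ∈ W) → (∀ {w} → w ∈ W → ∃[ a ] f a ≡ w) → HasDim W d
  hasDim-by-counting {N} {d} {W} cl {A} enum f f-inj f∈ f-onto =
    extend d [] [] (λ { [] _ → refl }) ℕₚ.≤-refl
    where
    bound : ∀ {m} (b : Vec (V {N}) m) → All (_∈ W) b → Independent b → m ≤ d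
    bound {m} b b∈ ind = ^-cancel-≤ (inj⇒≤ (coords↔ m) enum {f = λ c → proj₁ (f-onto (combination-∈ cl c b∈))}
      λ {c} {c′} eq → combination-inj ind (trans (sym (proj₂ (f-onto (combination-∈ cl c b∈))))
        (trans (cong f eq) (proj₂ (f-onto (combination-∈ cl c′ b∈))))))
    extend : ∀ fuel {m} (b : Vec V m) → All (_∈ W) b → Independent b → d ≤ m ℕ.+ fuel → HasDim W d
    extend fuel {m} b b∈ ind le with search enum (λ a → ¬? (Span? b (f a)))
    extend zero {m} b b∈ ind le | yes (a , ∉) =
      contradiction (bound (f a ∷ b) (f∈ a ∷ b∈) (independent-∷ ind ∉))
        (ℕₚ.<⇒≱ (s≤s (subst (d ≤_) (ℕₚ.+-identityʳ m) le)))
    extend (suc fuel) {m} b b∈ ind le | yes (a , ∉) =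
      extend fuel (f a ∷ b) (f∈ a ∷ b∈) (independent-∷ ind ∉) (subst (d ≤_) (ℕₚ.+-suc m fuel) le)
    extend fuel {m} b b∈ ind le | no none = subst (HasDim W) m≡d
      (b , record { inside = b∈ ; independent = ind ; spanning = spans })
      where
      spans-f : ∀ a → Span b (f a)
      spans-f a = decidable-stable (Span? b (f a)) (λ ∉ → none (a , ∉))
      spans : ∀ {w} → w ∈ W → Span b w
      spans w∈ with a , refl ← f-onto w∈ = spans-f a
      m≡d : m ≡ d
      m≡d = ℕₚ.≤-antisym (bound b b∈ ind) (^-cancel-≤ (inj⇒≤ enum (coords↔ m) {f = λ a → proj₁ (spans-f a)}
        λ {a} {a′} eq → f-inj (trans (sym (proj₂ (spans-f a))) (trans (cong (λ c → combination c b) eq) (proj₂ (spans-f a′))))))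

-- Points, lines and linear collineations of PG(N - 1, K)

module OverK {r : ℕ} (K : FiniteField r) where
  open Field K
  open VectorLaws K
  open LinearAlgebra K K id (Identity.isRingHomomorphism rawRing refl) public
  open ≡-Reasoning

  Indep₂ : ∀ {N} → V {N} → V → Set
  Indep₂ u v = ∀ a b → a *ᵥ u +ᵥ b *ᵥ v ≡ 0ᵥ → a ≡ 0# × b ≡ 0#

  combination₂ : ∀ {N} a b (u v : V {N}) → combination (a ∷ b ∷ []) (u ∷ v ∷ []) ≡ a *ᵥ u +ᵥ b *ᵥ v
  combination₂ a b u v = cong (a *ᵥ u +ᵥ_) (+ᵥ-identityʳ _)

  indep₂⇒ : ∀ {N} {u v : V {N}} → Indep₂ u v → Independent (u ∷ v ∷ [])
  indep₂⇒ {u = u} {v} ind (a ∷ b ∷ []) e with ind a b (trans (sym (combination₂ a b u v)) e)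
  ... | refl , refl = refl

  indep₂-intro : ∀ {N} {u v : V {N}} → u ≢ 0ᵥ → (∀ a → v ≢ a *ᵥ u) → Indep₂ u v
  indep₂-intro {u = u} {v} u≢0 np a b e with b ≟ 0#
  ... | yes refl = *ᵥ-≢0 u≢0 (trans (sym (trans (cong (a *ᵥ u +ᵥ_) (*ᵥ-zeroˡ v)) (+ᵥ-identityʳ _))) e) , refl
  ... | no b≢0 = contradiction (begin
      v                                         ≡⟨ *ᵥ-identity v ⟨
      1# *ᵥ v                                   ≡⟨ cong (_*ᵥ v) (trans (*-comm _ _) (inv-r b b≢0)) ⟨
      (i * b) *ᵥ v                              ≡⟨ lemma i a b u v ⟩
      i *ᵥ (a *ᵥ u +ᵥ b *ᵥ v) +ᵥ (- (i * a)) *ᵥ u ≡⟨ cong (λ z → i *ᵥ z +ᵥ (- (i * a)) *ᵥ u) e ⟩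
      i *ᵥ 0ᵥ +ᵥ (- (i * a)) *ᵥ u               ≡⟨ trans (cong (_+ᵥ (- (i * a)) *ᵥ u) (*ᵥ-zeroʳ i)) (+ᵥ-identityˡ _) ⟩
      (- (i * a)) *ᵥ u ∎) (np _)
    where
    i = inv b b≢0
    lemma : ∀ {N} i a b (u v : V {N}) → (i * b) *ᵥ v ≡ i *ᵥ (a *ᵥ u +ᵥ b *ᵥ v) +ᵥ (- (i * a)) *ᵥ u
    lemma i a b []      []      = refl
    lemma i a b (x ∷ u) (y ∷ v) = cong₂ _∷_
      (solve 5 (λ i a b x y → i :* b :* y := i :* (a :* x :+ b :* y) :+ (:- (i :* a)) :* x) refl i a b x y) (lemma i a b u v)

  indep₂-inj : ∀ {N} {u v : V {N}} → Indep₂ u v → ∀ {a b c d} → a *ᵥ u +ᵥ b *ᵥ v ≡ c *ᵥ u +ᵥ d *ᵥ v → a ≡ c × b ≡ d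
  indep₂-inj ind {a} {b} {c} {d} e
    with eq ← combination-inj (indep₂⇒ ind) {a ∷ b ∷ []} {c ∷ d ∷ []}
                (trans (combination₂ a b _ _) (trans e (sym (combination₂ c d _ _))))
    = ∷-injectiveˡ eq , ∷-injectiveˡ (∷-injectiveʳ eq)

  indep₂-sym : ∀ {N} {u v : V {N}} → Indep₂ u v → Indep₂ v u
  indep₂-sym ind a b e with p , q ← ind b a (trans (+ᵥ-comm _ _) e) = q , p

  indep₂-≢0ˡ : ∀ {N} {u v : V {N}} → Indep₂ u v → u ≢ 0ᵥ
  indep₂-≢0ˡ {v = v} ind refl = 1≢0 (proj₁ (ind 1# 0# (trans (cong₂ _+ᵥ_ (*ᵥ-zeroʳ 1#) (*ᵥ-zeroˡ v)) (+ᵥ-identityˡ _))))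

  indep₂-≢ : ∀ {N} {u v : V {N}} → Indep₂ u v → ∀ a → v ≢ a *ᵥ u
  indep₂-≢ {u = u} ind a refl = 1≢0 (proj₂ (ind (- a) 1# (lemma u)))
    where
    lemma : ∀ {N} (u : V {N}) → (- a) *ᵥ u +ᵥ 1# *ᵥ a *ᵥ u ≡ 0ᵥ
    lemma []      = refl
    lemma (x ∷ u) = cong₂ _∷_ (solve 2 (λ a x → (:- a) :* x :+ :1 :* (a :* x) := :0) refl a x) (lemma u)

  module _ {N : ℕ} where
    open Projective K N hiding (V; 0ᵥ; _+ᵥ_; _*ᵥ_)
    open Point

    ≈⇒ : ∀ {p p′} → p ≈ₚ p′ → ∃[ a ] vec p ≡ a *ᵥ vec p′
    ≈⇒ {p} (f , _) = f (1# , sym (*ᵥ-identity (vec p)))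

    ⇒≈ : ∀ {p p′} a → vec p ≡ a *ᵥ vec p′ → p ≈ₚ p′
    ⇒≈ {p} {p′} a e =
      (λ (b , eq) → b * a , trans eq (trans (cong (b *ᵥ_) e) (sym (*ᵥ-assoc b a _)))) ,
      (λ (b , eq) → b * i , trans eq (trans (cong (b *ᵥ_) (*ᵥ-inv a≢0 e)) (sym (*ᵥ-assoc b i _))))
      where
      a≢0 = scalar≢0 (vec≢0ᵥ p) e
      i = inv a a≢0

    span-flat : ∀ {d} {b : Vec V d} → Independent b → Flat d
    span-flat {b = b} ind = record { subspace = span-subspace b ; hasDim = b , Span-basis ind }

    flat-closed : ∀ {d} (T : Flat d) → Closed (Flat.member T)
    flat-closed T = 0-closed , +-closed , *-closed
      where open Subspaces.Subspace (Flat.subspace T)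

    line : ∀ {a b} → Indep₂ (vec a) (vec b) → Line
    line {a} {b} ind = span-flat {b = vec a ∷ vec b ∷ []} (indep₂⇒ ind)

    collinear-intro : ∀ {a b c} → Indep₂ (vec a) (vec b) → ∀ α β → vec c ≡ α *ᵥ vec a +ᵥ β *ᵥ vec b → Collinear a b c
    collinear-intro {a} {b} {c} ind α β e = line {a} {b} ind , All.head ins , All.head (All.tail ins) , c∈
      where
      ins : All (Span (vec a ∷ vec b ∷ [])) (vec a ∷ vec b ∷ [])
      ins = Span-inside (vec a ∷ vec b ∷ [])
      c∈ : Span (vec a ∷ vec b ∷ []) (vec c)
      c∈ = α ∷ β ∷ [] , trans (combination₂ α β _ _) (sym e)

    span₂ : ∀ {u v w : V {N}} → Span (u ∷ v ∷ []) w → ∃[ α ] ∃[ β ] w ≡ α *ᵥ u +ᵥ β *ᵥ v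
    span₂ (α ∷ β ∷ [] , e) = α , β , trans (sym e) (combination₂ α β _ _)

    collinear-elim : ∀ {a b c} → Indep₂ (vec a) (vec b) → Collinear a b c → ∃[ α ] ∃[ β ] vec c ≡ α *ᵥ vec a +ᵥ β *ᵥ vec b
    collinear-elim {a} {b} {c} ind (ℓ , a∈ , b∈ , c∈) = span₂
      (independent⇒spanning {W = Flat.member ℓ} (flat-closed ℓ) (Flat.hasDim ℓ) (vec a ∷ vec b ∷ []) (a∈ ∷ b∈ ∷ []) (indep₂⇒ ind) c∈)

  combination-++ : ∀ {N d d′} (c : Vec Carrier d) (c′ : Vec Carrier d′) (b : Vec (V {N}) d) (b′ : Vec V d′) →
                   combination (c ++ c′) (b ++ b′) ≡ combination c b +ᵥ combination c′ b′
  combination-++ []      c′ []      b′ = sym (+ᵥ-identityˡ _)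
  combination-++ (x ∷ c) c′ (v ∷ b) b′ = trans (cong (x *ᵥ v +ᵥ_) (combination-++ c c′ b b′)) (sym (+ᵥ-assoc _ _ _))

  closed-- : ∀ {N} {W : Pred (V {N}) 0ℓ} → Closed W → ∀ {u v} → u ∈ W → v ∈ W → u -ᵥ v ∈ W
  closed-- (_ , plus , times) u∈ v∈ = plus u∈ (times (- 1#) v∈)

  module Linear {N : ℕ} (B : Vec (V {N}) N) (ind : Independent B) where
    open Projective K N hiding (V; 0ᵥ; _+ᵥ_; _*ᵥ_)
    open Point

    f : V {N} → V {N}
    f v = combination v B

    f-inj : Inj f
    f-inj = combination-inj ind

    abstract
      f-surj : ∀ v → ∃[ u ] f u ≡ v
      f-surj = inj⇒surj (coords↔ N) (coords↔ N) f-inj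

    f⁻¹ : V {N} → V {N}
    f⁻¹ v = proj₁ (f-surj v)

    ff⁻¹ : ∀ v → f (f⁻¹ v) ≡ v
    ff⁻¹ v = proj₂ (f-surj v)

    f⁻¹f : ∀ v → f⁻¹ (f v) ≡ v
    f⁻¹f v = f-inj (ff⁻¹ (f v))

    f-* : ∀ a v → f (a *ᵥ v) ≡ a *ᵥ f v
    f-* a v = combination-* a v B

    f-+ : ∀ u v → f (u +ᵥ v) ≡ f u +ᵥ f v
    f-+ u v = combination-+ u v B

    f-0 : f 0ᵥ ≡ 0ᵥ
    f-0 = combination-0 B

    f⁻¹-* : ∀ a v → f⁻¹ (a *ᵥ v) ≡ a *ᵥ f⁻¹ v
    f⁻¹-* a v = f-inj (trans (ff⁻¹ _) (sym (trans (f-* a (f⁻¹ v)) (cong (a *ᵥ_) (ff⁻¹ v)))))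

    f⁻¹-+ : ∀ u v → f⁻¹ (u +ᵥ v) ≡ f⁻¹ u +ᵥ f⁻¹ v
    f⁻¹-+ u v = f-inj (trans (ff⁻¹ _) (sym (trans (f-+ (f⁻¹ u) (f⁻¹ v)) (cong₂ _+ᵥ_ (ff⁻¹ u) (ff⁻¹ v)))))

    f⁻¹-0 : f⁻¹ 0ᵥ ≡ 0ᵥ
    f⁻¹-0 = trans (cong f⁻¹ (sym f-0)) (f⁻¹f 0ᵥ)

    -- An arbitrary pair of inverse linear maps is allowed, so that the lemma serves `f` and `f⁻¹`
    -- alike. Membership in the image is tested through the inverse, which keeps it decidable.
    image-flat : (g h : V {N} → V {N}) → (∀ v → g (h v) ≡ v) → (∀ v → h (g v) ≡ v) → g 0ᵥ ≡ 0ᵥ → h 0ᵥ ≡ 0ᵥ →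
                 (∀ u v → g (u +ᵥ v) ≡ g u +ᵥ g v) → (∀ u v → h (u +ᵥ v) ≡ h u +ᵥ h v) →
                 (∀ a v → g (a *ᵥ v) ≡ a *ᵥ g v) → (∀ a v → h (a *ᵥ v) ≡ a *ᵥ h v) →
                 ∀ {d} (T : Flat d) → Σ[ T′ ∈ Flat d ] (∀ v → v ∈ Flat.member T → g v ∈ Flat.member T′)
    image-flat g h gh hg g0 h0 g+ h+ g* h* T = record
        { subspace = record
          { member = λ v → h v ∈ Flat.member T
          ; member? = λ v → member? (h v)
          ; 0-closed = subst (_∈ Flat.member T) (sym h0) 0-closed
          ; +-closed = λ {u} {v} p q → subst (_∈ Flat.member T) (sym (h+ u v)) (+-closed p q)
          ; *-closed = λ a {v} p → subst (_∈ Flat.member T) (sym (h* a v)) (*-closed a p) }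
        ; hasDim = map g b , record
          { inside = Allₚ.map⁺ (All.map (λ {v} → subst (_∈ Flat.member T) (sym (hg v))) inside)
          ; independent = λ c e → independent c (trans (sym (hg _))
              (trans (cong h (trans (g-combination c b) e)) h0))
          ; spanning = λ {w} w∈ → let (c , e) = spanning w∈ in
              c , trans (sym (g-combination c b)) (trans (cong g e) (gh w)) } } ,
        λ v → subst (_∈ Flat.member T) (sym (hg v))
      where
      open Subspaces.Subspace (Flat.subspace T) hiding (member)
      b = proj₁ (Flat.hasDim T)
      open IsBasis (proj₂ (Flat.hasDim T))
      g-combination : ∀ {d} (c : Vec Carrier d) (b : Vec V d) → g (combination c b) ≡ combination c (map g b)
      g-combination []      []      = g0
      g-combination (x ∷ c) (v ∷ b) = trans (g+ _ _) (cong₂ _+ᵥ_ (g* x v) (g-combination c b))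

    image : Point → Point
    image p = point (f (vec p)) λ e → vec≢0ᵥ p (f-inj (trans e (sym f-0)))

    preimage : Point → Point
    preimage p = point (f⁻¹ (vec p)) λ e → vec≢0ᵥ p (trans (sym (ff⁻¹ _)) (trans (cong f e) f-0))

    image-cong : ∀ {p p′} → p ≈ₚ p′ → image p ≈ₚ image p′
    image-cong {p} {p′} p≈ = ⇒≈ {p = image p} {image p′} (proj₁ pp) (trans (cong f (proj₂ pp)) (f-* (proj₁ pp) (vec p′)))
      where pp = ≈⇒ {p = p} {p′} p≈

    preimage-cong : ∀ {p p′} → p ≈ₚ p′ → preimage p ≈ₚ preimage p′
    preimage-cong {p} {p′} p≈ = ⇒≈ {p = preimage p} {preimage p′} (proj₁ pp) (trans (cong f⁻¹ (proj₂ pp)) (f⁻¹-* (proj₁ pp) (vec p′)))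
      where pp = ≈⇒ {p = p} {p′} p≈

    same-vec : ∀ {p p′} → vec p ≡ vec p′ → p ≈ₚ p′
    same-vec {p} {p′} e = ⇒≈ {p = p} {p′} 1# (trans e (sym (*ᵥ-identity _)))

    preimage-image : ∀ p → preimage (image p) ≈ₚ p
    preimage-image p = same-vec {preimage (image p)} {p} (f⁻¹f (vec p))

    image-preimage : ∀ p → image (preimage p) ≈ₚ p
    image-preimage p = same-vec {image (preimage p)} {p} (ff⁻¹ (vec p))

    -- The basis `B` will be found inside a given space and `f` maps standard coordinates into it;
    -- bringing a set into standard form is therefore the inverse direction.
    collineation⁻¹ : Collineation
    collineation⁻¹ = record
      { bijection = record
        { to = preimage ; from = image
        ; to-cong = λ {p} {p′} → preimage-cong {p} {p′} ; from-cong = λ {p} {p′} → image-cong {p} {p′}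
        ; inverse = (λ {p} {p′} e → Setoid.trans pointSetoid {preimage p′} {preimage (image p)} {p} (preimage-cong {p′} {image p} e) (preimage-image p)) ,
                    (λ {p} {p′} e → Setoid.trans pointSetoid {image p′} {image (preimage p)} {p} (image-cong {p′} {preimage p} e) (image-preimage p)) }
      ; collinear = λ a b c → mk⇔
          (λ (ℓ , a∈ , b∈ , c∈) → let (ℓ′ , h) = image-flat f⁻¹ f f⁻¹f ff⁻¹ f⁻¹-0 f-0 f⁻¹-+ f-+ f⁻¹-* f-* ℓ
             in ℓ′ , h _ a∈ , h _ b∈ , h _ c∈)
          (λ (ℓ , a∈ , b∈ , c∈) → let (ℓ′ , h) = image-line ℓ in ℓ′ , h a a∈ , h b b∈ , h c c∈) }
      where
      image-line : ∀ ℓ → Σ[ ℓ′ ∈ Line ] (∀ p → preimage p on ℓ → p on ℓ′)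
      image-line ℓ = let (ℓ′ , h) = image-flat f f⁻¹ ff⁻¹ f⁻¹f f-0 f⁻¹-0 f-+ f⁻¹-+ f-* f⁻¹-* ℓ
        in ℓ′ , λ p p∈ → subst (_∈ Flat.member ℓ′) (ff⁻¹ (vec p)) (h _ p∈)

  module Doubled {n : ℕ} where
    infix 5 _⊞_
    abstract
     -- `2 * n` unfolds to `n + (n + 0)`, whence the appended empty vector.
     _⊞_ : V {n} → V {n} → V {2 ℕ.* n}
     x ⊞ y = x ++ (y ++ [])

     ⊞-+ : ∀ x y x′ y′ → (x ⊞ y) +ᵥ (x′ ⊞ y′) ≡ x +ᵥ x′ ⊞ y +ᵥ y′
     ⊞-+ x y x′ y′ = trans (zipWith-++ _+_ x (y ++ []) x′ (y′ ++ [])) (cong (zipWith _+_ x x′ ++_) (zipWith-++ _+_ y [] y′ []))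

     ⊞-* : ∀ a x y → a *ᵥ (x ⊞ y) ≡ a *ᵥ x ⊞ a *ᵥ y
     ⊞-* a x y = trans (map-++ (a *_) x (y ++ [])) (cong (map (a *_) x ++_) (map-++ (a *_) y []))

     ⊞-inj : ∀ {x y x′ y′} → x ⊞ y ≡ x′ ⊞ y′ → x ≡ x′ × y ≡ y′
     ⊞-inj {x} {y} {x′} {y′} e = ++-injectiveˡ x x′ e , ++-injectiveˡ y y′ (++-injectiveʳ x x′ e)

     frame : ∀ {N} → Vec (V {N}) n → Vec (V {N}) n → Vec (V {N}) (2 ℕ.* n)
     frame b b′ = b ++ (b′ ++ [])

     combination-frame : ∀ {N} c d (b b′ : Vec (V {N}) n) → combination (c ⊞ d) (frame b b′) ≡ combination c b +ᵥ combination d b′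
     combination-frame c d b b′ = trans (combination-++ c (d ++ []) b (b′ ++ []))
       (cong (combination c b +ᵥ_) (trans (combination-++ d [] b′ []) (+ᵥ-identityʳ _)))

     ⊞-split : ∀ v → ∃[ x ] ∃[ y ] v ≡ x ⊞ y
     ⊞-split v with x , w , refl ← Vec.splitAt n v with y , [] , refl ← Vec.splitAt n w = x , y , refl

    ⊞-0 : 0ᵥ ⊞ 0ᵥ ≡ 0ᵥ
    ⊞-0 = trans (cong₂ _⊞_ (sym (*ᵥ-zeroˡ {n} 0ᵥ)) (sym (*ᵥ-zeroˡ {n} 0ᵥ)))
      (trans (sym (⊞-* 0# 0ᵥ 0ᵥ)) (*ᵥ-zeroˡ (0ᵥ ⊞ 0ᵥ)))

    ⊞-≡0 : ∀ {x y} → x ⊞ y ≡ 0ᵥ → x ≡ 0ᵥ × y ≡ 0ᵥ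
    ⊞-≡0 e = ⊞-inj (trans e (sym ⊞-0))

    ⊞-lin : ∀ a b x y x′ y′ → a *ᵥ (x ⊞ y) +ᵥ b *ᵥ (x′ ⊞ y′) ≡ a *ᵥ x +ᵥ b *ᵥ x′ ⊞ a *ᵥ y +ᵥ b *ᵥ y′
    ⊞-lin a b x y x′ y′ = trans (cong₂ _+ᵥ_ (⊞-* a x y) (⊞-* b x′ y′)) (⊞-+ _ _ _ _)

    combination-⊞ : ∀ {d} (c : Vec Carrier d) (xs ys : Vec (V {n}) d) →
                    combination c (zipWith _⊞_ xs ys) ≡ combination c xs ⊞ combination c ys
    combination-⊞ []      []       []       = sym ⊞-0
    combination-⊞ (a ∷ c) (x ∷ xs) (y ∷ ys) = trans (cong₂ _+ᵥ_ (⊞-* a x y) (combination-⊞ c xs ys)) (⊞-+ _ _ _ _)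

  unit : ∀ n → Vec (V {n}) n
  unit zero    = []
  unit (suc n) = (1# ∷ 0ᵥ) ∷ map (0# ∷_) (unit n)

  combination-0∷ : ∀ {N d} (c : Vec Carrier d) (b : Vec (V {N}) d) → combination c (map (0# ∷_) b) ≡ 0# ∷ combination c b
  combination-0∷ []      []      = refl
  combination-0∷ (a ∷ c) (v ∷ b) = trans (cong (a *ᵥ (0# ∷ v) +ᵥ_) (combination-0∷ c b))
    (cong (_∷ combination (a ∷ c) (v ∷ b)) (solve 1 (λ a → a :* :0 :+ :0 := :0) refl a))

  combination-unit : ∀ {n} (c : V {n}) → combination c (unit n) ≡ c
  combination-unit []      = refl
  combination-unit (a ∷ c) = trans (cong (a *ᵥ (1# ∷ 0ᵥ) +ᵥ_) (combination-0∷ c (unit _)))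
    (cong₂ _∷_ (solve 1 (λ a → a :* :1 :+ :0 := a) refl a)
      (trans (cong₂ _+ᵥ_ (*ᵥ-zeroʳ a) (combination-unit c)) (+ᵥ-identityˡ c)))

  combination-replicate-0 : ∀ {N d} (c : Vec Carrier d) → combination c (replicate d (0ᵥ {N})) ≡ 0ᵥ
  combination-replicate-0 []      = refl
  combination-replicate-0 (a ∷ c) = trans (cong₂ _+ᵥ_ (*ᵥ-zeroʳ a) (combination-replicate-0 c)) (+ᵥ-identityˡ 0ᵥ)

  -- Vectors whose first nonzero coordinate is 1 represent the points of PG(n-1, K).
  #points : ℕ → ℕ
  #points zero    = 0
  #points (suc n) = r ℕ.^ n ℕ.+ #points n

  normalised : ∀ n → Fin (#points n) → V {n}
  normalised (suc n) i with splitAt (r ℕ.^ n) i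
  ... | inj₁ j = 1# ∷ Inverse.from (vec↔ enumeration n) j
  ... | inj₂ k = 0# ∷ normalised n k

  normalised≢0 : ∀ n i → normalised n i ≢ 0ᵥ
  normalised≢0 (suc n) i e with splitAt (r ℕ.^ n) i
  ... | inj₁ j = 1≢0 (∷-injectiveˡ e)
  ... | inj₂ k = normalised≢0 n k (∷-injectiveʳ e)

  -- Leading ones in the same position force `a` to be 1. In different positions the comparison at
  -- the earlier one gives 1 = 0, or a = 0 and with it a zero vector.
  normalised-inj : ∀ n i j {a} → normalised n i ≡ a *ᵥ normalised n j → i ≡ j
  normalised-inj (suc n) i j {a} e with splitAt (r ℕ.^ n) i in p | splitAt (r ℕ.^ n) j in q
  ... | inj₁ x | inj₂ y = contradiction (trans (∷-injectiveˡ e) (zeroʳ a)) 1≢0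
  ... | inj₂ x | inj₁ y = contradiction (trans (∷-injectiveʳ e) (trans (cong (_*ᵥ _)
        (trans (sym (*-identityʳ a)) (sym (∷-injectiveˡ e)))) (*ᵥ-zeroˡ _))) (normalised≢0 n x)
  ... | inj₂ x | inj₂ y = trans (sym (splitAt⁻¹-↑ʳ {i = i} p)) (trans (cong (r ℕ.^ n ↑ʳ_)
        (normalised-inj n x y (∷-injectiveʳ e))) (splitAt⁻¹-↑ʳ {i = j} q))
  ... | inj₁ x | inj₁ y = trans (sym (splitAt⁻¹-↑ˡ {i = i} p)) (trans (cong (_↑ˡ #points n) x≡y) (splitAt⁻¹-↑ˡ {i = j} q))
    where
    x≡y = from-inj (vec↔ enumeration n) (trans (∷-injectiveʳ e) (trans (cong (_*ᵥ _)
            (trans (sym (*-identityʳ a)) (sym (∷-injectiveˡ e)))) (*ᵥ-identity _)))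

  normalise : ∀ n (v : V {n}) → v ≢ 0ᵥ → ∃[ i ] ∃[ a ] v ≡ a *ᵥ normalised n i
  normalise zero    []      v≢0 = contradiction refl v≢0
  normalise (suc n) (x ∷ v) v≢0 with x ≟ 0#
  ... | yes refl with i , a , e ← normalise n v (λ e → v≢0 (cong (0# ∷_) e)) = r ℕ.^ n ↑ʳ i , a , eq
    where
    eq : 0# ∷ v ≡ a *ᵥ normalised (suc n) (r ℕ.^ n ↑ʳ i)
    eq rewrite splitAt-↑ʳ (r ℕ.^ n) (#points n) i = cong₂ _∷_ (sym (zeroʳ a)) e
  ... | no x≢0 = i ↑ˡ #points n , x , eq
    where
    w = inv x x≢0 *ᵥ v
    i = Inverse.to (vec↔ enumeration n) w
    eq : x ∷ v ≡ x *ᵥ normalised (suc n) (i ↑ˡ #points n)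
    eq rewrite splitAt-↑ˡ (r ℕ.^ n) i (#points n) = cong₂ _∷_ (sym (*-identityʳ x))
      (trans (trans (sym (*ᵥ-identity v)) (trans (cong (_*ᵥ v) (sym (inv-r x x≢0))) (*ᵥ-assoc _ _ v)))
        (cong (x *ᵥ_) (sym (Inverse.strictlyInverseʳ (vec↔ enumeration n) w))))

  -- The geometric sum; `count` proves it with 1 added to both sides, so that truncated subtraction
  -- enters only at the end.
  #points-count : ∀ n → #points n ℕ.* (r ∸ 1) ≡ r ℕ.^ n ∸ 1
  #points-count n = cong ℕ.pred (count n)
    where
    1+[r-1]≡r : suc (r ∸ 1) ≡ r
    1+[r-1]≡r = ℕₚ.suc-pred r {{ℕ.>-nonZero (ℕₚ.<-trans (s≤s z≤n) 1<order)}}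
    count : ∀ n → 1 ℕ.+ #points n ℕ.* (r ∸ 1) ≡ r ℕ.^ n
    count zero    = refl
    count (suc n) = begin
      1 ℕ.+ (r ℕ.^ n ℕ.+ #points n) ℕ.* (r ∸ 1)
        ≡⟨ cong suc (ℕₚ.*-distribʳ-+ (r ∸ 1) (r ℕ.^ n) (#points n)) ⟩
      1 ℕ.+ (r ℕ.^ n ℕ.* (r ∸ 1) ℕ.+ #points n ℕ.* (r ∸ 1))
        ≡⟨ ℕₚ.+-suc _ _ ⟨
      r ℕ.^ n ℕ.* (r ∸ 1) ℕ.+ (1 ℕ.+ #points n ℕ.* (r ∸ 1))
        ≡⟨ cong₂ ℕ._+_ (ℕₚ.*-comm (r ℕ.^ n) (r ∸ 1)) (count n) ⟩
      (r ∸ 1) ℕ.* r ℕ.^ n ℕ.+ r ℕ.^ n       ≡⟨ ℕₚ.+-comm _ (r ℕ.^ n) ⟩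
      suc (r ∸ 1) ℕ.* r ℕ.^ n               ≡⟨ cong (ℕ._* r ℕ.^ n) 1+[r-1]≡r ⟩
      r ℕ.* r ℕ.^ n ∎

-- The standard sets of points ⟨(x, σ x)⟩

module Over {q t : ℕ} (E : FieldExtension q t) (3≤t : 3 ≤ t) where
  open Extension E 3≤t public
  open VectorLaws K public
  open OverK K public
  open ≡-Reasoning
  module OverF = LinearAlgebra K F ι (FieldExtension.isHomomorphism E)

  module Semilinear (G : Generator) where
    open Generator G public

    infixr 7 σᵥ_
    σᵥ_ : ∀ {N} → V {N} → V {N}
    σᵥ_ = map σ

    σᵥ-+ : ∀ {N} (u v : V {N}) → σᵥ (u +ᵥ v) ≡ σᵥ u +ᵥ σᵥ v
    σᵥ-+ []      []      = refl
    σᵥ-+ (x ∷ u) (y ∷ v) = cong₂ _∷_ (σ-+ x y) (σᵥ-+ u v)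

    σᵥ-* : ∀ {N} a (v : V {N}) → σᵥ (a *ᵥ v) ≡ σ a *ᵥ σᵥ v
    σᵥ-* a []      = refl
    σᵥ-* a (x ∷ v) = cong₂ _∷_ (σ-* a x) (σᵥ-* a v)

    σᵥ-0 : ∀ {N} → σᵥ 0ᵥ {N} ≡ 0ᵥ
    σᵥ-0 {zero}  = refl
    σᵥ-0 {suc N} = cong₂ _∷_ σ-0 σᵥ-0

    σᵥ-inj : ∀ {N} {u v : V {N}} → σᵥ u ≡ σᵥ v → u ≡ v
    σᵥ-inj {u = []}    {[]}    e = refl
    σᵥ-inj {u = x ∷ u} {y ∷ v} e = cong₂ _∷_ (σ-inj (∷-injectiveˡ e)) (σᵥ-inj (∷-injectiveʳ e))

    σᵥ-≢0 : ∀ {N} {v : V {N}} → v ≢ 0ᵥ → σᵥ v ≢ 0ᵥ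
    σᵥ-≢0 v≢0 e = v≢0 (σᵥ-inj (trans e (sym σᵥ-0)))

    σᵥ-multiple : ∀ {N} {a} {u v : V {N}} → σᵥ u ≡ a *ᵥ σᵥ v → u ≡ σ⁻¹ a *ᵥ v
    σᵥ-multiple {a = a} {v = v} e = σᵥ-inj (trans e (trans (cong (_*ᵥ σᵥ v) (sym (σσ⁻¹ a))) (sym (σᵥ-* _ _))))

  module Standard (n : ℕ) (2≤n : 2 ≤ n) (G : Generator) where
    open Semilinear G
    open Doubled {n}
    open LinearSets E n hiding (V; 0ᵥ; _+ᵥ_; _*ᵥ_; HasDimF)
    open Point

    graph : V {n} → V {2 ℕ.* n}
    graph x = x ⊞ σᵥ x

    graph-+ : ∀ x y → graph (x +ᵥ y) ≡ graph x +ᵥ graph y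
    graph-+ x y = trans (cong (x +ᵥ y ⊞_) (σᵥ-+ x y)) (sym (⊞-+ x (σᵥ x) y (σᵥ y)))

    graph-inj : ∀ {x y} → graph x ≡ graph y → x ≡ y
    graph-inj e = proj₁ (⊞-inj e)

    graph-0 : graph 0ᵥ ≡ 0ᵥ
    graph-0 = trans (cong (0ᵥ ⊞_) σᵥ-0) ⊞-0

    Uσ : FSubspace
    Uσ = record
      { member   = λ v → ∃[ x ] v ≡ graph x
      ; member?  = member?
      ; 0-closed = 0ᵥ , sym graph-0
      ; +-closed = λ { (x , refl) (y , refl) → x +ᵥ y , sym (graph-+ x y) }
      ; *-closed = λ { c (x , refl) → ι c *ᵥ x , trans (⊞-* (ι c) x (σᵥ x))
                       (cong (ι c *ᵥ x ⊞_) (sym (trans (σᵥ-* (ι c) x) (cong (_*ᵥ σᵥ x) (σ-ι c))))) } }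
      where
      member? : ∀ v → Dec (∃[ x ] v ≡ graph x)
      member? v with x , y , refl ← ⊞-split v =
        map′ (λ e → x , cong (x ⊞_) e) (λ (z , e) → trans (proj₂ (⊞-inj e)) (cong σᵥ_ (sym (proj₁ (⊞-inj e))))) (y ≟ᵥ σᵥ x)

    U-closed : OverF.Closed (member Uσ)
    U-closed = 0-closed , +-closed , *-closed
      where open Subspaces.Subspace Uσ

    L : Pred Point 0ℓ
    L = L[ Uσ ]

    L-elim : ∀ {p} → p ∈ L → ∃[ x ] ∃[ a ] x ≢ 0ᵥ × a ≢ 0# × vec p ≡ a *ᵥ graph x
    L-elim {p} (u , (x , e) , u≈p) with b , eq ← ≈⇒ {p = u} {p} u≈p =
      x , inv b b≢0 , (λ { refl → vec≢0ᵥ u (trans e graph-0) }) , inv≢0 b b≢0 ,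
      trans (*ᵥ-inv b≢0 eq) (cong (inv b b≢0 *ᵥ_) e)
      where b≢0 = scalar≢0 (vec≢0ᵥ u) eq

    L-intro : ∀ {p} x a → vec p ≡ a *ᵥ graph x → p ∈ L
    L-intro {p} x a e = point (graph x) gx≢0 , (x , refl) ,
      Setoid.sym pointSetoid {p} {point (graph x) gx≢0} (⇒≈ {p = p} {point (graph x) gx≢0} a e)
      where
      gx≢0 : graph x ≢ 0ᵥ
      gx≢0 z = vec≢0ᵥ p (trans e (trans (cong (a *ᵥ_) z) (*ᵥ-zeroʳ a)))

    ∩-closed : ∀ {N} {A B : Pred (V {N}) 0ℓ} → OverF.Closed A → OverF.Closed B → OverF.Closed (A ∩ B)
    ∩-closed (z , p , m) (z′ , p′ , m′) = (z , z′) , (λ (a , b) (a′ , b′) → p a a′ , p′ b b′) , (λ c (a , b) → m c a , m′ c b)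

    restrict : ∀ {N} {A : Pred (V {N}) 0ℓ} → Closed A → OverF.Closed A
    restrict (z , p , m) = z , p , λ c → m (ι c)

    multiples-closed : ∀ p → Closed ⟨ p ⟩
    multiples-closed p = (0# , sym (*ᵥ-zeroˡ _)) ,
      (λ { (a , refl) (b , refl) → a + b , sym (*ᵥ-distrib-+ a b _) }) ,
      (λ { a (b , refl) → a * b , sym (*ᵥ-assoc a b _) })

    -- The first halves give z = a x, and the second halves then σ a = a. Scatteredness of the
    -- standard set thus comes from Fix σ = F.
    graph-scalar : ∀ {x a z} → x ≢ 0ᵥ → a *ᵥ graph x ≡ graph z → InF a
    graph-scalar {x} {a} x≢0 e with refl , e₂ ← ⊞-inj (trans (sym (⊞-* a x (σᵥ x))) e) =
      fixed (*ᵥ-cancelʳ (σᵥ-≢0 x≢0) (sym (trans e₂ (σᵥ-* a x))))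

    scattered : Scattered Uσ
    scattered p p∈ with x , a , x≢0 , a≢0 , e ← L-elim {p} p∈ =
      OverF.hasDim-by-counting {d = 1} (∩-closed (restrict (multiples-closed p)) U-closed) (OverF.coords↔ 1)
        f f-inj f∈ f-onto
      where
      f : Vec F.Carrier 1 → V
      f (c ∷ []) = ι c *ᵥ graph x
      gx≢0 : graph x ≢ 0ᵥ
      gx≢0 z = x≢0 (graph-inj (trans z (sym graph-0)))
      f-inj : Inj f
      f-inj {c ∷ []} {d ∷ []} eq = cong (_∷ []) (ι-inj (*ᵥ-cancelʳ gx≢0 eq))
      f∈ : ∀ c → f c ∈ ⟨ p ⟩ ∩ member Uσ
      f∈ (c ∷ []) = (ι c * inv a a≢0 , trans (cong (ι c *ᵥ_) (*ᵥ-inv a≢0 e)) (sym (*ᵥ-assoc _ _ _))) ,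
        proj₂ (proj₂ U-closed) c (x , refl)
      f-onto : ∀ {w} → w ∈ ⟨ p ⟩ ∩ member Uσ → ∃[ c ] f c ≡ w
      f-onto ((b , refl) , (z , eq)) = proj₁ ba∈F ∷ [] , trans (cong (_*ᵥ graph x) (proj₂ ba∈F)) ba
        where
        ba : (b * a) *ᵥ graph x ≡ b *ᵥ vec p
        ba = trans (*ᵥ-assoc b a _) (cong (b *ᵥ_) (sym e))
        ba∈F = graph-scalar {a = b * a} x≢0 (trans ba eq)

    q^tn : (q ℕ.^ t) ℕ.^ n ≡ q ℕ.^ (t ℕ.* n)
    q^tn = ℕₚ.^-*-assoc q t n

    maximumScattered : MaximumScattered Uσ
    maximumScattered = scattered ,
      OverF.hasDim-by-counting U-closed (subst (λ N → V {n} ↔ Fin N) q^tn (coords↔ n)) graph graph-inj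
        (λ x → x , refl) (λ { (x , refl) → x , refl })

    line-indep : ∀ {x} → x ≢ 0ᵥ → Indep₂ (x ⊞ 0ᵥ) (0ᵥ ⊞ σᵥ x)
    line-indep {x} x≢0 a b e with p , q ← ⊞-≡0 (trans (sym (⊞-lin a b x 0ᵥ 0ᵥ (σᵥ x))) e) =
      *ᵥ-≢0 x≢0 (trans (sym (trans (cong (a *ᵥ x +ᵥ_) (*ᵥ-zeroʳ b)) (+ᵥ-identityʳ _))) p) ,
      *ᵥ-≢0 (σᵥ-≢0 x≢0) (trans (sym (trans (cong (_+ᵥ b *ᵥ σᵥ x) (*ᵥ-zeroʳ a)) (+ᵥ-identityˡ _))) q)

    lin-⊞ : ∀ a b x y → a *ᵥ (x ⊞ 0ᵥ) +ᵥ b *ᵥ (0ᵥ ⊞ y) ≡ a *ᵥ x ⊞ b *ᵥ y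
    lin-⊞ a b x y = trans (⊞-lin a b x 0ᵥ 0ᵥ y) (cong₂ _⊞_
      (trans (cong (a *ᵥ x +ᵥ_) (*ᵥ-zeroʳ b)) (+ᵥ-identityʳ _)) (trans (cong (_+ᵥ b *ᵥ y) (*ᵥ-zeroʳ a)) (+ᵥ-identityˡ _)))

    -- Joins (x, 0) to (0, σ x). By semilinearity it contains (a x, σ (a x)) for every a ∈ K; these
    -- lines serve as the s i.
    ruling : ∀ {x} → x ≢ 0ᵥ → Line
    ruling {x} x≢0 = span-flat {b = (x ⊞ 0ᵥ) ∷ (0ᵥ ⊞ σᵥ x) ∷ []} (indep₂⇒ (line-indep x≢0))

    OnRuling : V {n} → V {2 ℕ.* n} → Set
    OnRuling x v = ∃[ a ] ∃[ b ] v ≡ a *ᵥ x ⊞ b *ᵥ σᵥ x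

    ruling-elim : ∀ {x v} (x≢0 : x ≢ 0ᵥ) → v ∈ Flat.member (ruling x≢0) → OnRuling x v
    ruling-elim {x} x≢0 v∈ with a , b , e ← span₂ {u = x ⊞ 0ᵥ} {0ᵥ ⊞ σᵥ x} v∈ = a , b , trans e (lin-⊞ a b x (σᵥ x))

    ruling-intro : ∀ {x v} (x≢0 : x ≢ 0ᵥ) → OnRuling x v → v ∈ Flat.member (ruling x≢0)
    ruling-intro {x} x≢0 (a , b , e) = a ∷ b ∷ [] , trans (combination₂ a b _ _) (trans (lin-⊞ a b x (σᵥ x)) (sym e))

    s : Fin (#points n) → Line
    s i = ruling (normalised≢0 n i)

    -- A nonzero vector has a nonzero half. The first half determines the ruling directly, the
    -- second after applying σ⁻¹.
    onRuling-unique : ∀ {x y v} → v ≢ 0ᵥ → OnRuling x v → OnRuling y v → ∃[ a ] x ≡ a *ᵥ y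
    onRuling-unique {x} {y} v≢0 (a , b , e) (c , d , e′) with p , q ← ⊞-inj (trans (sym e) e′) | a ≟ 0#
    ... | no a≢0 = inv a a≢0 * c , trans (*ᵥ-inv a≢0 (sym p)) (sym (*ᵥ-assoc _ _ _))
    ... | yes refl = σ⁻¹ (inv b b≢0 * d) , σᵥ-multiple (trans (*ᵥ-inv b≢0 (sym q)) (sym (*ᵥ-assoc _ _ _)))
      where
      b≢0 : b ≢ 0#
      b≢0 refl = v≢0 (trans e (trans (cong₂ _⊞_ (*ᵥ-zeroˡ x) (*ᵥ-zeroˡ (σᵥ x))) ⊞-0))

    s-disjoint : ∀ i j → i ≢ j → ¬ (∃[ p ] p on s i × p on s j)
    s-disjoint i j i≢j (p , p∈i , p∈j)
      with a , e ← onRuling-unique (vec≢0ᵥ p) (ruling-elim (normalised≢0 n i) p∈i) (ruling-elim (normalised≢0 n j) p∈j)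
      = i≢j (normalised-inj n i j e)

    -- The map a ↦ graph (a x) counts the intersection by K itself, and q^t elements mean dimension
    -- t over F.
    ruling-weight : ∀ {x} (x≢0 : x ≢ 0ᵥ) → Weight Uσ (Flat.member (ruling x≢0)) t
    ruling-weight {x} x≢0 = OverF.hasDim-by-counting {d = t} (∩-closed (restrict (flat-closed (ruling x≢0))) U-closed)
      enumeration f f-inj (λ a → ruling-intro x≢0 (a , σ a , cong (a *ᵥ x ⊞_) (σᵥ-* a x)) , (a *ᵥ x , refl)) f-onto
      where
      f : Carrier → V
      f a = graph (a *ᵥ x)
      f-inj : Inj f
      f-inj e = *ᵥ-cancelʳ x≢0 (graph-inj e)
      f-onto : ∀ {w} → w ∈ Flat.member (ruling x≢0) ∩ member Uσ → ∃[ a ] f a ≡ w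
      f-onto (w∈ , (z , e)) with a , b , eq ← ruling-elim x≢0 w∈ =
        a , trans (cong graph (proj₁ (⊞-inj (trans (sym eq) e)))) (sym e)

    0s : Vec (V {n}) n
    0s = replicate n 0ᵥ

    combination-T₁ : ∀ c → combination c (zipWith _⊞_ (unit n) 0s) ≡ c ⊞ 0ᵥ
    combination-T₁ c = trans (combination-⊞ c (unit n) 0s) (cong₂ _⊞_ (combination-unit c) (combination-replicate-0 c))

    combination-T₂ : ∀ c → combination c (zipWith _⊞_ 0s (unit n)) ≡ 0ᵥ ⊞ c
    combination-T₂ c = trans (combination-⊞ c 0s (unit n)) (cong₂ _⊞_ (combination-replicate-0 c) (combination-unit c))

    T₁ T₂ : Flat n
    T₁ = span-flat {b = zipWith _⊞_ (unit n) 0s} (λ c e → proj₁ (⊞-≡0 (trans (sym (combination-T₁ c)) e)))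
    T₂ = span-flat {b = zipWith _⊞_ 0s (unit n)} (λ c e → proj₂ (⊞-≡0 (trans (sym (combination-T₂ c)) e)))

    ∈T₁ : ∀ x → x ⊞ 0ᵥ ∈ Flat.member T₁
    ∈T₁ x = x , combination-T₁ x

    ∈T₂ : ∀ y → 0ᵥ ⊞ y ∈ Flat.member T₂
    ∈T₂ y = y , combination-T₂ y

    T₁-transversal : Transversal Uσ s T₁
    T₁-transversal = record
      { disjoint = λ p p∈L (c , e) → let (x , a , x≢0 , a≢0 , eq) = L-elim {p} p∈L in
          σᵥ-≢0 x≢0 (*ᵥ-≡0 (proj₂ (⊞-inj (trans (sym (trans eq (⊞-* a x (σᵥ x)))) (trans (sym e) (combination-T₁ c))))) a≢0)
      ; meets = λ i → let x = normalised n i in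
          point (x ⊞ 0ᵥ) (λ e → normalised≢0 n i (proj₁ (⊞-≡0 e))) , ∈T₁ x ,
          ruling-intro (normalised≢0 n i) (1# , 0# , sym (cong₂ _⊞_ (*ᵥ-identity x) (*ᵥ-zeroˡ (σᵥ x)))) }

    T₂-transversal : Transversal Uσ s T₂
    T₂-transversal = record
      { disjoint = λ p p∈L (c , e) → let (x , a , x≢0 , a≢0 , eq) = L-elim {p} p∈L in
          x≢0 (*ᵥ-≡0 (proj₁ (⊞-inj (trans (sym (trans eq (⊞-* a x (σᵥ x)))) (trans (sym e) (combination-T₂ c))))) a≢0)
      ; meets = λ i → let x = normalised n i in
          point (0ᵥ ⊞ σᵥ x) (λ e → σᵥ-≢0 (normalised≢0 n i) (proj₂ (⊞-≡0 e))) , ∈T₂ (σᵥ x) ,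
          ruling-intro (normalised≢0 n i) (0# , 1# , sym (cong₂ _⊞_ (*ᵥ-zeroˡ x) (*ᵥ-identity (σᵥ x)))) }

    𝟏 : V {n}
    𝟏 = replicate n 1#

    𝟏≢0 : 𝟏 ≢ 0ᵥ
    𝟏≢0 = nz 2≤n
      where
      nz : ∀ {n} → 2 ≤ n → replicate n 1# ≢ 0ᵥ
      nz (s≤s _) e = 1≢0 (∷-injectiveˡ e)

    T₁≢T₂ : ¬ (T₁ ≐ᶠ T₂)
    T₁≢T₂ (f , _) with c , e ← f (∈T₁ 𝟏) = 𝟏≢0 (proj₁ (⊞-inj (trans (sym e) (combination-T₂ c))))

    -- The vector (1, w, 0, ..., 0). For w outside F it is not proportional to its image under σ,
    -- unlike the unit vectors and `𝟏`, which σ fixes.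
    1∷ : ∀ {n} → 2 ≤ n → Carrier → V {n}
    1∷ (s≤s (s≤s z≤n)) w = 1# ∷ w ∷ 0ᵥ

    1∷≢0 : ∀ {n} (le : 2 ≤ n) w → 1∷ le w ≢ 0ᵥ
    1∷≢0 (s≤s (s≤s z≤n)) w e = 1≢0 (∷-injectiveˡ e)

    1∷-coordinates : ∀ {n} (le : 2 ≤ n) w {a b γ δ} → δ *ᵥ a *ᵥ 1∷ le w ≡ γ *ᵥ b *ᵥ σᵥ 1∷ le w →
                     δ * a ≡ γ * b × δ * a * w ≡ γ * b * σ w
    1∷-coordinates (s≤s (s≤s z≤n)) w {a} {b} {γ} {δ} e = (begin
        δ * a              ≡⟨ cong (δ *_) (*-identityʳ a) ⟨
        δ * (a * 1#)       ≡⟨ ∷-injectiveˡ e ⟩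
        γ * (b * σ 1#)     ≡⟨ cong (λ z → γ * (b * z)) σ-1 ⟩
        γ * (b * 1#)       ≡⟨ cong (γ *_) (*-identityʳ b) ⟩
        γ * b              ∎) ,
      trans (*-assoc δ a w) (trans (∷-injectiveˡ (∷-injectiveʳ e)) (sym (*-assoc γ b (σ w))))

    -- By dimension, T is spanned by its points on the rulings of the unit vectors. Its point on the
    -- ruling of 𝟏 then forces one ratio γ : δ between the two components of all vectors of T.
    module Uniqueness (T : Flat n) (transversal : Transversal Uσ s T) where
      open Transversal transversal
      T-closed = flat-closed T

      -- `meets` speaks of normalised representatives. A multiple x = c y has the same ruling, with
      -- the two coefficients divided by c and by σ c.
      meets-ruling : ∀ {x} → x ≢ 0ᵥ → ∃[ a ] ∃[ b ] a *ᵥ x ⊞ b *ᵥ σᵥ x ∈ Flat.member T × ¬ (a ≡ 0# × b ≡ 0#)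
      meets-ruling {x} x≢0
        with i , c , refl ← normalise n x x≢0
        with p , p∈T , p∈s ← meets i
        with a , b , e ← ruling-elim (normalised≢0 n i) p∈s =
        a * j , b * inv (σ c) σc≢0 , subst (_∈ Flat.member T) eq p∈T , both-zero
        where
        y = normalised n i
        c≢0 : c ≢ 0#
        c≢0 = scalar≢0 x≢0 refl
        σc≢0 = σ-≢0 c≢0
        j = inv c c≢0
        rescale : ∀ {N} a c c≢0 (v : V {N}) → a *ᵥ v ≡ (a * inv c c≢0) *ᵥ c *ᵥ v
        rescale a c c≢0 v = trans (cong (_*ᵥ v) (begin
          a                     ≡⟨ *-identityʳ a ⟨
          a * 1#                ≡⟨ cong (a *_) (trans (*-comm _ _) (inv-r c c≢0)) ⟨
          a * (inv c c≢0 * c)   ≡⟨ *-assoc _ _ _ ⟨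
          a * inv c c≢0 * c     ∎)) (*ᵥ-assoc _ c v)
        eq : vec p ≡ (a * j) *ᵥ c *ᵥ y ⊞ (b * inv (σ c) σc≢0) *ᵥ σᵥ (c *ᵥ y)
        eq = trans e (cong₂ _⊞_ (rescale a c c≢0 y)
          (trans (rescale b (σ c) σc≢0 (σᵥ y)) (cong ((b * inv (σ c) σc≢0) *ᵥ_) (sym (σᵥ-* c y)))))
        both-zero : ¬ (a * j ≡ 0# × b * inv (σ c) σc≢0 ≡ 0#)
        both-zero (p₁ , p₂) = vec≢0ᵥ p (trans eq (trans (cong₂ _⊞_
          (trans (cong (_*ᵥ c *ᵥ y) p₁) (*ᵥ-zeroˡ _)) (trans (cong (_*ᵥ σᵥ (c *ᵥ y)) p₂) (*ᵥ-zeroˡ _))) ⊞-0))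

      scaled : ∀ {d} → Vec Carrier d → Vec (V {n}) d → Vec (V {n}) d
      scaled = zipWith _*ᵥ_

      NonzeroPairs : ∀ {d} → Vec Carrier d → Vec Carrier d → Set
      NonzeroPairs []      []      = Unit
      NonzeroPairs (a ∷ α) (b ∷ β) = ¬ (a ≡ 0# × b ≡ 0#) × NonzeroPairs α β

      meets-all : ∀ {d} (es : Vec (V {n}) d) → All (λ e → e ≢ 0ᵥ × σᵥ e ≡ e) es → ∃[ α ] ∃[ β ]
                  All (_∈ Flat.member T) (zipWith _⊞_ (scaled α es) (scaled β es)) × NonzeroPairs α β
      meets-all []       []                 = [] , [] , [] , tt
      meets-all (e ∷ es) ((e≢0 , fix) ∷ ps)
        with a , b , ab∈T , nz ← meets-ruling e≢0 | α , β , ∈T , nzs ← meets-all es ps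
        = a ∷ α , b ∷ β , subst (λ z → a *ᵥ e ⊞ b *ᵥ z ∈ Flat.member T) fix ab∈T ∷ ∈T , nz , nzs

      unit-fixed : ∀ n → All (λ e → e ≢ 0ᵥ × σᵥ e ≡ e) (unit n)
      unit-fixed zero    = []
      unit-fixed (suc n) = ((λ e → 1≢0 (∷-injectiveˡ e)) , cong₂ _∷_ σ-1 σᵥ-0) ∷
        Allₚ.map⁺ (All.map (λ (e≢0 , fix) → (λ e → e≢0 (∷-injectiveʳ e)) , cong₂ _∷_ σ-0 fix) (unit-fixed n))

      combination-scaled : ∀ {d} (c α : Vec Carrier d) (es : Vec (V {n}) d) →
                           combination c (scaled α es) ≡ combination (zipWith _*_ c α) es
      combination-scaled []      []      []       = refl
      combination-scaled (x ∷ c) (a ∷ α) (e ∷ es) = cong₂ _+ᵥ_ (sym (*ᵥ-assoc x a e)) (combination-scaled c α es)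

      private
        abstract
          on-units : ∃[ α ] ∃[ β ] All (_∈ Flat.member T) (zipWith _⊞_ (scaled α (unit n)) (scaled β (unit n))) × NonzeroPairs α β
          on-units = meets-all (unit n) (unit-fixed n)
          on-𝟏 : ∃[ a ] ∃[ b ] a *ᵥ 𝟏 ⊞ b *ᵥ σᵥ 𝟏 ∈ Flat.member T × ¬ (a ≡ 0# × b ≡ 0#)
          on-𝟏 = meets-ruling 𝟏≢0
        α β : Vec Carrier n
        α = proj₁ on-units
        β = proj₁ (proj₂ on-units)
        B : Vec V n
        B = zipWith _⊞_ (scaled α (unit n)) (scaled β (unit n))

        nonzeroPairs : NonzeroPairs α β
        nonzeroPairs = proj₂ (proj₂ (proj₂ on-units))

        combination-B : ∀ c → combination c B ≡ zipWith _*_ c α ⊞ zipWith _*_ c β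
        combination-B c = trans (combination-⊞ c _ _) (cong₂ _⊞_
          (trans (combination-scaled c α (unit n)) (combination-unit _))
          (trans (combination-scaled c β (unit n)) (combination-unit _)))

        independent-pairs : ∀ {d} (c α β : Vec Carrier d) → NonzeroPairs α β →
                            zipWith _*_ c α ≡ replicate d 0# → zipWith _*_ c β ≡ replicate d 0# → c ≡ replicate d 0#
        independent-pairs []      []      []      nz       p q = refl
        independent-pairs (x ∷ c) (a ∷ α) (b ∷ β) (nz , nzs) p q = cong₂ _∷_
          (decidable-stable (x ≟ 0#) (λ x≢0 → nz (*-zero⇒ (∷-injectiveˡ p) x≢0 , *-zero⇒ (∷-injectiveˡ q) x≢0)))
          (independent-pairs c α β nzs (∷-injectiveʳ p) (∷-injectiveʳ q))

        spanned : ∀ {w} → w ∈ Flat.member T → Span B w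
        spanned = independent⇒spanning T-closed (Flat.hasDim T) B (proj₁ (proj₂ (proj₂ on-units)))
          (λ c e → let (p , q) = ⊞-≡0 (trans (sym (combination-B c)) e) in independent-pairs c α β nonzeroPairs p q)

        γ δ : Carrier
        γ = proj₁ on-𝟏
        δ = proj₁ (proj₂ on-𝟏)

        γδ≢0 : ¬ (γ ≡ 0# × δ ≡ 0#)
        γδ≢0 = proj₂ (proj₂ (proj₂ on-𝟏))

        -- Coordinatewise (γ, δ) = c_i (α_i, β_i), so cross-multiplication transfers the ratio γ : δ
        -- to every combination c′.
        proportional : ∀ {d} (c c′ α β : Vec Carrier d) → γ *ᵥ replicate d 1# ≡ zipWith _*_ c α →
                       δ *ᵥ replicate d 1# ≡ zipWith _*_ c β → δ *ᵥ zipWith _*_ c′ α ≡ γ *ᵥ zipWith _*_ c′ β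
        proportional []      []        []      []      p q = refl
        proportional (x ∷ c) (x′ ∷ c′) (a ∷ α) (b ∷ β) p q = cong₂ _∷_
          (begin
            δ * (x′ * a)          ≡⟨ cong (_* (x′ * a)) (trans (sym (*-identityʳ δ)) (∷-injectiveˡ q)) ⟩
            x * b * (x′ * a)      ≡⟨ solve 4 (λ x b x′ a → x :* b :* (x′ :* a) := x :* a :* (x′ :* b)) refl x b x′ a ⟩
            x * a * (x′ * b)      ≡⟨ cong (_* (x′ * b)) (trans (sym (*-identityʳ γ)) (∷-injectiveˡ p)) ⟨
            γ * (x′ * b)          ∎)
          (proportional c c′ α β (∷-injectiveʳ p) (∷-injectiveʳ q))

        𝟏-coordinates : ∃[ c ] γ *ᵥ 𝟏 ≡ zipWith _*_ c α × δ *ᵥ 𝟏 ≡ zipWith _*_ c β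
        𝟏-coordinates = c , proj₁ eqs , trans (cong (δ *ᵥ_) (sym (σ-𝟏 n))) (proj₂ eqs)
          where
          c = proj₁ (spanned (proj₁ (proj₂ (proj₂ on-𝟏))))
          eqs : γ *ᵥ 𝟏 ≡ zipWith _*_ c α × δ *ᵥ σᵥ 𝟏 ≡ zipWith _*_ c β
          eqs = ⊞-inj (trans (sym (proj₂ (spanned (proj₁ (proj₂ (proj₂ on-𝟏)))))) (combination-B c))
          σ-𝟏 : ∀ n → σᵥ replicate n 1# ≡ replicate n 1#
          σ-𝟏 zero    = refl
          σ-𝟏 (suc n) = cong₂ _∷_ σ-1 (σ-𝟏 n)

      ratio : ∀ {x y} → x ⊞ y ∈ Flat.member T → δ *ᵥ x ≡ γ *ᵥ y
      ratio {x} {y} xy∈T = trans (cong (δ *ᵥ_) (proj₁ eqs))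
        (trans (proportional c c′ α β (proj₁ (proj₂ 𝟏-coordinates)) (proj₂ (proj₂ 𝟏-coordinates)))
          (cong (γ *ᵥ_) (sym (proj₂ eqs))))
        where
        c = proj₁ 𝟏-coordinates
        c′ = proj₁ (spanned xy∈T)
        eqs : x ≡ zipWith _*_ c′ α × y ≡ zipWith _*_ c′ β
        eqs = ⊞-inj (trans (sym (proj₂ (spanned xy∈T))) (combination-B c′))

      -- With γ and δ both nonzero, the point of T on the ruling of (1, w, 0, ..., 0) would make
      -- this vector proportional to its image under σ. Comparing the first two coordinates gives σ
      -- w = w, against w ∉ F.
      ratio-degenerate : ¬ (γ ≢ 0# × δ ≢ 0#)
      ratio-degenerate (γ≢0 , δ≢0) = w∉F (fixed (sym (*-cancelˡ (*-≢0 δ≢0 a≢0) (begin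
          δ * a * w              ≡⟨ proj₂ coordinates ⟩
          γ * b * σ w            ≡⟨ cong (_* σ w) (proj₁ coordinates) ⟨
          δ * a * σ w            ∎))))
        where
        w = proj₁ ∃∉F
        w∉F = proj₂ ∃∉F
        met : ∃[ a ] ∃[ b ] a *ᵥ 1∷ 2≤n w ⊞ b *ᵥ σᵥ 1∷ 2≤n w ∈ Flat.member T × ¬ (a ≡ 0# × b ≡ 0#)
        met = meets-ruling (1∷≢0 2≤n w)
        a = proj₁ met
        b = proj₁ (proj₂ met)
        coordinates : δ * a ≡ γ * b × δ * a * w ≡ γ * b * σ w
        coordinates = 1∷-coordinates 2≤n w (ratio (proj₁ (proj₂ (proj₂ met))))
        a≢0 : a ≢ 0#
        a≢0 e = proj₂ (proj₂ (proj₂ met))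
          (e , *-zero⇒ (trans (sym (proj₁ coordinates)) (trans (cong (δ *_) e) (zeroʳ δ))) γ≢0)

      ⊆⇒≐ : (T′ : Flat n) → (∀ {v} → v ∈ Flat.member T → v ∈ Flat.member T′) → T ≐ᶠ T′
      ⊆⇒≐ T′ T⊆T′ = T⊆T′ , λ v∈ → let (c , e) = independent⇒spanning (flat-closed T′) (Flat.hasDim T′) b
                                                  (All.map T⊆T′ inside) independent v∈
        in subst (_∈ Flat.member T) e (combination-∈ T-closed c inside)
        where
        b = proj₁ (Flat.hasDim T)
        open IsBasis (proj₂ (Flat.hasDim T))

      only : T ≐ᶠ T₁ ⊎ T ≐ᶠ T₂
      only with γ ≟ 0# | δ ≟ 0#
      ... | no γ≢0  | no δ≢0 = contradiction (γ≢0 , δ≢0) ratio-degenerate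
      ... | yes γ≡0 | yes δ≡0 = contradiction (γ≡0 , δ≡0) γδ≢0
      ... | no γ≢0  | yes δ≡0 = inj₁ (⊆⇒≐ T₁ in-T₁)
        where
        in-T₁ : ∀ {v} → v ∈ Flat.member T → v ∈ Flat.member T₁
        in-T₁ {v} v∈ with x , y , refl ← ⊞-split v = subst (λ z → x ⊞ z ∈ Flat.member T₁)
          (sym (*ᵥ-≡0 (trans (sym (ratio v∈)) (trans (cong (_*ᵥ x) δ≡0) (*ᵥ-zeroˡ x))) γ≢0)) (∈T₁ x)
      ... | yes γ≡0 | no δ≢0 = inj₂ (⊆⇒≐ T₂ in-T₂)
        where
        in-T₂ : ∀ {v} → v ∈ Flat.member T → v ∈ Flat.member T₂
        in-T₂ {v} v∈ with x , y , refl ← ⊞-split v = subst (λ z → z ⊞ y ∈ Flat.member T₂)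
          (sym (*ᵥ-≡0 (trans (ratio v∈) (trans (cong (_*ᵥ y) γ≡0) (*ᵥ-zeroˡ y))) δ≢0)) (∈T₂ y)

    pseudoregulus : PseudoregulusType L
    pseudoregulus = record
      { U = Uσ ; L≐L[U] = id , id ; maximumScattered = maximumScattered
      ; m = #points n
      ; m-value = trans (#points-count n) (cong (_∸ 1) (trans q^tn (cong (q ℕ.^_) (ℕₚ.*-comm t n))))
      ; s = s ; s-disjoint = s-disjoint ; s-weight = λ i → ruling-weight (normalised≢0 n i)
      ; T₁ = T₁ ; T₂ = T₂ ; T₁-transversal = T₁-transversal ; T₂-transversal = T₂-transversal
      ; T₁≢T₂ = T₁≢T₂ ; only-T₁-T₂ = λ T tr → Uniqueness.only T tr }

-- The structure of a set of pseudoregulus type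

module Structure {q t : ℕ} (E : FieldExtension q t) (3≤t : 3 ≤ t) (n : ℕ) (2≤n : 2 ≤ n)
                 (L : Pred (LinearSets.Point E n) 0ℓ) (P : LinearSets.PseudoregulusType E n L) where
  open Over E 3≤t
  open LinearSets E n hiding (V; 0ᵥ; _+ᵥ_; _*ᵥ_; HasDimF)
  open PseudoregulusType P
  open Point
  open Doubled {n}
  open ≡-Reasoning

  private
    W : ℕ
    W = 2 ℕ.* n
    𝕍 : Set
    𝕍 = V {W}

  module U = Subspaces.Subspace U

  U-closed : OverF.Closed (member U)
  U-closed = U.0-closed , U.+-closed , U.*-closed

  U-minus : ∀ {u v} → u ∈ member U → v ∈ member U → u -ᵥ v ∈ member U
  U-minus {u} {v} u∈ v∈ = subst (λ a → u +ᵥ a *ᵥ v ∈ member U)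
    (trans (ι-neg F.1#) (cong -_ ι-1)) (U.+-closed u∈ (U.*-closed (F.- F.1#) v∈))

  asPoint : ∀ {v : V {W}} → v ≢ 0ᵥ → Point
  asPoint {v} v≢0 = point v v≢0

  in-L[U] : ∀ {v} (v≢0 : v ≢ 0ᵥ) → v ∈ member U → asPoint v≢0 ∈ L[ U ]
  in-L[U] v≢0 v∈ = asPoint v≢0 , v∈ , Setoid.refl pointSetoid {asPoint v≢0}

  -- Scatteredness in usable form: ⟨u⟩ ∩ U has a one-element basis b over F, and from u = c b and a
  -- u = d b follows a = d / c.
  scalar-in-F : ∀ {u a} → u ≢ 0ᵥ → u ∈ member U → a *ᵥ u ∈ member U → InF a
  scalar-in-F {u} {a} u≢0 u∈ au∈ = go (proj₁ maximumScattered (asPoint u≢0) (in-L[U] u≢0 u∈))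
    where
    go : Weight U ⟨ asPoint u≢0 ⟩ 1 → InF a
    go (b ∷ [] , basis) = result (spanning ((1# , sym (*ᵥ-identity u)) , u∈)) (spanning ((a , refl) , au∈))
      where
      open Subspaces.IsBasis basis
      result : ∃[ c ] OverF.combination c (b ∷ []) ≡ u → ∃[ d ] OverF.combination d (b ∷ []) ≡ a *ᵥ u → InF a
      result (c ∷ [] , refl) (d ∷ [] , e) = (d F.* F.inv c c≢0) , (begin
          ι (d F.* j)          ≡⟨ ι-* d j ⟩
          ι d * ι j            ≡⟨ cong (_* ι j) (*ᵥ-cancelʳ b≢0 db≡) ⟩
          a * ι c * ι j        ≡⟨ *-assoc _ _ _ ⟩
          a * (ι c * ι j)      ≡⟨ cong (a *_) (trans (sym (ι-* c j)) (trans (cong ι (F.inv-r c c≢0)) ι-1)) ⟩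
          a * 1#               ≡⟨ *-identityʳ a ⟩
          a ∎)
        where
        b≢0 : b ≢ 0ᵥ
        b≢0 refl = u≢0 (trans (+ᵥ-identityʳ _) (*ᵥ-zeroʳ _))
        c≢0 : c ≢ F.0#
        c≢0 refl = u≢0 (trans (+ᵥ-identityʳ _) (trans (cong (_*ᵥ b) ι-0) (*ᵥ-zeroˡ b)))
        j = F.inv c c≢0
        db≡ : ι d *ᵥ b ≡ (a * ι c) *ᵥ b
        db≡ = trans (sym (+ᵥ-identityʳ _)) (trans e (trans (cong (a *ᵥ_) (+ᵥ-identityʳ _)) (sym (*ᵥ-assoc a _ b))))

  s-unique : ∀ {v i j} → v ≢ 0ᵥ → v ∈ Flat.member (s i) → v ∈ Flat.member (s j) → i ≡ j
  s-unique {v} {i} {j} v≢0 v∈i v∈j with i ≟ᶠ j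
  ... | yes e = e
  ... | no ¬e = contradiction (asPoint v≢0 , v∈i , v∈j) (s-disjoint i j ¬e)

  s-closed : ∀ i → Closed (Flat.member (s i))
  s-closed i = flat-closed (s i)

  private
    module SU (i : Fin m) where
      b = proj₁ (s-weight i)
      open Subspaces.IsBasis (proj₂ (s-weight i)) public
      ∩∋ : ∀ c → OverF.combination c b ∈ Flat.member (s i) ∩ member U
      ∩∋ c = OverF.combination-∈
        ((proj₁ (s-closed i) , U.0-closed) ,
         (λ (p , p′) (r , r′) → proj₁ (proj₂ (s-closed i)) p r , U.+-closed p′ r′) ,
         (λ a (p , p′) → proj₂ (proj₂ (s-closed i)) (ι a) p , U.*-closed a p′)) c inside

    module BU where
      b = proj₁ (proj₂ maximumScattered)
      open Subspaces.IsBasis (proj₂ (proj₂ maximumScattered)) public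

  abstract
    -- Each U ∩ s i has q^t - 1 nonzero vectors, and disjointness keeps them apart for different i.
    -- By `m-value` together they are q^(nt) - 1, the number of nonzero vectors of U.
    cover-U : ∀ {u} → u ∈ member U → u ≢ 0ᵥ → ∃[ i ] u ∈ Flat.member (s i)
    cover-U {u} u∈ u≢0 = result (cover (OverF.coords↔ t) (OverF.coords↔ (t ℕ.* n)) OverF.0ᶜ OverF.0ᶜ f f-0 f-unique
          (trans m-value (cong (λ k → q ℕ.^ k ∸ 1) (ℕₚ.*-comm n t))) (coord u∈) coord≢0)
      where
      coord : ∀ {u} → u ∈ member U → OverF.Coords (t ℕ.* n)
      coord u∈ = proj₁ (BU.spanning u∈)
      coord-correct : ∀ {u} (u∈ : u ∈ member U) → OverF.combination (coord u∈) BU.b ≡ u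
      coord-correct u∈ = proj₂ (BU.spanning u∈)
      coord≢0 : coord u∈ ≢ OverF.0ᶜ
      coord≢0 e = u≢0 (trans (sym (coord-correct u∈)) (trans (cong (λ c → OverF.combination c BU.b) e) (OverF.combination-0 BU.b)))
      vector : (i : Fin m) → OverF.Coords t → 𝕍
      vector i c = OverF.combination c (SU.b i)
      f : (i : Fin m) → OverF.Coords t → OverF.Coords (t ℕ.* n)
      f i c = coord (proj₂ (SU.∩∋ i c))
      f-vector : ∀ i c → OverF.combination (f i c) BU.b ≡ vector i c
      f-vector i c = coord-correct (proj₂ (SU.∩∋ i c))
      f-0 : ∀ i c → f i c ≡ OverF.0ᶜ → c ≡ OverF.0ᶜ
      f-0 i c e = SU.independent i c (trans (sym (f-vector i c))
        (trans (cong (λ c → OverF.combination c BU.b) e) (OverF.combination-0 BU.b)))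
      f-unique : ∀ i j c d → c ≢ OverF.0ᶜ → f i c ≡ f j d → i ≡ j × c ≡ d
      f-unique i j c d c≢0 e = go (s-unique (λ z → c≢0 (SU.independent i c z)) (proj₁ (SU.∩∋ i c))
          (subst (_∈ Flat.member (s j)) (sym eq) (proj₁ (SU.∩∋ j d)))) eq
        where
        eq : vector i c ≡ vector j d
        eq = trans (sym (f-vector i c)) (trans (cong (λ c → OverF.combination c BU.b) e) (f-vector j d))
        go : i ≡ j → vector i c ≡ vector j d → i ≡ j × c ≡ d
        go refl eq = refl , OverF.combination-inj (SU.independent i) eq
      result : ∃[ i ] ∃[ c ] c ≢ OverF.0ᶜ × f i c ≡ coord u∈ → ∃[ i ] u ∈ Flat.member (s i)
      result (i , c , _ , e) = i , subst (_∈ Flat.member (s i))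
        (trans (sym (f-vector i c)) (trans (cong (λ c → OverF.combination c BU.b) e) (coord-correct u∈))) (proj₁ (SU.∩∋ i c))

    ∃-on-s : ∀ i → ∃[ u ] u ≢ 0ᵥ × u ∈ member U × u ∈ Flat.member (s i)
    ∃-on-s i = OverF.combination c (SU.b i) , (λ e → 1∷≢0 (subst (λ k → 0 < k) refl (ℕₚ.≤-trans (s≤s z≤n) 3≤t)) (SU.independent i c e)) ,
      proj₂ (SU.∩∋ i c) , proj₁ (SU.∩∋ i c)
      where
      c : OverF.Coords t
      c = replicate t F.1#
      1∷≢0 : ∀ {k} → 0 < k → replicate k F.1# ≢ replicate k F.0#
      1∷≢0 (s≤s _) e = F.1≢0 (∷-injectiveˡ e)

  module Transverse (T : Flat n) (tr : Transversal U s T) where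
    open Transversal tr
    T-closed = flat-closed T

    private
      +∈ = proj₁ (proj₂ T-closed)
      *∈ = proj₂ (proj₂ T-closed)
      bT = proj₁ (Flat.hasDim T)
      open Subspaces.IsBasis (proj₂ (Flat.hasDim T))

      p : Fin m → 𝕍
      p i = vec (proj₁ (meets i))
      p≢0 : ∀ i → p i ≢ 0ᵥ
      p≢0 i = vec≢0ᵥ (proj₁ (meets i))
      p∈T : ∀ i → p i ∈ Flat.member T
      p∈T i = proj₁ (proj₂ (meets i))
      p∈s : ∀ i → p i ∈ Flat.member (s i)
      p∈s i = proj₂ (proj₂ (meets i))

    meeting : ∀ i → ∃[ v ] v ≢ 0ᵥ × v ∈ Flat.member T × v ∈ Flat.member (s i)
    meeting i = p i , p≢0 i , p∈T i , p∈s i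

    T∩U : ∀ {v} → v ∈ Flat.member T → v ∈ member U → v ≡ 0ᵥ
    T∩U {v} v∈T v∈U = decidable-stable (v ≟ᵥ 0ᵥ) (λ v≢0 → disjoint (asPoint v≢0) (in-L[U] v≢0 v∈U) v∈T)

    abstract
      -- The count of `cover-U` again: each s i contributes the q^t - 1 nonzero multiples of its
      -- point in T, and T has (q^t)^n vectors.
      cover-T : ∀ {v} → v ∈ Flat.member T → v ≢ 0ᵥ → ∃[ i ] v ∈ Flat.member (s i)
      cover-T {v} v∈ v≢0 = result (cover enumeration (coords↔ n) 0# 0ᶜ f f-0 f-unique count (coord v∈) coord≢0)
        where
        count : m ℕ.* (q ℕ.^ t ∸ 1) ≡ (q ℕ.^ t) ℕ.^ n ∸ 1
        count = trans m-value (cong (_∸ 1) (trans (cong (q ℕ.^_) (ℕₚ.*-comm n t)) (sym (ℕₚ.^-*-assoc q t n))))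
        coord : ∀ {v} → v ∈ Flat.member T → Vec Carrier n
        coord v∈ = proj₁ (spanning v∈)
        coord-correct : ∀ {v} (v∈ : v ∈ Flat.member T) → combination (coord v∈) bT ≡ v
        coord-correct v∈ = proj₂ (spanning v∈)
        coord≢0 : coord v∈ ≢ 0ᶜ
        coord≢0 e = v≢0 (trans (sym (coord-correct v∈)) (trans (cong (λ c → combination c bT) e) (combination-0 bT)))
        f : (i : Fin m) → Carrier → Vec Carrier n
        f i a = coord (*∈ a (p∈T i))
        f-vector : ∀ i a → combination (f i a) bT ≡ a *ᵥ p i
        f-vector i a = coord-correct (*∈ a (p∈T i))
        f-0 : ∀ i a → f i a ≡ 0ᶜ → a ≡ 0#
        f-0 i a e = *ᵥ-≢0 (p≢0 i) (trans (sym (f-vector i a)) (trans (cong (λ c → combination c bT) e) (combination-0 bT)))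
        f-unique : ∀ i j a b → a ≢ 0# → f i a ≡ f j b → i ≡ j × a ≡ b
        f-unique i j a b a≢0 e = go (s-unique (*ᵥ-nonzero a≢0 (p≢0 i)) (proj₂ (proj₂ (s-closed i)) a (p∈s i))
            (subst (_∈ Flat.member (s j)) (sym eq) (proj₂ (proj₂ (s-closed j)) b (p∈s j)))) eq
          where
          eq : a *ᵥ p i ≡ b *ᵥ p j
          eq = trans (sym (f-vector i a)) (trans (cong (λ c → combination c bT) e) (f-vector j b))
          go : i ≡ j → a *ᵥ p i ≡ b *ᵥ p j → i ≡ j × a ≡ b
          go refl eq = refl , *ᵥ-cancelʳ (p≢0 i) eq
        result : ∃[ i ] ∃[ a ] a ≢ 0# × f i a ≡ coord v∈ → ∃[ i ] v ∈ Flat.member (s i)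
        result (i , a , _ , e) = i , subst (_∈ Flat.member (s i))
          (trans (sym (f-vector i a)) (trans (cong (λ c → combination c bT) e) (coord-correct v∈))) (proj₂ (proj₂ (s-closed i)) a (p∈s i))

    spans-s : ∀ i {u v w} → Indep₂ u v → u ∈ Flat.member (s i) → v ∈ Flat.member (s i) → w ∈ Flat.member (s i) →
              ∃[ a ] ∃[ b ] w ≡ a *ᵥ u +ᵥ b *ᵥ v
    spans-s i {u} {v} ind u∈ v∈ w∈ = span₂ (independent⇒spanning (s-closed i) (Flat.hasDim (s i)) (u ∷ v ∷ []) (u∈ ∷ v∈ ∷ []) (indep₂⇒ ind) w∈)

    -- Two independent vectors of T on s i would put the whole line into T, including its nonzero
    -- vectors of U.
    T∩s : ∀ i {v w} → v ≢ 0ᵥ → v ∈ Flat.member T → v ∈ Flat.member (s i) → w ∈ Flat.member T → w ∈ Flat.member (s i) → ∃[ a ] w ≡ a *ᵥ v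
    T∩s i {v} {w} v≢0 v∈T v∈s w∈T w∈s with search enumeration (λ a → w ≟ᵥ a *ᵥ v)
    ... | yes r = r
    ... | no ¬r = ⊥-elim (impossible (∃-on-s i))
      where
      impossible : ∃[ u ] u ≢ 0ᵥ × u ∈ member U × u ∈ Flat.member (s i) → ⊥
      impossible (u , u≢0 , u∈U , u∈s) =
        let (a , b , e) = spans-s i (indep₂-intro v≢0 (λ a e → ¬r (a , e))) v∈s w∈s u∈s
        in u≢0 (T∩U (subst (_∈ Flat.member T) (sym e) (+∈ (*∈ a v∈T) (*∈ b w∈T))) u∈U)

    U-T-indep : ∀ {u v} → v ≢ 0ᵥ → v ∈ Flat.member T → u ≢ 0ᵥ → u ∈ member U → Indep₂ v u
    U-T-indep v≢0 v∈T u≢0 u∈U = indep₂-intro v≢0 (λ a e → u≢0 (T∩U (subst (_∈ Flat.member T) (sym e) (*∈ a v∈T)) u∈U))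

    -- w represents a·u in the K-structure that U inherits from V / T.
    Shift : Carrier → 𝕍 → 𝕍 → Set
    Shift a u w = w ∈ member U × w -ᵥ a *ᵥ u ∈ Flat.member T

    -- T contains no nonzero vector of U, so U embeds in V / T.
    shift-unique : ∀ {a u w w′} → Shift a u w → Shift a u w′ → w ≡ w′
    shift-unique {a} {u} {w} {w′} (w∈ , d) (w′∈ , d′) = -ᵥ≡0⇒ (T∩U
      (subst (_∈ Flat.member T) (-ᵥ-cancelʳ w w′ (a *ᵥ u)) (closed-- T-closed d d′)) (U-minus w∈ w′∈))

    shift-+ : ∀ {a u v w w′} → Shift a u w → Shift a v w′ → Shift a (u +ᵥ v) (w +ᵥ w′)
    shift-+ {a} {u} {v} {w} {w′} (w∈ , d) (w′∈ , d′) = U.+-closed w∈ w′∈ , subst (_∈ Flat.member T) (-ᵥ-*ᵥ-sum a w w′ u v) (+∈ d d′)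

    shift-scalars : ∀ {a b u w w′} → Shift a u w → Shift b u w′ → Shift (a + b) u (w +ᵥ w′)
    shift-scalars {a} {b} {u} {w} {w′} (w∈ , d) (w′∈ , d′) = U.+-closed w∈ w′∈ , subst (_∈ Flat.member T) (-ᵥ-*ᵥ-scalars a b w w′ u) (+∈ d d′)

    shift-compose : ∀ {a b u w z} → Shift a u w → Shift b w z → Shift (b * a) u z
    shift-compose {a} {b} {u} {w} {z} (_ , d) (z∈ , d′) = z∈ , subst (_∈ Flat.member T) (-ᵥ-*ᵥ-compose a b z w u) (+∈ d′ (*∈ b d))

    shift-self : ∀ {a u} → a *ᵥ u ∈ member U → Shift a u (a *ᵥ u)
    shift-self au∈ = au∈ , subst (_∈ Flat.member T) (sym (-ᵥ-self _)) (proj₁ T-closed)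

    shift-scalar-unique : ∀ {a b u w} → u ≢ 0ᵥ → u ∈ member U → Shift a u w → Shift b u w → a ≡ b
    shift-scalar-unique {a} {b} {u} {w} u≢0 u∈ (_ , d) (_ , d′) with (b - a) ≟ 0#
    ... | yes e = sym (-≡0⇒ e)
    ... | no b-a≢0 = contradiction (T∩U (subst (_∈ Flat.member T) (sym (*ᵥ-inv b-a≢0 refl))
        (*∈ (inv (b - a) b-a≢0) (subst (_∈ Flat.member T) (-ᵥ-*ᵥ-difference a b w u) (closed-- T-closed d d′)))) u∈) u≢0

    abstract
      -- w ↦ (coefficient of u) is an injection from U ∩ s i to K, hence onto.
      shift-on-s : ∀ i {u} a → u ≢ 0ᵥ → u ∈ member U → u ∈ Flat.member (s i) → ∃[ w ] w ∈ Flat.member (s i) × Shift a u w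
      shift-on-s i {u} a u≢0 u∈U u∈s = result (inj⇒surj (OverF.coords↔ t) enumeration {f} f-inj a)
        where
        ind : Indep₂ (p i) u
        ind = U-T-indep (p≢0 i) (p∈T i) u≢0 u∈U
        w : OverF.Coords t → 𝕍
        w c = OverF.combination c (SU.b i)
        expand : ∀ c → ∃[ α ] ∃[ β ] w c ≡ α *ᵥ p i +ᵥ β *ᵥ u
        expand c = spans-s i ind (p∈s i) u∈s (proj₁ (SU.∩∋ i c))
        f : OverF.Coords t → Carrier
        f c = proj₁ (proj₂ (expand c))
        shifted : ∀ c → Shift (f c) u (w c)
        shifted c = proj₂ (SU.∩∋ i c) , subst (_∈ Flat.member T)
          (sym (trans (cong (_-ᵥ f c *ᵥ u) (proj₂ (proj₂ (expand c)))) (+ᵥ-cancelʳ _ (f c *ᵥ u)))) (*∈ _ (p∈T i))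
        f-inj : Inj f
        f-inj {c} {d} e = OverF.combination-inj (SU.independent i) (shift-unique (shifted c) (subst (λ a → Shift a u (w d)) (sym e) (shifted d)))
        result : ∃[ c ] f c ≡ a → ∃[ w ] w ∈ Flat.member (s i) × Shift a u w
        result (c , e) = w c , proj₁ (SU.∩∋ i c) , subst (λ a → Shift a u (w c)) e (shifted c)

  module Tr₁ = Transverse T₁ T₁-transversal
  module Tr₂ = Transverse T₂ T₂-transversal

  -- The T₂-structure multiplies u by a where the T₁-structure multiplies it by b.
  Rel : Carrier → Carrier → 𝕍 → Set
  Rel a b u = ∃[ w ] Tr₂.Shift a u w × Tr₁.Shift b u w

  rel-unique : ∀ {a b c u} → u ≢ 0ᵥ → u ∈ member U → Rel a b u → Rel a c u → b ≡ c
  rel-unique {b = b} {c} {u} u≢0 u∈ (w , h₂ , h₁) (w′ , h₂′ , h₁′) = Tr₁.shift-scalar-unique u≢0 u∈ h₁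
    (subst (Tr₁.Shift c u) (sym (Tr₂.shift-unique h₂ h₂′)) h₁′)

  -- Here the two structures are seen to have the same one-dimensional subspaces. The vector w that
  -- represents a u for T₂ lies on s i, so w = α v + β u with v ∈ T₁ ∩ s i, and β is its scalar for
  -- T₁.
  rel-on-s : ∀ i {u} a → u ≢ 0ᵥ → u ∈ member U → u ∈ Flat.member (s i) → ∃[ b ] Rel a b u
  rel-on-s i {u} a u≢0 u∈U u∈s = from (Tr₂.shift-on-s i a u≢0 u∈U u∈s) (Tr₁.meeting i)
    where
    from : ∃[ w ] w ∈ Flat.member (s i) × Tr₂.Shift a u w → ∃[ v ] v ≢ 0ᵥ × v ∈ Flat.member T₁ × v ∈ Flat.member (s i) → ∃[ b ] Rel a b u
    from (w , w∈s , h) (v , v≢0 , v∈T , v∈s) =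
      let (α , β , e) = Tr₁.spans-s i (Tr₁.U-T-indep v≢0 v∈T u≢0 u∈U) v∈s u∈s w∈s
      in β , w , h , proj₁ h , subst (_∈ Flat.member T₁) (sym (trans (cong (_-ᵥ β *ᵥ u) e) (+ᵥ-cancelʳ (α *ᵥ v) (β *ᵥ u))))
                                 (proj₂ (proj₂ Tr₁.T-closed) α v∈T)

  rel-total : ∀ {u} a → u ≢ 0ᵥ → u ∈ member U → ∃[ b ] Rel a b u
  rel-total a u≢0 u∈ = let (i , u∈s) = cover-U u∈ u≢0 in rel-on-s i a u≢0 u∈ u∈s

  -- The scalar `e` belonging to u + v acts on both summands. Since s i and s j share no nonzero
  -- vector, the equation between the two sums splits into one on each line, and both scalars equal
  -- `e`.
  rel-agree : ∀ {i j a b c u v} → i ≢ j → u ≢ 0ᵥ → u ∈ member U → u ∈ Flat.member (s i) →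
              v ≢ 0ᵥ → v ∈ member U → v ∈ Flat.member (s j) → Rel a b u → Rel a c v → b ≡ c
  rel-agree {i} {j} {a} {b} {c} {u} {v} i≢j u≢0 u∈U u∈i v≢0 v∈U v∈j (w , h₂ , h₁) (w′ , h₂′ , h₁′) =
    from (rel-total a u+v≢0 (U.+-closed u∈U v∈U))
    where
    apart : ∀ {x y} → x ∈ Flat.member (s i) → y ∈ Flat.member (s j) → x ≡ y → x ≡ 0ᵥ
    apart {x} x∈ y∈ refl = decidable-stable (x ≟ᵥ 0ᵥ) (λ x≢0 → i≢j (s-unique x≢0 x∈ y∈))
    u+v≢0 : u +ᵥ v ≢ 0ᵥ
    u+v≢0 e = u≢0 (apart u∈i (closed-- (s-closed j) (proj₁ (s-closed j)) v∈j)
      (trans (sym (+ᵥ-cancelʳ u v)) (cong (_-ᵥ v) e)))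
    -- `shift-on-s` finds a representative on s k, and representatives are unique.
    local₁ : ∀ {k b x y} → x ≢ 0ᵥ → x ∈ member U → x ∈ Flat.member (s k) → Tr₁.Shift b x y → y ∈ Flat.member (s k)
    local₁ {k} {b} x≢0 x∈U x∈s h = let (y′ , y′∈ , h′) = Tr₁.shift-on-s k b x≢0 x∈U x∈s
      in subst (_∈ Flat.member (s k)) (Tr₁.shift-unique h′ h) y′∈
    from : ∃[ e ] Rel a e (u +ᵥ v) → b ≡ c
    from (e , z , k₂ , k₁) = trans (Tr₁.shift-scalar-unique u≢0 u∈U h₁ (subst (Tr₁.Shift e u) (sym w≡x) hx))
                               (Tr₁.shift-scalar-unique v≢0 v∈U (subst (Tr₁.Shift e v) y≡w′ hy) h₁′)
      where
      sx = Tr₁.shift-on-s i e u≢0 u∈U u∈i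
      sy = Tr₁.shift-on-s j e v≢0 v∈U v∈j
      x = proj₁ sx
      y = proj₁ sy
      hx = proj₂ (proj₂ sx)
      hy = proj₂ (proj₂ sy)
      sums : w +ᵥ w′ ≡ x +ᵥ y
      sums = trans (Tr₂.shift-unique (Tr₂.shift-+ h₂ h₂′) k₂) (Tr₁.shift-unique k₁ (Tr₁.shift-+ hx hy))
      w-x≡0 : w -ᵥ x ≡ 0ᵥ
      w-x≡0 = apart (closed-- (s-closed i) (local₁ u≢0 u∈U u∈i h₁) (proj₁ (proj₂ sx)))
                    (closed-- (s-closed j) (proj₁ (proj₂ sy)) (local₁ v≢0 v∈U v∈j h₁′)) (+ᵥ-exchange sums)
      w≡x : w ≡ x
      w≡x = -ᵥ≡0⇒ w-x≡0
      y≡w′ : y ≡ w′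
      y≡w′ = -ᵥ≡0⇒ (trans (sym (+ᵥ-exchange sums)) w-x≡0)

  -- T₁ contains two independent vectors because `n ≥ 2`, and they lie on different lines because T₁
  -- meets each s i in a single point.
  two-lines : ∃[ i ] ∃[ j ] i ≢ j
  two-lines = go (indep-pair 2≤n b inside independent)
    where
    b = proj₁ (Flat.hasDim T₁)
    open Subspaces.IsBasis (proj₂ (Flat.hasDim T₁))
    indep-pair : ∀ {k} {A : Pred 𝕍 0ℓ} → 2 ≤ k → (b : Vec 𝕍 k) → All (_∈ A) b → Independent b → ∃[ u ] ∃[ v ] u ∈ A × v ∈ A × Indep₂ u v
    indep-pair (s≤s (s≤s z≤n)) (u ∷ v ∷ b) (u∈ ∷ v∈ ∷ _) ind = u , v , u∈ , v∈ , λ α β e →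
      let eq = ind (α ∷ β ∷ 0ᶜ) (trans (cong (λ z → α *ᵥ u +ᵥ (β *ᵥ v +ᵥ z)) (combination-0 b))
                 (trans (cong (α *ᵥ u +ᵥ_) (+ᵥ-identityʳ _)) e))
      in ∷-injectiveˡ eq , ∷-injectiveˡ (∷-injectiveʳ eq)
    go : ∃[ u ] ∃[ v ] u ∈ Flat.member T₁ × v ∈ Flat.member T₁ × Indep₂ u v → ∃[ i ] ∃[ j ] i ≢ j
    go (u , v , u∈ , v∈ , ind) =
      let (i , u∈i) = Tr₁.cover-T u∈ (indep₂-≢0ˡ ind)
          (j , v∈j) = Tr₁.cover-T v∈ (indep₂-≢0ˡ (indep₂-sym ind))
      in i , j , λ e → let (a , eq) = Tr₁.T∩s i (indep₂-≢0ˡ ind) u∈ u∈i v∈ (subst (λ k → v ∈ Flat.member (s k)) (sym e) v∈j)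
                       in indep₂-≢ ind a eq

  private
    i₀ j₀ : Fin m
    i₀ = proj₁ two-lines
    j₀ = proj₁ (proj₂ two-lines)
    i₀≢j₀ = proj₂ (proj₂ two-lines)
    u₀ = proj₁ (∃-on-s i₀)
    u₀≢0 = proj₁ (proj₂ (∃-on-s i₀))
    u₀∈U = proj₁ (proj₂ (proj₂ (∃-on-s i₀)))
    u₀∈s = proj₂ (proj₂ (proj₂ (∃-on-s i₀)))
    v₀≢0 = proj₁ (proj₂ (∃-on-s j₀))
    v₀∈U = proj₁ (proj₂ (proj₂ (∃-on-s j₀)))
    v₀∈s = proj₂ (proj₂ (proj₂ (∃-on-s j₀)))

  σ : Carrier → Carrier
  σ a = proj₁ (rel-total a u₀≢0 u₀∈U)

  rel-u₀ : ∀ a → Rel a (σ a) u₀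
  rel-u₀ a = proj₂ (rel-total a u₀≢0 u₀∈U)

  -- `rel-agree` compares different lines only. If u lies on the line of u₀, both are compared with
  -- v₀ on a second line.
  rel-σ : ∀ {u} a → u ≢ 0ᵥ → u ∈ member U → Rel a (σ a) u
  rel-σ {u} a u≢0 u∈U = from (cover-U u∈U u≢0)
    where
    from : ∃[ i ] u ∈ Flat.member (s i) → Rel a (σ a) u
    from (i , u∈i) = case (i ≟ᶠ i₀)
      where
      b = proj₁ (rel-total a u≢0 u∈U)
      r = proj₂ (rel-total a u≢0 u∈U)
      c = proj₁ (rel-total a v₀≢0 v₀∈U)
      r′ = proj₂ (rel-total a v₀≢0 v₀∈U)
      case : Dec (i ≡ i₀) → Rel a (σ a) u
      case (no i≢i₀) = subst (λ b → Rel a b u) (rel-agree i≢i₀ u≢0 u∈U u∈i u₀≢0 u₀∈U u₀∈s r (rel-u₀ a)) r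
      case (yes e) = subst (λ b → Rel a b u)
        (trans (rel-agree (λ i≡j₀ → i₀≢j₀ (trans (sym e) i≡j₀)) u≢0 u∈U u∈i v₀≢0 v₀∈U v₀∈s r r′)
               (sym (rel-agree i₀≢j₀ u₀≢0 u₀∈U u₀∈s v₀≢0 v₀∈U v₀∈s (rel-u₀ a) r′))) r

  σ-intro : ∀ {a b} → Rel a b u₀ → σ a ≡ b
  σ-intro {a} r = rel-unique u₀≢0 u₀∈U (rel-u₀ a) r

  -- On the line through a common point of T₁ and T₂ both structures agree; as σ is
  -- the same on all lines, they agree everywhere.
  T₁∩T₂-σ : ∀ {v} → v ≢ 0ᵥ → v ∈ Flat.member T₁ → v ∈ Flat.member T₂ → ∀ a → σ a ≡ a
  T₁∩T₂-σ {v} v≢0 v∈₁ v∈₂ a = from (Tr₁.cover-T v∈₁ v≢0)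
    where
    from : ∃[ i ] v ∈ Flat.member (s i) → σ a ≡ a
    from (i , v∈i) = rel-unique u≢0 u∈U (rel-σ a u≢0 u∈U)
        (w , (proj₁ h , subst (_∈ Flat.member T₂) (sym (proj₂ on-v)) (proj₂ (proj₂ Tr₂.T-closed) _ v∈₂)) , h)
      where
      u≢0 = proj₁ (proj₂ (∃-on-s i))
      u∈U = proj₁ (proj₂ (proj₂ (∃-on-s i)))
      u∈i = proj₂ (proj₂ (proj₂ (∃-on-s i)))
      shifted = Tr₁.shift-on-s i a u≢0 u∈U u∈i
      w = proj₁ shifted
      h = proj₂ (proj₂ shifted)
      on-v = Tr₁.T∩s i v≢0 v∈₁ v∈i (proj₂ h)
        (closed-- (s-closed i) (proj₁ (proj₂ shifted)) (proj₂ (proj₂ (s-closed i)) a u∈i))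

  -- For x ∉ F let w represent x u in both structures. Then d = w - x u lies in T₁, in T₂ and on s
  -- i, and it is nonzero since scatteredness keeps x u out of U. So T₁ and T₂ meet every s i in the
  -- same point, and as these points cover both, T₁ = T₂.
  module _ (σ≡id : ∀ a → σ a ≡ a) where
    private
      x = proj₁ ∃∉F
      module _ (i : Fin m) where
        u = proj₁ (∃-on-s i)
        u≢0 = proj₁ (proj₂ (∃-on-s i))
        u∈U = proj₁ (proj₂ (proj₂ (∃-on-s i)))
        u∈i = proj₂ (proj₂ (proj₂ (∃-on-s i)))
        rel : Rel x x u
        rel = subst (λ b → Rel x b u) (σ≡id x) (rel-σ x u≢0 u∈U)
        d : 𝕍
        d = proj₁ rel -ᵥ x *ᵥ u
        d≢0 : d ≢ 0ᵥ
        d≢0 e = proj₂ ∃∉F (scalar-in-F u≢0 u∈U (subst (_∈ member U) (-ᵥ≡0⇒ e) (proj₁ (proj₁ (proj₂ rel)))))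
        d∈₂ : d ∈ Flat.member T₂
        d∈₂ = proj₂ (proj₁ (proj₂ rel))
        d∈₁ : d ∈ Flat.member T₁
        d∈₁ = proj₂ (proj₂ (proj₂ rel))
        d∈i : d ∈ Flat.member (s i)
        d∈i = let (w , w∈ , h) = Tr₁.shift-on-s i x u≢0 u∈U u∈i in
          closed-- (s-closed i) (subst (_∈ Flat.member (s i)) (Tr₁.shift-unique h (proj₂ (proj₂ rel))) w∈) (proj₂ (proj₂ (s-closed i)) x u∈i)

    σ≢id : ⊥
    σ≢id = T₁≢T₂ (T₁⊆T₂ , T₂⊆T₁)
      where
      T₁⊆T₂ : ∀ {v} → v ∈ Flat.member T₁ → v ∈ Flat.member T₂
      T₁⊆T₂ {v} v∈ = case (v ≟ᵥ 0ᵥ)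
        where
        case : Dec (v ≡ 0ᵥ) → v ∈ Flat.member T₂
        case (yes e) = subst (_∈ Flat.member T₂) (sym e) (proj₁ Tr₂.T-closed)
        case (no v≢0) = let (i , v∈i) = Tr₁.cover-T v∈ v≢0
                            (a , e) = Tr₁.T∩s i (d≢0 i) (d∈₁ i) (d∈i i) v∈ v∈i
          in subst (_∈ Flat.member T₂) (sym e) (proj₂ (proj₂ Tr₂.T-closed) a (d∈₂ i))
      T₂⊆T₁ : ∀ {v} → v ∈ Flat.member T₂ → v ∈ Flat.member T₁
      T₂⊆T₁ {v} v∈ = case (v ≟ᵥ 0ᵥ)
        where
        case : Dec (v ≡ 0ᵥ) → v ∈ Flat.member T₁
        case (yes e) = subst (_∈ Flat.member T₁) (sym e) (proj₁ Tr₁.T-closed)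
        case (no v≢0) = let (i , v∈i) = Tr₂.cover-T v∈ v≢0
                            (a , e) = Tr₂.T∩s i (d≢0 i) (d∈₂ i) (d∈i i) v∈ v∈i
          in subst (_∈ Flat.member T₁) (sym e) (proj₂ (proj₂ Tr₁.T-closed) a (d∈₁ i))

  T₁∩T₂ : ∀ {v} → v ∈ Flat.member T₁ → v ∈ Flat.member T₂ → v ≡ 0ᵥ
  T₁∩T₂ {v} v∈₁ v∈₂ = decidable-stable (v ≟ᵥ 0ᵥ) (λ v≢0 → σ≢id (T₁∩T₂-σ v≢0 v∈₁ v∈₂))

  σ-endo : Endo σ
  σ-endo = record
    { σ-+ = λ a b → let (w , h₂ , h₁) = rel-u₀ a ; (w′ , h₂′ , h₁′) = rel-u₀ b
        in σ-intro (w +ᵥ w′ , Tr₂.shift-scalars h₂ h₂′ , Tr₁.shift-scalars h₁ h₁′)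
    ; σ-* = σ-*
    ; σ-ι = λ c → σ-intro (ι c *ᵥ u₀ , Tr₂.shift-self (U.*-closed c u₀∈U) , Tr₁.shift-self (U.*-closed c u₀∈U)) }
    where
    σ-* : ∀ a b → σ (a * b) ≡ σ a * σ b
    σ-* a b = from (rel-u₀ b)
      where
      from : Rel b (σ b) u₀ → σ (a * b) ≡ σ a * σ b
      from (w , h₂ , h₁) = case (w ≟ᵥ 0ᵥ)
        where
        compose : Rel a (σ a) w → σ (a * b) ≡ σ a * σ b
        compose (z , k₂ , k₁) = σ-intro (z , Tr₂.shift-compose h₂ k₂ , Tr₁.shift-compose h₁ k₁)
        case : Dec (w ≡ 0ᵥ) → σ (a * b) ≡ σ a * σ b
        case (no w≢0) = compose (rel-σ a w≢0 (proj₁ h₂))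
        -- `rel-σ` asks for a nonzero vector. If b u₀ is represented by 0, then 0 also represents a
        -- b u₀ in both structures.
        case (yes e) = compose (0ᵥ , (U.0-closed , subst (_∈ Flat.member T₂) (sym (zero-shift a e)) (proj₁ Tr₂.T-closed))
                                   , (U.0-closed , subst (_∈ Flat.member T₁) (sym (zero-shift (σ a) e)) (proj₁ Tr₁.T-closed)))
          where
          zero-shift : ∀ a {w : 𝕍} → w ≡ 0ᵥ → 0ᵥ -ᵥ a *ᵥ w ≡ 0ᵥ
          zero-shift a refl = trans (cong (0ᵥ -ᵥ_) (*ᵥ-zeroʳ a)) (-ᵥ-self 0ᵥ)

  -- For a fixed scalar, w - a u₀ lies in T₁ ∩ T₂ = 0. So a u₀ itself is in U, and scatteredness
  -- puts a in F.
  σ-fixed : ∀ {a} → σ a ≡ a → InF a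
  σ-fixed {a} e = from (rel-u₀ a)
    where
    from : Rel a (σ a) u₀ → InF a
    from (w , (w∈ , d₂) , (_ , d₁)) = scalar-in-F u₀≢0 u₀∈U (subst (_∈ member U)
      (-ᵥ≡0⇒ (T₁∩T₂ (subst (λ b → w -ᵥ b *ᵥ u₀ ∈ Flat.member T₁) e d₁) d₂)) w∈)

  abstract
    σ-frobenius : ∃[ k ] k < t × (∀ x → σ x ≡ Frob k x)
    σ-frobenius = endo-frobenius σ-endo

  k : ℕ
  k = proj₁ σ-frobenius

  k<t : k < t
  k<t = proj₁ (proj₂ σ-frobenius)

  σ≡Frob : ∀ x → σ x ≡ Frob k x
  σ≡Frob = proj₂ (proj₂ σ-frobenius)

  abstract
    k-coprime : Coprime k t
    k-coprime = fixed⇒coprime k (λ {x} e → σ-fixed (trans (σ≡Frob x) e))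

  -- The vector w that represents a (x + y) for T₂ and σ a (x + y) for T₁ differs from a x + σ a y
  -- by an element of T₁ ∩ T₂, in view of `-ᵥ-*ᵥ-components`. This is the semilinearity of the map
  -- whose graph is U.
  component-scaling : ∀ {x y} a → x ∈ Flat.member T₁ → y ∈ Flat.member T₂ → x +ᵥ y ∈ member U → a *ᵥ x +ᵥ σ a *ᵥ y ∈ member U
  component-scaling {x} {y} a x∈ y∈ xy∈ = case (x +ᵥ y ≟ᵥ 0ᵥ)
    where
    from : Rel a (σ a) (x +ᵥ y) → a *ᵥ x +ᵥ σ a *ᵥ y ∈ member U
    from (w , (w∈ , d₂) , (_ , d₁)) = subst (_∈ member U) (-ᵥ≡0⇒ (T₁∩T₂
      (subst (_∈ Flat.member T₁) (proj₂ (-ᵥ-*ᵥ-components a (σ a) w x y)) (proj₁ (proj₂ Tr₁.T-closed) d₁ (proj₂ (proj₂ Tr₁.T-closed) _ x∈)))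
      (subst (_∈ Flat.member T₂) (proj₁ (-ᵥ-*ᵥ-components a (σ a) w x y)) (proj₁ (proj₂ Tr₂.T-closed) d₂ (proj₂ (proj₂ Tr₂.T-closed) _ y∈))))) w∈
    case : Dec (x +ᵥ y ≡ 0ᵥ) → a *ᵥ x +ᵥ σ a *ᵥ y ∈ member U
    case (no nz) = from (rel-σ a nz xy∈)
    case (yes e) = subst (_∈ member U) (sym (trans (cong₂ (λ x y → a *ᵥ x +ᵥ σ a *ᵥ y) x≡0 y≡0)
        (trans (cong₂ _+ᵥ_ (*ᵥ-zeroʳ a) (*ᵥ-zeroʳ (σ a))) (+ᵥ-identityˡ 0ᵥ)))) U.0-closed
      where
      x≡-y : x ≡ 0ᵥ -ᵥ y
      x≡-y = trans (sym (+ᵥ-cancelʳ x y)) (cong (_-ᵥ y) e)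
      x≡0 : x ≡ 0ᵥ
      x≡0 = T₁∩T₂ x∈ (subst (_∈ Flat.member T₂) (sym x≡-y) (closed-- Tr₂.T-closed (proj₁ Tr₂.T-closed) y∈))
      y≡0 : y ≡ 0ᵥ
      y≡0 = trans (sym (+ᵥ-identityˡ y)) (trans (cong (_+ᵥ y) (sym x≡0)) e)

  -- On the line s i through x take u = α x + β r in U, with r ∈ T₂. Here α ≠ 0, since otherwise u
  -- would lie in T₂, and `component-scaling` by the inverse of α turns α x into x.
  partner : ∀ {x} → x ∈ Flat.member T₁ → x ≢ 0ᵥ → ∃[ y ] y ∈ Flat.member T₂ × x +ᵥ y ∈ member U
  partner {x} x∈ x≢0 = from (Tr₁.cover-T x∈ x≢0)
    where
    from : ∃[ i ] x ∈ Flat.member (s i) → ∃[ y ] y ∈ Flat.member T₂ × x +ᵥ y ∈ member U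
    from (i , x∈i) = build (∃-on-s i) (Tr₂.meeting i)
      where
      build : ∃[ u ] u ≢ 0ᵥ × u ∈ member U × u ∈ Flat.member (s i) →
              ∃[ r ] r ≢ 0ᵥ × r ∈ Flat.member T₂ × r ∈ Flat.member (s i) → ∃[ y ] y ∈ Flat.member T₂ × x +ᵥ y ∈ member U
      build (u , u≢0 , u∈U , u∈i) (r , r≢0 , r∈ , r∈i) = split (Tr₁.spans-s i x-r x∈i r∈i u∈i)
        where
        x-r : Indep₂ x r
        x-r = indep₂-intro x≢0 (λ a e → r≢0 (T₁∩T₂ (subst (_∈ Flat.member T₁) (sym e) (proj₂ (proj₂ Tr₁.T-closed) a x∈)) r∈))
        split : ∃[ α ] ∃[ β ] u ≡ α *ᵥ x +ᵥ β *ᵥ r → ∃[ y ] y ∈ Flat.member T₂ × x +ᵥ y ∈ member U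
        split (α , β , e) = y , y∈ , subst (λ z → z +ᵥ y ∈ member U) x≡ (component-scaling (inv α α≢0)
            (proj₂ (proj₂ Tr₁.T-closed) α x∈) (proj₂ (proj₂ Tr₂.T-closed) β r∈) (subst (_∈ member U) e u∈U))
          where
          α≢0 : α ≢ 0#
          α≢0 α≡0 = u≢0 (Tr₂.T∩U (subst (_∈ Flat.member T₂) (sym (trans e (trans (cong (λ z → z *ᵥ x +ᵥ β *ᵥ r) α≡0)
            (trans (cong (_+ᵥ β *ᵥ r) (*ᵥ-zeroˡ x)) (+ᵥ-identityˡ _))))) (proj₂ (proj₂ Tr₂.T-closed) β r∈)) u∈U)
          y = σ (inv α α≢0) *ᵥ β *ᵥ r
          y∈ : y ∈ Flat.member T₂
          y∈ = proj₂ (proj₂ Tr₂.T-closed) _ (proj₂ (proj₂ Tr₂.T-closed) β r∈)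
          x≡ : inv α α≢0 *ᵥ α *ᵥ x ≡ x
          x≡ = sym (*ᵥ-inv α≢0 refl)

  private
    module B₁ = Subspaces.IsBasis (proj₂ (Flat.hasDim T₁))
    ts : Vec 𝕍 n
    ts = proj₁ (Flat.hasDim T₁)

  partners : ∀ {d} {xs : Vec 𝕍 d} → All (_∈ Flat.member T₁) xs → ∃[ ys ] All (_∈ Flat.member T₂) ys × All (_∈ member U) (zipWith _+ᵥ_ xs ys)
  partners []       = [] , [] , []
  partners {xs = x ∷ xs} (x∈ ∷ xs∈) = add (case (x ≟ᵥ 0ᵥ)) (partners xs∈)
    where
    case : Dec (x ≡ 0ᵥ) → ∃[ y ] y ∈ Flat.member T₂ × x +ᵥ y ∈ member U
    case (no x≢0) = partner x∈ x≢0
    -- The induction carries membership in T₁ only, so a zero vector has to be served too; its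
    -- partner is zero.
    case (yes e)  = 0ᵥ , proj₁ Tr₂.T-closed , subst (_∈ member U) (sym (trans (cong (_+ᵥ 0ᵥ) e) (+ᵥ-identityˡ 0ᵥ))) U.0-closed
    add : ∃[ y ] y ∈ Flat.member T₂ × x +ᵥ y ∈ member U →
          ∃[ ys ] All (_∈ Flat.member T₂) ys × All (_∈ member U) (zipWith _+ᵥ_ xs ys) →
          ∃[ ys ] All (_∈ Flat.member T₂) ys × All (_∈ member U) (zipWith _+ᵥ_ (x ∷ xs) ys)
    add (y , y∈ , xy∈) (ys , ys∈ , xys∈) = y ∷ ys , y∈ ∷ ys∈ , xy∈ ∷ xys∈

  private
    ys : Vec 𝕍 n
    ys = proj₁ (partners B₁.inside)
    ys∈ : All (_∈ Flat.member T₂) ys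
    ys∈ = proj₁ (proj₂ (partners B₁.inside))

  graph-combination : ∀ {d} (c : Vec Carrier d) {xs ys : Vec 𝕍 d} → All (_∈ Flat.member T₁) xs → All (_∈ Flat.member T₂) ys →
                      All (_∈ member U) (zipWith _+ᵥ_ xs ys) → combination c xs +ᵥ combination (map (Frob k) c) ys ∈ member U
  graph-combination []      []       []       []         = subst (_∈ member U) (sym (+ᵥ-identityˡ 0ᵥ)) U.0-closed
  graph-combination (a ∷ c) {x ∷ xs} {y ∷ ys} (x∈ ∷ xs∈) (y∈ ∷ ys∈) (xy∈ ∷ xys∈) = subst (_∈ member U)
    (+ᵥ-interchange (a *ᵥ x) (Frob k a *ᵥ y) (combination c xs) (combination (map (Frob k) c) ys))
    (U.+-closed (subst (λ b → a *ᵥ x +ᵥ b *ᵥ y ∈ member U) (σ≡Frob a) (component-scaling a x∈ y∈ xy∈)) (graph-combination c xs∈ ys∈ xys∈))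

  U-graph : ∀ c → combination c ts +ᵥ combination (map (Frob k) c) ys ∈ member U
  U-graph c = graph-combination c B₁.inside ys∈ (proj₂ (proj₂ (partners B₁.inside)))

  -- A relation d among the partners, pulled back through `Frob (t ∸ k)` to c, makes the combination
  -- c of `ts` a vector of U ∩ T₁ = 0.
  ys-independent : Independent ys
  ys-independent d e = trans (sym d≡) (trans (cong (map (Frob k)) (B₁.independent c c≡0)) (Frob-0s n))
    where
    c = map (Frob (t ∸ k)) d
    invert : ∀ {d} (v : Vec Carrier d) → map (Frob k) (map (Frob (t ∸ k)) v) ≡ v
    invert []      = refl
    invert (x ∷ v) = cong₂ _∷_ (Frob-inverse′ k (ℕₚ.<⇒≤ k<t) x) (invert v)
    d≡ : map (Frob k) c ≡ d
    d≡ = invert d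
    Frob-0s : ∀ n → map (Frob k) (replicate n 0#) ≡ replicate n 0#
    Frob-0s zero    = refl
    Frob-0s (suc n) = cong₂ _∷_ (Frob-zero k) (Frob-0s n)
    c≡0 : combination c ts ≡ 0ᵥ
    c≡0 = Tr₁.T∩U (combination-∈ Tr₁.T-closed c B₁.inside) (subst (_∈ member U)
      (trans (cong (combination c ts +ᵥ_) (trans (cong (λ v → combination v ys) d≡) e)) (+ᵥ-identityʳ _)) (U-graph c))

  sum-≡0 : ∀ {x y} → x ∈ Flat.member T₁ → y ∈ Flat.member T₂ → x +ᵥ y ≡ 0ᵥ → x ≡ 0ᵥ × y ≡ 0ᵥ
  sum-≡0 {x} {y} x∈ y∈ e = x≡0 , trans (sym (+ᵥ-identityˡ y)) (trans (cong (_+ᵥ y) (sym x≡0)) e)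
    where
    x≡0 : x ≡ 0ᵥ
    x≡0 = T₁∩T₂ x∈ (subst (_∈ Flat.member T₂) (sym (trans (sym (+ᵥ-cancelʳ x y)) (cong (_-ᵥ y) e)))
      (closed-- Tr₂.T-closed (proj₁ Tr₂.T-closed) y∈))

  -- The graph vector over the same c differs from the given one by an element of T₂ ∩ U = 0.
  graph-U : ∀ c d → combination c ts +ᵥ combination d ys ∈ member U → d ≡ map (Frob k) c
  graph-U c d v∈ = combination-inj ys-independent (-ᵥ≡0⇒ (Tr₂.T∩U
    (closed-- Tr₂.T-closed (combination-∈ Tr₂.T-closed d ys∈) (combination-∈ Tr₂.T-closed (map (Frob k) c) ys∈))
    (subst (_∈ member U) (-ᵥ-cancelˡ (combination c ts) _ _) (U-minus v∈ (U-graph c)))))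

  -- The two frames are parameters so that both readings of U are instances: from T₁ to T₂ with
  -- exponent k, and from T₂ to T₁ with exponent t - k.
  module Equivalence′ (G : Generator) (b b′ : Vec 𝕍 n)
    (indep : ∀ c d → combination c b +ᵥ combination d b′ ≡ 0ᵥ → c ≡ 0ᵥ × d ≡ 0ᵥ)
    (on-graph : ∀ c → combination c b +ᵥ combination (map (Generator.σ G) c) b′ ∈ member U)
    (only-graph : ∀ c d → combination c b +ᵥ combination d b′ ∈ member U → d ≡ map (Generator.σ G) c) where

    module Std = Standard n 2≤n G

    frame-indep : Independent (frame b b′)
    frame-indep v e = go (⊞-split v)
      where
      go : ∃[ c ] ∃[ d ] v ≡ c ⊞ d → v ≡ 0ᶜ
      go (c , d , refl) = let (p , r) = indep c d (trans (sym (combination-frame c d b b′)) e)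
        in trans (cong₂ _⊞_ p r) ⊞-0

    module Φ = Linear (frame b b′) frame-indep

    Φ-graph : ∀ c → Φ.f (Std.graph c) ∈ member U
    Φ-graph c = subst (_∈ member U) (sym (combination-frame c _ b b′)) (on-graph c)

    Φ⁻¹-graph : ∀ {u} → u ∈ member U → ∃[ c ] Φ.f⁻¹ u ≡ Std.graph c
    Φ⁻¹-graph {u} u∈ = go (⊞-split (Φ.f⁻¹ u))
      where
      go : ∃[ c ] ∃[ d ] Φ.f⁻¹ u ≡ c ⊞ d → ∃[ c ] Φ.f⁻¹ u ≡ Std.graph c
      go (c , d , e) = c , trans e (cong (c ⊞_) (only-graph c d (subst (_∈ member U)
        (trans (sym (Φ.ff⁻¹ u)) (trans (cong Φ.f e) (combination-frame c d b b′))) u∈)))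

    equivalence : L ≅ Std.L
    equivalence = Φ.collineation⁻¹ , λ p → mk⇔ (λ p∈ → forward p (proj₁ L≐L[U] p∈)) (λ p∈ → proj₂ L≐L[U] (backward p (Std.L-elim {Φ.preimage p} p∈)))
      where
      forward : ∀ p → p ∈ L[ U ] → Φ.preimage p ∈ Std.L
      forward p (u , u∈ , u≈p) = go (≈⇒ {p = u} {p} u≈p) (Φ⁻¹-graph u∈)
        where
        go : ∃[ a ] vec u ≡ a *ᵥ vec p → ∃[ c ] Φ.f⁻¹ (vec u) ≡ Std.graph c → Φ.preimage p ∈ Std.L
        go (a , e) (c , e′) = Std.L-intro {Φ.preimage p} c (inv a a≢0)
          (trans (cong Φ.f⁻¹ (*ᵥ-inv a≢0 e)) (trans (Φ.f⁻¹-* (inv a a≢0) (vec u)) (cong (inv a a≢0 *ᵥ_) e′)))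
          where a≢0 = scalar≢0 (vec≢0ᵥ u) e
      backward : ∀ p → ∃[ x ] ∃[ a ] x ≢ 0ᵥ × a ≢ 0# × Φ.f⁻¹ (vec p) ≡ a *ᵥ Std.graph x → p ∈ L[ U ]
      backward p (x , a , x≢0 , a≢0 , e) = asPoint v≢0 , Φ-graph x ,
          Setoid.sym pointSetoid {p} {asPoint v≢0} (⇒≈ {p = p} {asPoint v≢0} a
            (trans (sym (Φ.ff⁻¹ (vec p))) (trans (cong Φ.f e) (Φ.f-* a (Std.graph x)))))
        where
        v≢0 : Φ.f (Std.graph x) ≢ 0ᵥ
        v≢0 z = x≢0 (Std.graph-inj (trans (Φ.f-inj (trans z (sym Φ.f-0))) (sym Std.graph-0)))

  indep-frame : ∀ c d → combination c ts +ᵥ combination d ys ≡ 0ᵥ → c ≡ 0ᵥ × d ≡ 0ᵥ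
  indep-frame c d e = let (p , r) = sum-≡0 (combination-∈ Tr₁.T-closed c B₁.inside) (combination-∈ Tr₂.T-closed d ys∈) e
    in B₁.independent c p , ys-independent d r

  classification : ∀ k′ (le : k′ ≤ t) (cop : Coprime k′ t) → k′ ≡ k → L ≅ Standard.L n 2≤n (frobenius k′ le cop)
  classification k′ le cop refl = Equivalence′.equivalence (frobenius k′ le cop) ts ys indep-frame U-graph graph-U

  classification′ : ∀ k′ (le : k′ ≤ t) (cop : Coprime k′ t) → k′ ≡ t ∸ k → L ≅ Standard.L n 2≤n (frobenius k′ le cop)
  classification′ k′ le cop refl = Equivalence′.equivalence (frobenius k′ le cop) ys ts
    (λ c d e → let (p , r) = indep-frame d c (trans (+ᵥ-comm _ _) e) in r , p)
    (λ c → subst (_∈ member U) (trans (cong (λ v → combination (map (Frob (t ∸ k)) c) ts +ᵥ combination v ys) (there c)) (+ᵥ-comm _ _))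
             (U-graph (map (Frob (t ∸ k)) c)))
    (λ c d v∈ → trans (sym (back d)) (cong (map (Frob (t ∸ k))) (sym (graph-U d c (subst (_∈ member U) (+ᵥ-comm _ _) v∈)))))
    where
    there : ∀ {d} (v : Vec Carrier d) → map (Frob k) (map (Frob (t ∸ k)) v) ≡ v
    there []      = refl
    there (x ∷ v) = cong₂ _∷_ (Frob-inverse′ k (ℕₚ.<⇒≤ k<t) x) (there v)
    back : ∀ {d} (v : Vec Carrier d) → map (Frob (t ∸ k)) (map (Frob k) v) ≡ v
    back []      = refl
    back (x ∷ v) = cong₂ _∷_ (Frob-inverse k (ℕₚ.<⇒≤ k<t) x) (back v)

-- Collineations in coordinates and von Staudt's products

module CollineationMaps {r : ℕ} (K : FiniteField r) (N : ℕ) (f : Projective.Collineation K N) where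
  open Field K
  open VectorLaws K
  open OverK K
  open Projective K N hiding (V; 0ᵥ; _+ᵥ_; _*ᵥ_)
  open Point
  open Collineation f
  open Inverse bijection using (from; to-cong; from-cong; strictlyInverseˡ; strictlyInverseʳ)
  open ≡-Reasoning
  private
    module ≈ = Setoid pointSetoid
    𝕍 : Set
    𝕍 = V {N}

  -- w spans the image of ⟨ v ⟩.
  Maps : 𝕍 → 𝕍 → Set
  Maps v w = w ≢ 0ᵥ × Σ[ v≢0 ∈ v ≢ 0ᵥ ] ∃[ ρ ] w ≡ ρ *ᵥ vec (to (point v v≢0))

  maps-source≢0 : ∀ {v w} → Maps v w → v ≢ 0ᵥ
  maps-source≢0 (_ , v≢0 , _) = v≢0

  maps-≈ : ∀ {v w} ((w≢0 , v≢0 , _) : Maps v w) → point w w≢0 ≈ₚ to (point v v≢0)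
  maps-≈ {v} {w} (w≢0 , v≢0 , ρ , e) = ⇒≈ {p = point w w≢0} {to (point v v≢0)} ρ e

  maps-intro : ∀ {v} (v≢0 : v ≢ 0ᵥ) → Maps v (vec (to (point v v≢0)))
  maps-intro v≢0 = vec≢0ᵥ (to (point _ v≢0)) , v≢0 , 1# , sym (*ᵥ-identity _)

  maps-scale : ∀ {v w a} → a ≢ 0# → Maps v w → Maps v (a *ᵥ w)
  maps-scale {a = a} a≢0 (w≢0 , v≢0 , ρ , e) = *ᵥ-nonzero a≢0 w≢0 , v≢0 , a * ρ , trans (cong (a *ᵥ_) e) (sym (*ᵥ-assoc a ρ _))

  abstract
    maps-unique : ∀ {u v w w′} → Maps u w → Maps v w′ → ∃[ a ] u ≡ a *ᵥ v → ∃[ ρ ] w ≡ ρ *ᵥ w′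
    maps-unique {u} {v} {w} {w′} m@(w≢0 , u≢0 , _) m′@(w′≢0 , v≢0 , _) (a , e) = ≈⇒ {p = point w w≢0} {point w′ w′≢0}
      (≈.trans {point w w≢0} {to (point u u≢0)} {point w′ w′≢0} (maps-≈ m)
        (≈.trans {to (point u u≢0)} {to (point v v≢0)} {point w′ w′≢0}
          (to-cong {point u u≢0} {point v v≢0} (⇒≈ {p = point u u≢0} {point v v≢0} a e))
          (≈.sym {point w′ w′≢0} {to (point v v≢0)} (maps-≈ m′))))

  abstract
    maps-injective : ∀ {u v w w′} → Maps u w → Maps v w′ → ∃[ ρ ] w ≡ ρ *ᵥ w′ → ∃[ a ] u ≡ a *ᵥ v
    maps-injective {u} {v} {w} {w′} m@(w≢0 , u≢0 , _) m′@(w′≢0 , v≢0 , _) (ρ , e) = ≈⇒ {p = p} {p′}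
      (≈.trans {p} {from (to p)} {p′} (≈.sym {from (to p)} {p} (strictlyInverseʳ p))
        (≈.trans {from (to p)} {from (to p′)} {p′} (from-cong {to p} {to p′}
          (≈.trans {to p} {point w w≢0} {to p′} (≈.sym {point w w≢0} {to p} (maps-≈ m))
            (≈.trans {point w w≢0} {point w′ w′≢0} {to p′} (⇒≈ {p = point w w≢0} {point w′ w′≢0} ρ e) (maps-≈ m′))))
          (strictlyInverseʳ p′)))
      where
      p : Point
      p = point u u≢0
      p′ : Point
      p′ = point v v≢0

  abstract
    maps-surjective : ∀ {w} → w ≢ 0ᵥ → ∃[ v ] Maps v w
    maps-surjective {w} w≢0 = vec p , w≢0 , vec≢0ᵥ p ,
        ≈⇒ {p = point w w≢0} {to (point (vec p) (vec≢0ᵥ p))} (≈.sym {to p} {point w w≢0} (strictlyInverseˡ (point w w≢0)))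
      where
      p : Point
      p = from (point w w≢0)

  maps-indep : ∀ {u v u′ v′} → Maps u u′ → Maps v v′ → Indep₂ u v → Indep₂ u′ v′
  maps-indep mu mv ind = indep₂-intro (proj₁ mu) (λ a e → let (b , e′) = maps-injective mv mu (a , e) in indep₂-≢ ind b e′)

  private
    rescale₂ : ∀ {M} {u v w : V {M}} {a b ρ σ : Carrier} → w ≡ a *ᵥ ρ *ᵥ u +ᵥ b *ᵥ σ *ᵥ v → ∃[ α ] ∃[ β ] w ≡ α *ᵥ u +ᵥ β *ᵥ v
    rescale₂ {a = a} {b} {ρ} {σ} e = a * ρ , b * σ , trans e (sym (cong₂ _+ᵥ_ (*ᵥ-assoc a ρ _) (*ᵥ-assoc b σ _)))

    collinear-cong : ∀ {a b c c′} → c ≈ₚ c′ → Collinear a b c → Collinear a b c′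
    collinear-cong {a} {b} {c} {c′} c≈ (ℓ , a∈ , b∈ , c∈) = ℓ , a∈ , b∈ ,
      let (x , e) = ≈⇒ {p = c′} {c} (≈.sym {c} {c′} c≈) in subst (_∈ Flat.member ℓ) (sym e) (proj₂ (proj₂ (flat-closed ℓ)) x c∈)

  abstract
    maps-line : ∀ {u v w u′ v′ w′} → Maps u u′ → Maps v v′ → Maps w w′ → Indep₂ u v →
                ∃[ α ] ∃[ β ] w ≡ α *ᵥ u +ᵥ β *ᵥ v → ∃[ α ] ∃[ β ] w′ ≡ α *ᵥ u′ +ᵥ β *ᵥ v′
    maps-line {u} {v} {w} {u′} {v′} {w′} mu@(u′≢0 , u≢0 , ρ , eu) mv@(v′≢0 , v≢0 , ρ′ , ev) (w′≢0 , w≢0 , ρ″ , ew) ind (α , β , e) =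
      result (collinear-elim {a = to p₁} {to p₂} {to p₃} ind′
        (Equivalence.to (collinear p₁ p₂ p₃) (collinear-intro {a = p₁} {p₂} {p₃} ind α β e)))
      where
      p₁ p₂ p₃ : Point
      p₁ = point u u≢0
      p₂ = point v v≢0
      p₃ = point w w≢0
      ind′ : Indep₂ (vec (to p₁)) (vec (to p₂))
      ind′ = maps-indep (maps-intro u≢0) (maps-intro v≢0) ind
      ρ≢0 : ρ ≢ 0#
      ρ≢0 = scalar≢0 u′≢0 eu
      ρ′≢0 : ρ′ ≢ 0#
      ρ′≢0 = scalar≢0 v′≢0 ev
      result : ∃[ α ] ∃[ β ] vec (to p₃) ≡ α *ᵥ vec (to p₁) +ᵥ β *ᵥ vec (to p₂) → ∃[ α ] ∃[ β ] w′ ≡ α *ᵥ u′ +ᵥ β *ᵥ v′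
      result (α′ , β′ , e′) = rescale₂ {a = ρ″ * α′} {ρ″ * β′} {inv ρ ρ≢0} {inv ρ′ ρ′≢0} (begin
        w′                                                  ≡⟨ ew ⟩
        ρ″ *ᵥ vec (to p₃)                                   ≡⟨ cong (ρ″ *ᵥ_) e′ ⟩
        ρ″ *ᵥ (α′ *ᵥ vec (to p₁) +ᵥ β′ *ᵥ vec (to p₂))      ≡⟨ *ᵥ-distrib-+ᵥ ρ″ _ _ ⟩
        ρ″ *ᵥ α′ *ᵥ vec (to p₁) +ᵥ ρ″ *ᵥ β′ *ᵥ vec (to p₂)  ≡⟨ cong₂ _+ᵥ_ (*ᵥ-assoc ρ″ α′ _) (*ᵥ-assoc ρ″ β′ _) ⟨
        (ρ″ * α′) *ᵥ vec (to p₁) +ᵥ (ρ″ * β′) *ᵥ vec (to p₂)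
          ≡⟨ cong₂ (λ x y → (ρ″ * α′) *ᵥ x +ᵥ (ρ″ * β′) *ᵥ y) (*ᵥ-inv ρ≢0 eu) (*ᵥ-inv ρ′≢0 ev) ⟩
        (ρ″ * α′) *ᵥ inv ρ ρ≢0 *ᵥ u′ +ᵥ (ρ″ * β′) *ᵥ inv ρ′ ρ′≢0 *ᵥ v′ ∎)

  abstract
    maps-line⁻¹ : ∀ {u v w u′ v′ w′} → Maps u u′ → Maps v v′ → Maps w w′ → Indep₂ u v →
                  ∃[ α ] ∃[ β ] w′ ≡ α *ᵥ u′ +ᵥ β *ᵥ v′ → ∃[ α ] ∃[ β ] w ≡ α *ᵥ u +ᵥ β *ᵥ v
    maps-line⁻¹ {u} {v} {w} {u′} {v′} {w′} mu@(u′≢0 , u≢0 , ρ , eu) mv@(v′≢0 , v≢0 , ρ′ , ev) mw@(w′≢0 , w≢0 , ρ″ , ew) ind (α , β , e) =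
      collinear-elim {a = p₁} {p₂} {p₃} ind (Equivalence.from (collinear p₁ p₂ p₃)
        (collinear-cong {to p₁} {to p₂} {point w′ w′≢0} {to p₃} (maps-≈ mw)
          (collinear-intro {a = to p₁} {to p₂} {point w′ w′≢0} (maps-indep (maps-intro u≢0) (maps-intro v≢0) ind) (α * ρ) (β * ρ′)
            (trans e (cong₂ _+ᵥ_ (trans (cong (α *ᵥ_) eu) (sym (*ᵥ-assoc α ρ _))) (trans (cong (β *ᵥ_) ev) (sym (*ᵥ-assoc β ρ′ _))))))))
      where
      p₁ p₂ p₃ : Point
      p₁ = point u u≢0
      p₂ = point v v≢0
      p₃ = point w w≢0


  +c≢0 : ∀ {u v : 𝕍} c → Indep₂ u v → u +ᵥ c *ᵥ v ≢ 0ᵥ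
  +c≢0 {u} {v} c ind e = 1≢0 (proj₁ (ind 1# c (trans (cong (_+ᵥ c *ᵥ v) (*ᵥ-identity u)) e)))

  -- θ is normalised by the choice of B′.
  record Scale (A A′ B : 𝕍) : Set where
    field
      B′     : 𝕍
      maps-B : Maps B B′
      θ      : Carrier → Carrier
      maps-θ : ∀ c → Maps (A +ᵥ c *ᵥ B) (A′ +ᵥ θ c *ᵥ B′)
      θ-1    : θ 1# ≡ 1#
      θ-≢0   : ∀ {c} → c ≢ 0# → θ c ≢ 0#
      θ-inj  : Inj θ

  record RawScale (A A′ B : 𝕍) : Set where
    field
      B₀      : 𝕍
      mB      : Maps B B₀
      θ₀      : Carrier → Carrier
      maps-θ₀ : ∀ c → Maps (A +ᵥ c *ᵥ B) (A′ +ᵥ θ₀ c *ᵥ B₀)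

  -- The image of ⟨A + c B⟩ lies on the line A′B₀ and is not ⟨B₀⟩, because ⟨A + c B⟩ is not ⟨B⟩. Its
  -- A′-coefficient is therefore nonzero and can be scaled to 1; the other coefficient is then θ₀ c.
  rawScale : ∀ {A A′ B} → Maps A A′ → Indep₂ A B → RawScale A A′ B
  rawScale {A} {A′} {B} mA ind = record { B₀ = B₀ ; mB = mB ; θ₀ = θ₀ ; maps-θ₀ = maps-θ₀ }
    where
    B₀ : 𝕍
    B₀ = vec (to (point B (indep₂-≢0ˡ (indep₂-sym ind))))
    mB : Maps B B₀
    mB = maps-intro (indep₂-≢0ˡ (indep₂-sym ind))
    ind₀ : Indep₂ A′ B₀
    ind₀ = maps-indep mA mB ind
    image : Carrier → 𝕍
    image c = vec (to (point (A +ᵥ c *ᵥ B) (+c≢0 c ind)))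
    m-image : ∀ c → Maps (A +ᵥ c *ᵥ B) (image c)
    m-image c = maps-intro (+c≢0 c ind)
    expand : ∀ c → ∃[ α ] ∃[ β ] image c ≡ α *ᵥ A′ +ᵥ β *ᵥ B₀
    expand c = maps-line mA mB (m-image c) ind (1# , c , cong (_+ᵥ c *ᵥ B) (sym (*ᵥ-identity A)))
    α β : Carrier → Carrier
    α c = proj₁ (expand c)
    β c = proj₁ (proj₂ (expand c))
    α≢0 : ∀ c → α c ≢ 0#
    α≢0 c e = 1≢0 (proj₁ (indep₂-inj ind (begin
        1# *ᵥ A +ᵥ c *ᵥ B    ≡⟨ cong (_+ᵥ c *ᵥ B) (*ᵥ-identity A) ⟩
        A +ᵥ c *ᵥ B          ≡⟨ proj₂ on-B ⟩
        proj₁ on-B *ᵥ B      ≡⟨ +ᵥ-identityˡ _ ⟨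
        0ᵥ +ᵥ proj₁ on-B *ᵥ B ≡⟨ cong (_+ᵥ proj₁ on-B *ᵥ B) (*ᵥ-zeroˡ A) ⟨
        0# *ᵥ A +ᵥ proj₁ on-B *ᵥ B ∎)))
      where
      on-B : ∃[ a ] A +ᵥ c *ᵥ B ≡ a *ᵥ B
      on-B = maps-injective (m-image c) mB (β c , trans (proj₂ (proj₂ (expand c)))
        (trans (cong (λ z → z *ᵥ A′ +ᵥ β c *ᵥ B₀) e) (trans (cong (_+ᵥ β c *ᵥ B₀) (*ᵥ-zeroˡ A′)) (+ᵥ-identityˡ _))))
    θ₀ : Carrier → Carrier
    θ₀ c = inv (α c) (α≢0 c) * β c
    maps-θ₀ : ∀ c → Maps (A +ᵥ c *ᵥ B) (A′ +ᵥ θ₀ c *ᵥ B₀)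
    maps-θ₀ c = subst (Maps (A +ᵥ c *ᵥ B)) (begin
        i *ᵥ image c                      ≡⟨ cong (i *ᵥ_) (proj₂ (proj₂ (expand c))) ⟩
        i *ᵥ (α c *ᵥ A′ +ᵥ β c *ᵥ B₀)     ≡⟨ *ᵥ-distrib-+ᵥ i _ _ ⟩
        i *ᵥ α c *ᵥ A′ +ᵥ i *ᵥ β c *ᵥ B₀  ≡⟨ cong₂ _+ᵥ_ (sym (*ᵥ-inv (α≢0 c) refl)) (sym (*ᵥ-assoc i (β c) B₀)) ⟩
        A′ +ᵥ θ₀ c *ᵥ B₀ ∎) (maps-scale (inv≢0 (α c) (α≢0 c)) (m-image c))
      where i = inv (α c) (α≢0 c)

  module Normalise {A A′ B : 𝕍} (mA : Maps A A′) (ind : Indep₂ A B) (raw : RawScale A A′ B) where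
    open RawScale raw
    ind₀ : Indep₂ A′ B₀
    ind₀ = maps-indep mA mB ind
    ratio-unique : ∀ {x y ρ : Carrier} {u v : 𝕍} → Indep₂ u v → u +ᵥ x *ᵥ v ≡ ρ *ᵥ (u +ᵥ y *ᵥ v) → x ≡ y
    ratio-unique {x} {y} {ρ} {u} {v} ind e = trans (proj₂ both) (trans (cong (_* y) (sym (proj₁ both))) (*-identityˡ y))
      where
      both : 1# ≡ ρ × x ≡ ρ * y
      both = indep₂-inj ind (trans (cong (_+ᵥ x *ᵥ v) (*ᵥ-identity u)) (trans e (trans (*ᵥ-distrib-+ᵥ ρ _ _) (cong (ρ *ᵥ u +ᵥ_) (sym (*ᵥ-assoc ρ y v))))))
    θ₀-inj : Inj θ₀
    θ₀-inj {c} {d} e = ratio-unique ind (proj₂ (maps-injective (maps-θ₀ c) (maps-θ₀ d)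
      (1# , trans (cong (λ z → A′ +ᵥ z *ᵥ B₀) e) (sym (*ᵥ-identity _)))))
    θ₀-0 : θ₀ 0# ≡ 0#
    θ₀-0 = ratio-unique ind₀ (trans (proj₂ on-A) (cong (proj₁ on-A *ᵥ_) (sym (trans (cong (A′ +ᵥ_) (*ᵥ-zeroˡ B₀)) (+ᵥ-identityʳ A′)))))
      where
      on-A : ∃[ ρ ] A′ +ᵥ θ₀ 0# *ᵥ B₀ ≡ ρ *ᵥ A′
      on-A = maps-unique (maps-θ₀ 0#) mA (1# , trans (cong (A +ᵥ_) (*ᵥ-zeroˡ B)) (trans (+ᵥ-identityʳ A) (sym (*ᵥ-identity A))))
    τ : Carrier
    τ = θ₀ 1#
    τ≢0 : τ ≢ 0#
    τ≢0 e = 1≢0 (θ₀-inj (trans e (sym θ₀-0)))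
    B′ : 𝕍
    B′ = τ *ᵥ B₀
    mB′ : Maps B B′
    mB′ = maps-scale τ≢0 mB
    i : Carrier
    i = inv τ τ≢0
    θ : Carrier → Carrier
    θ c = θ₀ c * i
    maps-θ : ∀ c → Maps (A +ᵥ c *ᵥ B) (A′ +ᵥ θ c *ᵥ B′)
    maps-θ c = subst (λ z → Maps (A +ᵥ c *ᵥ B) (A′ +ᵥ z)) (trans (cong (_*ᵥ B₀) (begin
        θ₀ c                  ≡⟨ *-identityʳ _ ⟨
        θ₀ c * 1#             ≡⟨ cong (θ₀ c *_) (trans (*-comm i τ) (inv-r τ τ≢0)) ⟨
        θ₀ c * (i * τ)        ≡⟨ *-assoc _ _ _ ⟨
        θ₀ c * i * τ ∎)) (*ᵥ-assoc (θ c) τ B₀)) (maps-θ₀ c)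
    θ-1 : θ 1# ≡ 1#
    θ-1 = inv-r τ τ≢0
    θ-inj : Inj θ
    θ-inj e = θ₀-inj (*-cancelʳ (inv≢0 τ τ≢0) e)
    θ-≢0 : ∀ {c} → c ≢ 0# → θ c ≢ 0#
    θ-≢0 c≢0 e = c≢0 (θ₀-inj (trans (*-zero⇒ (trans (*-comm i _) e) (inv≢0 τ τ≢0)) (sym θ₀-0)))

  scale : ∀ {A A′ B} → Maps A A′ → Indep₂ A B → Scale A A′ B
  scale mA ind = record { B′ = B′ ; maps-B = mB′ ; θ = θ ; maps-θ = maps-θ ; θ-1 = θ-1 ; θ-≢0 = θ-≢0 ; θ-inj = θ-inj }
    where open Normalise mA ind (rawScale mA ind)

  -- Von Staudt's construction of products: ⟨B − cC⟩ lies on the lines joining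
  -- ⟨A + dB⟩ and ⟨A + dcC⟩ for all d.
  module Product {A A′ B C : 𝕍} (mA : Maps A A′) (A-B : Indep₂ A B) (A-C : Indep₂ A C) (B-C : Indep₂ B C)
                 (C∉AB : ¬ (∃[ α ] ∃[ β ] C ≡ α *ᵥ A +ᵥ β *ᵥ B)) (sB : Scale A A′ B) (sC : Scale A A′ C) where
    open Scale sB using (B′) renaming (maps-B to mB; θ to θB; maps-θ to maps-θB; θ-1 to θB-1)
    open Scale sC using () renaming (B′ to C′; maps-B to mC; θ to θC; maps-θ to maps-θC; θ-1 to θC-1)

    private
      ind₃ : Independent (C′ ∷ A′ ∷ B′ ∷ [])
      ind₃ = independent-∷ (indep₂⇒ (maps-indep mA mB A-B))
        (λ sp → C∉AB (maps-line⁻¹ mA mB mC A-B (span₂ {u = A′} {B′} sp)))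

      combination₃ : ∀ {M} a b c (u v w : V {M}) → combination (c ∷ a ∷ b ∷ []) (w ∷ u ∷ v ∷ []) ≡ a *ᵥ u +ᵥ b *ᵥ v +ᵥ c *ᵥ w
      combination₃ a b c []      []      []      = refl
      combination₃ a b c (x ∷ u) (y ∷ v) (z ∷ w) = cong₂ _∷_
        (solve 6 (λ a b c x y z → c :* z :+ (a :* x :+ (b :* y :+ :0)) := a :* x :+ b :* y :+ c :* z) refl a b c x y z)
        (combination₃ a b c u v w)

      compare : ∀ {a b c a′ b′ c′} → a *ᵥ A′ +ᵥ b *ᵥ B′ +ᵥ c *ᵥ C′ ≡ a′ *ᵥ A′ +ᵥ b′ *ᵥ B′ +ᵥ c′ *ᵥ C′ → a ≡ a′ × b ≡ b′ × c ≡ c′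
      compare {a} {b} {c} {a′} {b′} {c′} e =
        let eq = combination-inj ind₃ {c ∷ a ∷ b ∷ []} {c′ ∷ a′ ∷ b′ ∷ []}
                   (trans (combination₃ a b c A′ B′ C′) (trans e (sym (combination₃ a′ b′ c′ A′ B′ C′))))
        in ∷-injectiveˡ (∷-injectiveʳ eq) , ∷-injectiveˡ (∷-injectiveʳ (∷-injectiveʳ eq)) , ∷-injectiveˡ eq

      through-A : ∀ {M} d c (u v w : V {M}) → d *ᵥ (v +ᵥ (- c) *ᵥ w) ≡ 1# *ᵥ (u +ᵥ d *ᵥ v) +ᵥ (- 1#) *ᵥ (u +ᵥ (d * c) *ᵥ w)
      through-A d c []      []      []      = refl
      through-A d c (x ∷ u) (y ∷ v) (z ∷ w) = cong₂ _∷_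
        (solve 5 (λ d c x y z → d :* (y :+ (:- c) :* z) := :1 :* (x :+ d :* y) :+ (:- :1) :* (x :+ d :* c :* z)) refl d c x y z)
        (through-A d c u v w)

      collect : ∀ {M} λ₁ μ β γ (u v w : V {M}) → λ₁ *ᵥ (u +ᵥ β *ᵥ v) +ᵥ μ *ᵥ (u +ᵥ γ *ᵥ w) ≡ (λ₁ + μ) *ᵥ u +ᵥ (λ₁ * β) *ᵥ v +ᵥ (μ * γ) *ᵥ w
      collect λ₁ μ β γ []      []      []      = refl
      collect λ₁ μ β γ (x ∷ u) (y ∷ v) (z ∷ w) = cong₂ _∷_
        (solve 7 (λ l m b c x y z → l :* (x :+ b :* y) :+ m :* (x :+ c :* z) := (l :+ m) :* x :+ l :* b :* y :+ m :* c :* z) refl λ₁ μ β γ x y z)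
        (collect λ₁ μ β γ u v w)

      pad-A : ∀ {M} β γ (u v w : V {M}) → β *ᵥ v +ᵥ γ *ᵥ w ≡ 0# *ᵥ u +ᵥ β *ᵥ v +ᵥ γ *ᵥ w
      pad-A β γ u v w = cong (_+ᵥ γ *ᵥ w) (trans (sym (+ᵥ-identityˡ _)) (cong (_+ᵥ β *ᵥ v) (sym (*ᵥ-zeroˡ u))))

      shifted-indep : ∀ d c → d ≢ 0# → Indep₂ (A +ᵥ d *ᵥ B) (A +ᵥ (d * c) *ᵥ C)
      shifted-indep d c d≢0 = indep₂-sym (indep₂-intro (+c≢0 (d * c) A-C) λ a e → go a e)
        where
        B∉AC : ∀ α β → B ≢ α *ᵥ A +ᵥ β *ᵥ C
        B∉AC α β e with β ≟ 0#
        ... | yes β≡0 = indep₂-≢ A-B α (trans e (trans (cong (λ z → α *ᵥ A +ᵥ z *ᵥ C) β≡0)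
                          (trans (cong (α *ᵥ A +ᵥ_) (*ᵥ-zeroˡ C)) (+ᵥ-identityʳ _))))
        ... | no β≢0 = C∉AB (inv β β≢0 * - α , inv β β≢0 * 1# , trans (*ᵥ-inv β≢0 {u = (- α) *ᵥ A +ᵥ 1# *ᵥ B} (trans (cong (λ z → (- α) *ᵥ A +ᵥ 1# *ᵥ z) e) (lem α β A C)))
                          (trans (*ᵥ-distrib-+ᵥ _ _ _) (sym (cong₂ _+ᵥ_ (*ᵥ-assoc (inv β β≢0) (- α) A) (*ᵥ-assoc (inv β β≢0) 1# B)))))
          where
          lem : ∀ {M} α β (u w : V {M}) → (- α) *ᵥ u +ᵥ 1# *ᵥ (α *ᵥ u +ᵥ β *ᵥ w) ≡ β *ᵥ w
          lem α β []      []      = refl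
          lem α β (x ∷ u) (z ∷ w) = cong₂ _∷_ (solve 4 (λ α β x z → (:- α) :* x :+ :1 :* (α :* x :+ β :* z) := β :* z) refl α β x z) (lem α β u w)
        go : ∀ a → A +ᵥ d *ᵥ B ≢ a *ᵥ (A +ᵥ (d * c) *ᵥ C)
        go a e = B∉AC (i * (a - 1#)) (i * (a * (d * c))) (trans (*ᵥ-inv d≢0 {u = (- 1#) *ᵥ A +ᵥ (A +ᵥ d *ᵥ B)} (lem₁ d A B))
            (trans (cong (λ z → i *ᵥ ((- 1#) *ᵥ A +ᵥ z)) e) (lem₂ i a (d * c) A C)))
          where
          i = inv d d≢0
          lem₁ : ∀ {M} d (u v : V {M}) → (- 1#) *ᵥ u +ᵥ (u +ᵥ d *ᵥ v) ≡ d *ᵥ v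
          lem₁ d []      []      = refl
          lem₁ d (x ∷ u) (y ∷ v) = cong₂ _∷_ (solve 3 (λ d x y → (:- :1) :* x :+ (x :+ d :* y) := d :* y) refl d x y) (lem₁ d u v)
          lem₂ : ∀ {M} i a b (u w : V {M}) → i *ᵥ ((- 1#) *ᵥ u +ᵥ a *ᵥ (u +ᵥ b *ᵥ w)) ≡ (i * (a - 1#)) *ᵥ u +ᵥ (i * (a * b)) *ᵥ w
          lem₂ i a b []      []      = refl
          lem₂ i a b (x ∷ u) (z ∷ w) = cong₂ _∷_
            (solve 5 (λ i a b x z → i :* ((:- :1) :* x :+ a :* (x :+ b :* z)) := i :* (a :- :1) :* x :+ i :* (a :* b) :* z) refl i a b x z) (lem₂ i a b u w)

      on-line : ∀ d c {w} → d ≢ 0# → Maps (B +ᵥ (- c) *ᵥ C) w → ∃[ l ] ∃[ μ ] w ≡ (l + μ) *ᵥ A′ +ᵥ (l * θB d) *ᵥ B′ +ᵥ (μ * θC (d * c)) *ᵥ C′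
      on-line d c {w} d≢0 m = result (maps-line (maps-θB d) (maps-θC (d * c)) m (shifted-indep d c d≢0)
          (i * 1# , i * - 1# , trans (*ᵥ-inv d≢0 refl) (trans (cong (i *ᵥ_) (through-A d c A B C)) (trans (*ᵥ-distrib-+ᵥ i _ _)
            (sym (cong₂ _+ᵥ_ (*ᵥ-assoc i 1# _) (*ᵥ-assoc i (- 1#) _)))))))
        where
        i = inv d d≢0
        result : ∃[ l ] ∃[ μ ] w ≡ l *ᵥ (A′ +ᵥ θB d *ᵥ B′) +ᵥ μ *ᵥ (A′ +ᵥ θC (d * c) *ᵥ C′) →
                 ∃[ l ] ∃[ μ ] w ≡ (l + μ) *ᵥ A′ +ᵥ (l * θB d) *ᵥ B′ +ᵥ (μ * θC (d * c)) *ᵥ C′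
        result (l , μ , e) = l , μ , trans e (collect l μ (θB d) (θC (d * c)) A′ B′ C′)

      +≡0 : ∀ {l μ} → l + μ ≡ 0# → μ ≡ - l
      +≡0 {l} {μ} e = trans (solve 2 (λ l μ → μ := l :+ μ :- l) refl l μ) (trans (cong (_- l) e) (+-identityˡ _))

    -- The construction with d = 1. The image also lies on the line B′C′, so its A′-coefficient
    -- vanishes, and θB 1 = 1 fixes the other two up to a common factor.
    difference : ∀ c → Maps (B +ᵥ (- c) *ᵥ C) (B′ +ᵥ (- θC c) *ᵥ C′)
    difference c = go (on-line 1# c 1≢0 m) (maps-line mB mC m B-C (1# , - c , cong (_+ᵥ (- c) *ᵥ C) (sym (*ᵥ-identity B))))
      where
      w : 𝕍
      w = vec (to (point (B +ᵥ (- c) *ᵥ C) (+c≢0 (- c) B-C)))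
      m : Maps (B +ᵥ (- c) *ᵥ C) w
      m = maps-intro (+c≢0 (- c) B-C)
      go : ∃[ l ] ∃[ μ ] w ≡ (l + μ) *ᵥ A′ +ᵥ (l * θB 1#) *ᵥ B′ +ᵥ (μ * θC (1# * c)) *ᵥ C′ → ∃[ β ] ∃[ γ ] w ≡ β *ᵥ B′ +ᵥ γ *ᵥ C′ →
           Maps (B +ᵥ (- c) *ᵥ C) (B′ +ᵥ (- θC c) *ᵥ C′)
      go (l , μ , e) (β , γ , e′) = subst (Maps (B +ᵥ (- c) *ᵥ C)) (sym (*ᵥ-inv l≢0 w≡)) (maps-scale (inv≢0 l l≢0) m)
        where
        eqs : l + μ ≡ 0# × l * θB 1# ≡ β × μ * θC (1# * c) ≡ γ
        eqs = compare (trans (sym e) (trans e′ (pad-A β γ A′ B′ C′)))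
        w≡ : w ≡ l *ᵥ (B′ +ᵥ (- θC c) *ᵥ C′)
        w≡ = begin
          w                                     ≡⟨ e′ ⟩
          β *ᵥ B′ +ᵥ γ *ᵥ C′
            ≡⟨ cong₂ (λ x y → x *ᵥ B′ +ᵥ y *ᵥ C′) (trans (sym (proj₁ (proj₂ eqs))) (trans (cong (l *_) θB-1) (*-identityʳ l)))
                 (trans (sym (proj₂ (proj₂ eqs))) (trans (cong₂ (λ x y → x * θC y) (+≡0 (proj₁ eqs)) (*-identityˡ c))
                   (solve 2 (λ l z → (:- l) :* z := l :* (:- z)) refl l (θC c)))) ⟩
          l *ᵥ B′ +ᵥ (l * - θC c) *ᵥ C′         ≡⟨ cong (l *ᵥ B′ +ᵥ_) (*ᵥ-assoc l _ C′) ⟩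
          l *ᵥ B′ +ᵥ l *ᵥ (- θC c) *ᵥ C′        ≡⟨ *ᵥ-distrib-+ᵥ l _ _ ⟨
          l *ᵥ (B′ +ᵥ (- θC c) *ᵥ C′)           ∎
        l≢0 : l ≢ 0#
        l≢0 = scalar≢0 (proj₁ m) w≡

    -- Now d varies while the image point, known from `difference`, stays fixed. Eliminating l and μ
    -- from the three coordinates leaves the product rule.
    product : ∀ d c → d ≢ 0# → θC (d * c) ≡ θB d * θC c
    product d c d≢0 = go (on-line d c d≢0 (difference c))
      where
      go : ∃[ l ] ∃[ μ ] B′ +ᵥ (- θC c) *ᵥ C′ ≡ (l + μ) *ᵥ A′ +ᵥ (l * θB d) *ᵥ B′ +ᵥ (μ * θC (d * c)) *ᵥ C′ → θC (d * c) ≡ θB d * θC c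
      go (l , μ , e) = *-cancelˡ l≢0 (begin
          l * θC (d * c)           ≡⟨ solve 2 (λ l z → l :* z := :- ((:- l) :* z)) refl l (θC (d * c)) ⟩
          - ((- l) * θC (d * c))   ≡⟨ cong (λ z → - (z * θC (d * c))) (+≡0 (sym (proj₁ eqs))) ⟨
          - (μ * θC (d * c))       ≡⟨ cong -_ (proj₂ (proj₂ eqs)) ⟨
          - (- θC c)               ≡⟨ solve 1 (λ z → :- (:- z) := :1 :* z) refl (θC c) ⟩
          1# * θC c                ≡⟨ cong (_* θC c) (proj₁ (proj₂ eqs)) ⟩
          l * θB d * θC c          ≡⟨ *-assoc _ _ _ ⟩
          l * (θB d * θC c)        ∎)
        where
        eqs : 0# ≡ l + μ × 1# ≡ l * θB d × - θC c ≡ μ * θC (d * c)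
        eqs = compare (trans (sym (trans (cong (_+ᵥ (- θC c) *ᵥ C′) (sym (*ᵥ-identity B′))) (pad-A 1# (- θC c) A′ B′ C′))) e)
        l≢0 : l ≢ 0#
        l≢0 z = 1≢0 (trans (proj₁ (proj₂ eqs)) (trans (cong (_* θB d) z) (zeroˡ _)))

    -- The case c = 1 of the product rule. Both scales being 1 at 1, they agree off zero, which
    -- turns the rule into multiplicativity of a single map.
    same-scale : ∀ d → d ≢ 0# → θC d ≡ θB d
    same-scale d d≢0 = trans (cong θC (sym (*-identityʳ d))) (trans (product d 1# d≢0) (trans (cong (θB d *_) θC-1) (*-identityʳ _)))

-- Collineations between standard sets map rulings to rulings

module Inequivalence {q t : ℕ} (E : FieldExtension q t) (3≤t : 3 ≤ t) (n : ℕ) (2≤n : 2 ≤ n) where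
  open Over E 3≤t
  open Doubled {n}
  open LinearSets E n hiding (V; 0ᵥ; _+ᵥ_; _*ᵥ_; HasDimF; L[_]; member)
  open Point
  open ≡-Reasoning

  𝕍 : Set
  𝕍 = V {2 ℕ.* n}

  -- q + 2 elements of K, pairwise not proportional over F.
  vec₃ : ∀ {t} → 3 ≤ t → F.Carrier → F.Carrier → F.Carrier → Vec F.Carrier t
  vec₃ (s≤s (s≤s (s≤s z≤n))) a b c = a ∷ b ∷ c ∷ replicate _ F.0#

  vec₃-ratio : ∀ {t} (le : 3 ≤ t) {a b c e a′ b′ c′} → vec₃ le a b c ≡ map (e F.*_) (vec₃ le a′ b′ c′) →
               a ≡ e F.* a′ × b ≡ e F.* b′ × c ≡ e F.* c′
  vec₃-ratio (s≤s (s≤s (s≤s z≤n))) eq = ∷-injectiveˡ eq , ∷-injectiveˡ (∷-injectiveʳ eq) , ∷-injectiveˡ (∷-injectiveʳ (∷-injectiveʳ eq))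

  -- In the power basis these are 1, g² and c + g for c ∈ F: the q + 1 points of the subline spanned
  -- by 1 and g over F, and one point off it.
  code : Maybe (Maybe F.Carrier) → Vec F.Carrier t
  code nothing         = vec₃ 3≤t F.1# F.0# F.0#
  code (just nothing)  = vec₃ 3≤t F.0# F.0# F.1#
  code (just (just c)) = vec₃ 3≤t c F.1# F.0#

  code-ratio : ∀ i j {e} → code i ≡ map (e F.*_) (code j) → i ≡ j
  code-ratio nothing nothing eq = refl
  code-ratio nothing (just nothing) {e} eq = contradiction (trans (proj₁ (vec₃-ratio 3≤t eq)) (F.zeroʳ e)) F.1≢0
  code-ratio nothing (just (just c)) {e} eq with p , r , _ ← vec₃-ratio 3≤t eq =
    contradiction (trans p (trans (cong (F._* c) (trans (sym (F.*-identityʳ e)) (sym r))) (F.zeroˡ c))) F.1≢0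
  code-ratio (just nothing) nothing {e} eq = contradiction (trans (proj₂ (proj₂ (vec₃-ratio 3≤t eq))) (F.zeroʳ e)) F.1≢0
  code-ratio (just nothing) (just nothing) eq = refl
  code-ratio (just nothing) (just (just c)) {e} eq = contradiction (trans (proj₂ (proj₂ (vec₃-ratio 3≤t eq))) (F.zeroʳ e)) F.1≢0
  code-ratio (just (just c)) nothing {e} eq = contradiction (trans (proj₁ (proj₂ (vec₃-ratio 3≤t eq))) (F.zeroʳ e)) F.1≢0
  code-ratio (just (just c)) (just nothing) {e} eq = contradiction (trans (proj₁ (proj₂ (vec₃-ratio 3≤t eq))) (F.zeroʳ e)) F.1≢0
  code-ratio (just (just c)) (just (just d)) {e} eq with p , r , _ ← vec₃-ratio 3≤t eq =
    cong (just ∘ just) (trans p (trans (cong (F._* d) (trans (sym (F.*-identityʳ e)) (sym r))) (F.*-identityˡ d)))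

  ev-* : ∀ {d} e (cs : Vec F.Carrier d) x → ev (map (e F.*_) cs) x ≡ ι e * ev cs x
  ev-* e []       x = sym (zeroʳ (ι e))
  ev-* e (c ∷ cs) x = trans (cong₂ (λ a b → a + x * b) (ι-* e c) (ev-* e cs x))
    (solve 4 (λ e c x v → e :* c :+ x :* (e :* v) := e :* (c :+ x :* v)) refl (ι e) (ι c) x (ev cs x))

  abstract
    element : Maybe (Maybe F.Carrier) → Carrier
    element i = ev (code i) g

    element-ratio : ∀ i j e → element i ≡ ι e * element j → i ≡ j
    element-ratio i j e eq = code-ratio i j (ev-g-inj (trans eq (sym (ev-* e (code j) g))))

  -- A zero element would be 0 times every other one, and `element-ratio` would identify all
  -- indices.
  element≢0 : ∀ i → element i ≢ 0#
  element≢0 i z = contradiction (trans (sym (all-equal nothing)) (all-equal (just nothing))) λ ()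
    where
    all-equal : ∀ j → i ≡ j
    all-equal j = element-ratio i j F.0# (trans z (sym (trans (cong (_* element j) ι-0) (zeroˡ _))))

  maybe↔ : ∀ {A : Set} {m} → A ↔ Fin m → Maybe A ↔ Fin (suc m)
  maybe↔ e = mk↔ₛ′ (λ { nothing → zero ; (just a) → suc (Inverse.to e a) })
    (λ { zero → nothing ; (suc i) → just (Inverse.from e i) })
    (λ { zero → refl ; (suc i) → cong suc (Inverse.strictlyInverseˡ e i) })
    (λ { nothing → refl ; (just a) → cong just (Inverse.strictlyInverseʳ e a) })

  no-injection : {h : Maybe (Maybe F.Carrier) → Maybe F.Carrier} → ¬ Inj h
  no-injection inj = ℕₚ.1+n≰n (inj⇒≤ (maybe↔ (maybe↔ F.enumeration)) (maybe↔ F.enumeration) inj)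

  module Rulings (G : Generator) where
    module S = Standard n 2≤n G
    open Semilinear G
    open S using (OnRuling; graph)

    ruling-span : ∀ {x u v w} → x ≢ 0ᵥ → Indep₂ u v → OnRuling x u → OnRuling x v → OnRuling x w → ∃[ α ] ∃[ β ] w ≡ α *ᵥ u +ᵥ β *ᵥ v
    ruling-span {x} {u} {v} {w} x≢0 ind u∈ v∈ w∈ = span₂ {u = u} {v} {w}
      (independent⇒spanning (flat-closed ℓ) (Flat.hasDim ℓ) (u ∷ v ∷ [])
        (S.ruling-intro x≢0 u∈ ∷ S.ruling-intro x≢0 v∈ ∷ []) (indep₂⇒ ind) (S.ruling-intro x≢0 w∈))
      where ℓ = S.ruling x≢0

    ruling-closed : ∀ {x u v} α β → OnRuling x u → OnRuling x v → OnRuling x (α *ᵥ u +ᵥ β *ᵥ v)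
    ruling-closed {x} {u} {v} α β (a , b , e) (c , d , e′) = α * a + β * c , α * b + β * d ,
        trans (cong₂ (λ u v → α *ᵥ u +ᵥ β *ᵥ v) e e′) (trans (⊞-lin α β (a *ᵥ x) (b *ᵥ σᵥ x) (c *ᵥ x) (d *ᵥ σᵥ x)) (cong₂ _⊞_ (lem a c x) (lem b d (σᵥ x))))
      where
      lem : ∀ {N} a c (x : V {N}) → α *ᵥ a *ᵥ x +ᵥ β *ᵥ c *ᵥ x ≡ (α * a + β * c) *ᵥ x
      lem a c []      = refl
      lem a c (x ∷ v) = cong₂ _∷_ (solve 5 (λ α β a c x → α :* (a :* x) :+ β :* (c :* x) := (α :* a :+ β :* c) :* x) refl α β a c x) (lem a c v)

    ruling-multiple : ∀ {x y a v} → x ≡ a *ᵥ y → OnRuling x v → OnRuling y v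
    ruling-multiple {x} {y} {a} refl (c , d , e) = c * a , d * σ a , trans e (cong₂ _⊞_ (sym (*ᵥ-assoc c a y))
      (trans (cong (d *ᵥ_) (σᵥ-* a y)) (sym (*ᵥ-assoc d (σ a) _))))

    graph-on-ruling : ∀ x a → OnRuling x (graph (a *ᵥ x))
    graph-on-ruling x a = a , σ a , cong (a *ᵥ x ⊞_) (σᵥ-* a x)

    σ-indep : ∀ {N} {u v : V {N}} → Indep₂ u v → Indep₂ (σᵥ u) (σᵥ v)
    σ-indep ind = indep₂-intro (σᵥ-≢0 (indep₂-≢0ˡ ind)) (λ a e → indep₂-≢ ind (σ⁻¹ a) (σᵥ-multiple e))

    -- A point of L on the line joining ⟨graph y⟩ and ⟨graph z⟩ lies on their F-subline.
    subline : ∀ {y z x a b} → Indep₂ y z → graph x ≡ a *ᵥ graph y +ᵥ b *ᵥ graph z → InF a × InF b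
    subline {y} {z} {x} {a} {b} ind e = fixed (proj₁ coefficients) , fixed (proj₂ coefficients)
      where
      components : x ≡ a *ᵥ y +ᵥ b *ᵥ z × σᵥ x ≡ a *ᵥ σᵥ y +ᵥ b *ᵥ σᵥ z
      components = ⊞-inj (trans e (⊞-lin a b y (σᵥ y) z (σᵥ z)))
      coefficients : σ a ≡ a × σ b ≡ b
      coefficients = indep₂-inj (σ-indep ind) (trans (sym (trans (cong σᵥ_ (proj₁ components))
        (trans (σᵥ-+ (a *ᵥ y) (b *ᵥ z)) (cong₂ _+ᵥ_ (σᵥ-* a y) (σᵥ-* b z))))) (proj₂ components))

    -- Eliminates the unknown vector z: σ applied to the first equation expresses σ z up to a
    -- scalar, and comparison with the second leaves one factor e for both coefficients.
    proportion : ∀ {z₁ z₂ z : V {n}} {a b p₁ p₂ q₁ q₂} → Indep₂ z₁ z₂ → ¬ (p₁ ≡ 0# × p₂ ≡ 0#) →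
                 a *ᵥ z ≡ p₁ *ᵥ z₁ +ᵥ p₂ *ᵥ z₂ → b *ᵥ σᵥ z ≡ q₁ *ᵥ σᵥ z₁ +ᵥ q₂ *ᵥ σᵥ z₂ →
                 ∃[ e ] q₁ ≡ e * σ p₁ × q₂ ≡ e * σ p₂
    proportion {z₁} {z₂} {z} {a} {b} {p₁} {p₂} {q₁} {q₂} ind nz e e′ = b * σ r , indep₂-inj (σ-indep ind) (begin
        q₁ *ᵥ σᵥ z₁ +ᵥ q₂ *ᵥ σᵥ z₂                ≡⟨ e′ ⟨
        b *ᵥ σᵥ z                                 ≡⟨ cong (λ z → b *ᵥ σᵥ z) (trans (*ᵥ-inv a≢0 refl) (cong (r *ᵥ_) e)) ⟩
        b *ᵥ σᵥ (r *ᵥ (p₁ *ᵥ z₁ +ᵥ p₂ *ᵥ z₂))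
          ≡⟨ cong (b *ᵥ_) (trans (σᵥ-* r _) (cong (σ r *ᵥ_) (trans (σᵥ-+ (p₁ *ᵥ z₁) (p₂ *ᵥ z₂)) (cong₂ _+ᵥ_ (σᵥ-* p₁ z₁) (σᵥ-* p₂ z₂))))) ⟩
        b *ᵥ σ r *ᵥ (σ p₁ *ᵥ σᵥ z₁ +ᵥ σ p₂ *ᵥ σᵥ z₂)
          ≡⟨ lem b (σ r) (σ p₁) (σ p₂) (σᵥ z₁) (σᵥ z₂) ⟩
        (b * σ r * σ p₁) *ᵥ σᵥ z₁ +ᵥ (b * σ r * σ p₂) *ᵥ σᵥ z₂ ∎)
      where
      a≢0 : a ≢ 0#
      a≢0 refl = nz (ind p₁ p₂ (trans (sym e) (*ᵥ-zeroˡ z)))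
      r : Carrier
      r = inv a a≢0
      lem : ∀ {N} b r p p′ (u v : V {N}) → b *ᵥ r *ᵥ (p *ᵥ u +ᵥ p′ *ᵥ v) ≡ (b * r * p) *ᵥ u +ᵥ (b * r * p′) *ᵥ v
      lem b r p p′ []      []      = refl
      lem b r p p′ (x ∷ u) (y ∷ v) = cong₂ _∷_
        (solve 6 (λ b r p p′ x y → b :* (r :* (p :* x :+ p′ :* y)) := b :* r :* p :* x :+ b :* r :* p′ :* y) refl b r p p′ x y) (lem b r p p′ u v)

    -- A line all of whose points lie on rulings is contained in T₁ or in T₂.
    transversal-line : ∀ {z₁ z₂ a₁ b₁ a₂ b₂} → Indep₂ z₁ z₂ → a₁ *ᵥ z₁ ⊞ b₁ *ᵥ σᵥ z₁ ≢ 0ᵥ → a₂ *ᵥ z₂ ⊞ b₂ *ᵥ σᵥ z₂ ≢ 0ᵥ →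
      (∀ c → c ≢ 0# → ∃[ z ] OnRuling z ((a₁ *ᵥ z₁ ⊞ b₁ *ᵥ σᵥ z₁) +ᵥ c *ᵥ (a₂ *ᵥ z₂ ⊞ b₂ *ᵥ σᵥ z₂))) →
      (b₁ ≡ 0# × b₂ ≡ 0#) ⊎ (a₁ ≡ 0# × a₂ ≡ 0#)
    transversal-line {z₁} {z₂} {a₁} {b₁} {a₂} {b₂} ind u≢0 v≢0 on-ruling = case (a₁ ≟ 0#) (a₂ ≟ 0#)
      where
      zero-sum : ∀ {a b} (z : V {n}) → a ≡ 0# → b ≡ 0# → a *ᵥ z ⊞ b *ᵥ σᵥ z ≡ 0ᵥ
      zero-sum z refl refl = trans (cong₂ _⊞_ (*ᵥ-zeroˡ z) (*ᵥ-zeroˡ (σᵥ z))) ⊞-0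
      w = proj₁ ∃∉F
      w≢0 : w ≢ 0#
      w≢0 e = proj₂ ∃∉F (F.0# , trans ι-0 (sym e))
      ratio : ¬ (a₁ ≡ 0# × a₂ ≡ 0#) → ∀ c → c ≢ 0# → ∃[ e ] b₁ ≡ e * σ a₁ × c * b₂ ≡ e * σ (c * a₂)
      ratio nz c c≢0 = from (on-ruling c c≢0)
        where
        from : ∃[ z ] OnRuling z ((a₁ *ᵥ z₁ ⊞ b₁ *ᵥ σᵥ z₁) +ᵥ c *ᵥ (a₂ *ᵥ z₂ ⊞ b₂ *ᵥ σᵥ z₂)) → ∃[ e ] b₁ ≡ e * σ a₁ × c * b₂ ≡ e * σ (c * a₂)
        from (z , a , b , e) = proportion {z = z} {a} {b} ind (λ (p , r) → nz (p , *-zero⇒ r c≢0)) (sym (proj₁ eqs)) (sym (proj₂ eqs))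
          where
          eqs : a₁ *ᵥ z₁ +ᵥ (c * a₂) *ᵥ z₂ ≡ a *ᵥ z × b₁ *ᵥ σᵥ z₁ +ᵥ (c * b₂) *ᵥ σᵥ z₂ ≡ b *ᵥ σᵥ z
          eqs = ⊞-inj (trans (cong₂ _⊞_ (cong (a₁ *ᵥ z₁ +ᵥ_) (*ᵥ-assoc c a₂ z₂)) (cong (b₁ *ᵥ σᵥ z₁ +ᵥ_) (*ᵥ-assoc c b₂ (σᵥ z₂))))
            (trans (sym (trans (cong (_ +ᵥ_) (⊞-* c (a₂ *ᵥ z₂) (b₂ *ᵥ σᵥ z₂))) (⊞-+ (a₁ *ᵥ z₁) (b₁ *ᵥ σᵥ z₁) (c *ᵥ a₂ *ᵥ z₂) (c *ᵥ b₂ *ᵥ σᵥ z₂)))) e))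
      case : Dec (a₁ ≡ 0#) → Dec (a₂ ≡ 0#) → (b₁ ≡ 0# × b₂ ≡ 0#) ⊎ (a₁ ≡ 0# × a₂ ≡ 0#)
      case (yes a₁≡0) (yes a₂≡0) = inj₂ (a₁≡0 , a₂≡0)
      case (yes a₁≡0) (no a₂≢0)  = let (e , p , _) = ratio (λ (_ , z) → a₂≢0 z) 1# 1≢0 in
        contradiction (zero-sum z₁ a₁≡0 (trans p (trans (cong (λ a → e * σ a) a₁≡0) (trans (cong (e *_) σ-0) (zeroʳ e))))) u≢0
      case (no a₁≢0)  _          = conclude (a₂ ≟ 0#)
        where
        nz : ¬ (a₁ ≡ 0# × a₂ ≡ 0#)
        nz (z , _) = a₁≢0 z
        r₁ = ratio nz 1# 1≢0
        e = proj₁ r₁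
        rw = ratio nz w w≢0
        b₂≡ : b₂ ≡ e * σ a₂
        b₂≡ = trans (sym (*-identityˡ b₂)) (trans (proj₂ (proj₂ r₁)) (cong (λ a → e * σ a) (*-identityˡ a₂)))
        same-e : proj₁ rw ≡ e
        same-e = *-cancelʳ (σ-≢0 a₁≢0) (trans (sym (proj₁ (proj₂ rw))) (proj₁ (proj₂ r₁)))
        b₂≡0 : b₂ ≡ 0#
        b₂≡0 = decidable-stable (b₂ ≟ 0#) (λ b₂≢0 → proj₂ ∃∉F (fixed (sym (*-cancelʳ b₂≢0 (begin
          w * b₂                 ≡⟨ proj₂ (proj₂ rw) ⟩
          proj₁ rw * σ (w * a₂)  ≡⟨ cong₂ _*_ same-e (σ-* w a₂) ⟩
          e * (σ w * σ a₂)       ≡⟨ solve 3 (λ e w a → e :* (w :* a) := w :* (e :* a)) refl e (σ w) (σ a₂) ⟩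
          σ w * (e * σ a₂)       ≡⟨ cong (σ w *_) b₂≡ ⟨
          σ w * b₂               ∎)))))
        conclude : Dec (a₂ ≡ 0#) → (b₁ ≡ 0# × b₂ ≡ 0#) ⊎ (a₁ ≡ 0# × a₂ ≡ 0#)
        conclude (yes a₂≡0) = contradiction (zero-sum z₂ a₂≡0 b₂≡0) v≢0
        conclude (no a₂≢0)  = inj₁ (trans (proj₁ (proj₂ r₁)) (trans (cong (_* σ a₁) e≡0) (zeroˡ _)) , b₂≡0)
          where
          e≡0 : e ≡ 0#
          e≡0 = *-zero⇒ (trans (*-comm (σ a₂) e) (trans (sym b₂≡) b₂≡0)) (σ-≢0 a₂≢0)

    -- α and κ do not depend on c, so the factor of `proportion` is the same for all c. The value c
    -- = 1, where p and r are both 1, gives δ = e σ β, and δ then cancels.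
    compare-scales : ∀ {z₁ z₂ : V {n}} {α β κ δ} {p r : Carrier → Carrier} → Indep₂ z₁ z₂ → α ≢ 0# → δ ≢ 0# → p 1# ≡ 1# → r 1# ≡ 1# →
      (∀ c → c ≢ 0# → ∃[ z ] ∃[ a ] ∃[ b ] a *ᵥ z ≡ α *ᵥ z₁ +ᵥ (p c * β) *ᵥ z₂ × b *ᵥ σᵥ z ≡ κ *ᵥ σᵥ z₁ +ᵥ (r c * δ) *ᵥ σᵥ z₂) →
      ∀ c → c ≢ 0# → r c ≡ σ (p c)
    compare-scales {z₁} {z₂} {α} {β} {κ} {δ} {p} {r} ind α≢0 δ≢0 p1 r1 on c c≢0 = *-cancelʳ δ≢0 (begin
        r c * δ                 ≡⟨ proj₂ (proj₂ rc) ⟩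
        proj₁ rc * σ (p c * β)  ≡⟨ cong₂ _*_ same-e (σ-* (p c) β) ⟩
        e * (σ (p c) * σ β)     ≡⟨ solve 3 (λ e p b → e :* (p :* b) := p :* (e :* b)) refl e (σ (p c)) (σ β) ⟩
        σ (p c) * (e * σ β)     ≡⟨ cong (σ (p c) *_) δ≡ ⟨
        σ (p c) * δ             ∎)
      where
      ratio : ∀ c → c ≢ 0# → ∃[ e ] κ ≡ e * σ α × r c * δ ≡ e * σ (p c * β)
      ratio c c≢0 = let (z , a , b , e₁ , e₂) = on c c≢0 in proportion {z = z} {a} {b} ind (λ (z , _) → α≢0 z) e₁ e₂
      r₁ = ratio 1# 1≢0
      rc = ratio c c≢0
      e = proj₁ r₁
      same-e : proj₁ rc ≡ e
      same-e = *-cancelʳ (σ-≢0 α≢0) (trans (sym (proj₁ (proj₂ rc))) (proj₁ (proj₂ r₁)))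
      δ≡ : δ ≡ e * σ β
      δ≡ = trans (sym (*-identityˡ δ)) (trans (cong (_* δ) (sym r1)) (trans (proj₂ (proj₂ r₁))
        (cong (λ a → e * σ a) (trans (cong (_* β) p1) (*-identityˡ β)))))

  -- Lines meeting L in more than q + 1 points are the rulings, so these are preserved.
  module Preserved (G G′ : Generator) (f : Collineation)
                   (f-L : ∀ p → p ∈ Standard.L n 2≤n G ⇔ Collineation.to f p ∈ Standard.L n 2≤n G′) where
    open CollineationMaps K (2 ℕ.* n) f public
    module R = Rulings G
    module R′ = Rulings G′
    module σ = Semilinear G
    module σ′ = Semilinear G′

    abstract
      maps-L : ∀ {x} → x ≢ 0ᵥ → ∀ {w} → Maps (R.S.graph x) w → ∃[ y ] ∃[ a ] y ≢ 0ᵥ × a ≢ 0# × w ≡ a *ᵥ R′.S.graph y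
      maps-L {x} x≢0 {w} (w≢0 , v≢0 , ρ , e) = from (R′.S.L-elim {Collineation.to f p} (Equivalence.to (f-L p)
          (R.S.L-intro {p} x 1# (sym (*ᵥ-identity _)))))
        where
        p : Point
        p = point (R.S.graph x) v≢0
        from : ∃[ y ] ∃[ a ] y ≢ 0ᵥ × a ≢ 0# × vec (Collineation.to f p) ≡ a *ᵥ R′.S.graph y → ∃[ y ] ∃[ a ] y ≢ 0ᵥ × a ≢ 0# × w ≡ a *ᵥ R′.S.graph y
        from (y , a , y≢0 , a≢0 , e′) = y , ρ * a , y≢0 , *-≢0 (scalar≢0 w≢0 e) a≢0 ,
          trans e (trans (cong (ρ *ᵥ_) e′) (sym (*ᵥ-assoc ρ a _)))

      graph≢0 : ∀ {x} → x ≢ 0ᵥ → R.S.graph x ≢ 0ᵥ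
      graph≢0 x≢0 e = x≢0 (R.S.graph-inj (trans e (sym R.S.graph-0)))

    module _ {x : V {n}} (x≢0 : x ≢ 0ᵥ) where
      private
        on-L : Maybe (Maybe F.Carrier) → 𝕍
        on-L i = R.S.graph (element i *ᵥ x)

        ex≢0 : ∀ i → element i *ᵥ x ≢ 0ᵥ
        ex≢0 i = *ᵥ-nonzero (element≢0 i) x≢0

        on-L-distinct : ∀ i j a → on-L i ≡ a *ᵥ on-L j → i ≡ j
        on-L-distinct i j a e = from (R.S.graph-scalar (ex≢0 j) (sym e))
          where
          from : InF a → i ≡ j
          from (c , eq) = element-ratio i j c (trans (*ᵥ-cancelʳ x≢0 (trans (proj₁ (⊞-inj (trans e (⊞-* a _ _))))
            (sym (*ᵥ-assoc a (element j) x)))) (cong (_* element j) (sym eq)))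

        im : Maybe (Maybe F.Carrier) → 𝕍
        im i = vec (Collineation.to f (point (on-L i) (graph≢0 (ex≢0 i))))

        m : ∀ i → Maps (on-L i) (im i)
        m i = maps-intro (graph≢0 (ex≢0 i))

        p₁ p₂ : Maybe (Maybe F.Carrier)
        p₁ = nothing
        p₂ = just nothing

        ind : Indep₂ (on-L p₁) (on-L p₂)
        ind = indep₂-intro (graph≢0 (ex≢0 p₁)) (λ a e → contradiction (on-L-distinct p₂ p₁ a e) λ ())

        on-line : ∀ i → ∃[ α ] ∃[ β ] on-L i ≡ α *ᵥ on-L p₁ +ᵥ β *ᵥ on-L p₂
        on-line i = R.ruling-span x≢0 ind (R.graph-on-ruling x _) (R.graph-on-ruling x _) (R.graph-on-ruling x _)

        Image : Set
        Image = ∃[ z ] z ≢ 0ᵥ × (∀ {v w} → Maps v w → R.S.OnRuling x v → R′.S.OnRuling z w)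

        module Images (w₁ w₂ : 𝕍) (m₁ : Maps (on-L p₁) w₁) (m₂ : Maps (on-L p₂) w₂)
                      (y z : V {n}) (a b : Carrier) (y≢0 : y ≢ 0ᵥ)
                      (e₁ : w₁ ≡ a *ᵥ R′.S.graph y) (e₂ : w₂ ≡ b *ᵥ R′.S.graph z) where

          -- Every point of the ruling of x lies on the line joining the two chosen points. If their
          -- images share a ruling, all images lie on it.
          same-ruling : ∀ κ → z ≡ κ *ᵥ y → Image
          same-ruling κ e = y , y≢0 , λ {v} {w} mv v∈ →
            let (α , β , eq) = maps-line m₁ m₂ mv ind (R.ruling-span x≢0 ind (R.graph-on-ruling x _) (R.graph-on-ruling x _) v∈)
            in subst (R′.S.OnRuling y) (sym eq) (R′.ruling-closed α β w₁∈ w₂∈)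
            where
            scaled : ∀ {c u v} → u ≡ c *ᵥ R′.S.graph v → R′.S.OnRuling v u
            scaled {c} {u} {v} e = c , c , trans e (⊞-* c v _)
            w₁∈ : R′.S.OnRuling y w₁
            w₁∈ = scaled e₁
            w₂∈ : R′.S.OnRuling y w₂
            w₂∈ = R′.ruling-multiple e (scaled e₂)

          module _ (y-z : Indep₂ y z) where
            -- Representatives of the q + 1 points of the F-subline through ⟨graph y⟩ and ⟨graph z⟩;
            -- by `subline`, no other points of the second set lie on the line joining these two.
            D : Maybe F.Carrier → 𝕍
            D nothing  = R′.S.graph z
            D (just c) = R′.S.graph y +ᵥ ι c *ᵥ R′.S.graph z

            normal-form : ∀ {u a b} → InF a → InF b → u ≡ a *ᵥ R′.S.graph y +ᵥ b *ᵥ R′.S.graph z → ∃[ d ] ∃[ ρ ] u ≡ ρ *ᵥ D d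
            normal-form {u} (c , refl) (d , refl) e with c F.≟ F.0#
            ... | yes refl = nothing , ι d , trans e (trans (cong (λ o → o *ᵥ R′.S.graph y +ᵥ ι d *ᵥ R′.S.graph z) ι-0)
                               (trans (cong (_+ᵥ ι d *ᵥ R′.S.graph z) (*ᵥ-zeroˡ _)) (+ᵥ-identityˡ _)))
            ... | no c≢0 with h , refl ← F.div c≢0 d = just h , ι c , trans e (trans (cong (ι c *ᵥ R′.S.graph y +ᵥ_)
                               (trans (cong (_*ᵥ R′.S.graph z) (ι-* c h)) (*ᵥ-assoc (ι c) (ι h) _))) (sym (*ᵥ-distrib-+ᵥ (ι c) _ _)))

            located : ∀ i {w} → Maps (on-L i) w → ∃[ d ] ∃[ ρ ] w ≡ ρ *ᵥ D d
            located i {w} mi = from (maps-L (ex≢0 i) mi) (maps-line m₁ m₂ mi ind (on-line i))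
              where
              from : ∃[ y′ ] ∃[ c ] y′ ≢ 0ᵥ × c ≢ 0# × w ≡ c *ᵥ R′.S.graph y′ → ∃[ α ] ∃[ β ] w ≡ α *ᵥ w₁ +ᵥ β *ᵥ w₂ → ∃[ d ] ∃[ ρ ] w ≡ ρ *ᵥ D d
              from (y′ , c , _ , c≢0 , ew) (α , β , ew′) = let (d , ρ , eq) = normal-form (proj₁ coefs) (proj₂ coefs) gy′ in
                  d , c * ρ , trans ew (trans (cong (c *ᵥ_) eq) (sym (*ᵥ-assoc c ρ _)))
                where
                i′ : Carrier
                i′ = inv c c≢0
                lem : ∀ {N} i α a β b (u v : V {N}) → i *ᵥ (α *ᵥ a *ᵥ u +ᵥ β *ᵥ b *ᵥ v) ≡ (i * (α * a)) *ᵥ u +ᵥ (i * (β * b)) *ᵥ v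
                lem i α a β b u v = trans (*ᵥ-distrib-+ᵥ i _ _) (cong₂ _+ᵥ_
                  (trans (cong (i *ᵥ_) (sym (*ᵥ-assoc α a u))) (sym (*ᵥ-assoc i (α * a) u)))
                  (trans (cong (i *ᵥ_) (sym (*ᵥ-assoc β b v))) (sym (*ᵥ-assoc i (β * b) v))))
                gy′ : R′.S.graph y′ ≡ (i′ * (α * a)) *ᵥ R′.S.graph y +ᵥ (i′ * (β * b)) *ᵥ R′.S.graph z
                gy′ = trans (*ᵥ-inv c≢0 ew) (trans (cong (i′ *ᵥ_) (trans ew′ (cong₂ (λ u v → α *ᵥ u +ᵥ β *ᵥ v) e₁ e₂)))
                        (lem i′ α a β b (R′.S.graph y) (R′.S.graph z)))
                coefs : InF (i′ * (α * a)) × InF (i′ * (β * b))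
                coefs = R′.subline y-z gy′

            -- The q + 2 points chosen on the ruling of x have distinct images, and each of these is
            -- one of the q + 1 points `D d`.
            impossible : ⊥
            impossible = no-injection {λ i → proj₁ (located i (m i))} (λ {i} {j} e →
              let (_ , ρ , ei) = located i (m i) ; (_ , ρ′ , ej) = located j (m j)
                  ρ′≢0 = scalar≢0 (proj₁ (m j)) ej
                  (a , eq) = maps-injective (m i) (m j) (ρ * inv ρ′ ρ′≢0 , trans ei (trans (cong (λ d → ρ *ᵥ D d) e)
                     (trans (cong (ρ *ᵥ_) (*ᵥ-inv ρ′≢0 ej)) (sym (*ᵥ-assoc ρ _ _)))))
              in on-L-distinct i j a eq)

      abstract
        ruling-image : ∃[ z ] z ≢ 0ᵥ × (∀ {v w} → Maps v w → R.S.OnRuling x v → R′.S.OnRuling z w)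
        ruling-image = from (maps-L (ex≢0 p₁) (m p₁)) (maps-L (ex≢0 p₂) (m p₂))
          where
          from : ∃[ y ] ∃[ a ] y ≢ 0ᵥ × a ≢ 0# × im p₁ ≡ a *ᵥ R′.S.graph y → ∃[ z ] ∃[ b ] z ≢ 0ᵥ × b ≢ 0# × im p₂ ≡ b *ᵥ R′.S.graph z → Image
          from (y , a , y≢0 , _ , e₁) (z , b , _ , _ , e₂) = case (search enumeration (λ κ → z ≟ᵥ κ *ᵥ y))
            where
            module I = Images (im p₁) (im p₂) (m p₁) (m p₂) y z a b y≢0 e₁ e₂
            case : Dec (∃[ κ ] z ≡ κ *ᵥ y) → Image
            case (yes (κ , e)) = I.same-ruling κ e
            case (no ¬κ)       = ⊥-elim (I.impossible (indep₂-intro y≢0 (λ κ e → ¬κ (κ , e))))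

-- The multiplicative map induced on a coordinate of the transversal subspaces

module Transport {q t : ℕ} (E : FieldExtension q t) (3≤t : 3 ≤ t) (n : ℕ) (2≤n : 2 ≤ n)
  (G G′ : Extension.Generator E 3≤t) (f : LinearSets.Collineation E n)
  (f-L : ∀ p → p ∈ Over.Standard.L E 3≤t n 2≤n G ⇔ LinearSets.Collineation.to E n f p ∈ Over.Standard.L E 3≤t n 2≤n G′) where
  open Over E 3≤t
  open Inequivalence E 3≤t n 2≤n
  open Preserved G G′ f f-L
  open Doubled {n}
  open LinearSets E n using (point; module Point; module Collineation)
  open Point
  open Collineation f using (to)
  open ≡-Reasoning
  open R.S using () renaming (OnRuling to On)
  open R′.S using () renaming (OnRuling to On′)
  open Extension.Generator G using (σ)
  open Extension.Generator G′ using () renaming (σ to σ′)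

  indep-pair : ∀ {n} → 2 ≤ n → ∃[ x ] ∃[ y ] Indep₂ {n} x y
  indep-pair (s≤s (s≤s z≤n)) = 1# ∷ 0# ∷ 0ᵥ , 0# ∷ 1# ∷ 0ᵥ , λ a b e →
    trans (solve 2 (λ a b → a := a :* :1 :+ b :* :0) refl a b) (∷-injectiveˡ e) ,
    trans (solve 2 (λ a b → b := a :* :0 :+ b :* :1) refl a b) (∷-injectiveˡ (∷-injectiveʳ e))

  private
    null : ∀ {N} a b → a *ᵥ 0ᵥ {N} +ᵥ b *ᵥ 0ᵥ ≡ 0ᵥ
    null a b = trans (cong₂ _+ᵥ_ (*ᵥ-zeroʳ a) (*ᵥ-zeroʳ b)) (+ᵥ-identityˡ 0ᵥ)

    lin₁ : ∀ a b x y → a *ᵥ (x ⊞ 0ᵥ) +ᵥ b *ᵥ (y ⊞ 0ᵥ) ≡ a *ᵥ x +ᵥ b *ᵥ y ⊞ 0ᵥ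
    lin₁ a b x y = trans (⊞-lin a b x 0ᵥ y 0ᵥ) (cong (a *ᵥ x +ᵥ b *ᵥ y ⊞_) (null a b))

    lin₂ : ∀ a b x y → a *ᵥ (0ᵥ ⊞ x) +ᵥ b *ᵥ (0ᵥ ⊞ y) ≡ 0ᵥ ⊞ a *ᵥ x +ᵥ b *ᵥ y
    lin₂ a b x y = trans (⊞-lin a b 0ᵥ x 0ᵥ y) (cong (_⊞ a *ᵥ x +ᵥ b *ᵥ y) (null a b))

    indep-T₁ : ∀ {x y} → Indep₂ x y → Indep₂ (x ⊞ 0ᵥ) (y ⊞ 0ᵥ)
    indep-T₁ {x} {y} ind a b e = ind a b (proj₁ (⊞-≡0 (trans (sym (lin₁ a b x y)) e)))

    indep-T₂ : ∀ {x y} → Indep₂ x y → Indep₂ (0ᵥ ⊞ x) (0ᵥ ⊞ y)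
    indep-T₂ {x} {y} ind a b e = ind a b (proj₂ (⊞-≡0 (trans (sym (lin₂ a b x y)) e)))

    indep-T₁T₂ : ∀ {x y} → x ≢ 0ᵥ → y ≢ 0ᵥ → Indep₂ (x ⊞ 0ᵥ) (0ᵥ ⊞ y)
    indep-T₁T₂ {x} {y} x≢0 y≢0 a b e = let (p , r) = ⊞-≡0 (trans (sym (R.S.lin-⊞ a b x y)) e) in *ᵥ-≢0 x≢0 p , *ᵥ-≢0 y≢0 r

    On-T₁ : ∀ x → On x (x ⊞ 0ᵥ)
    On-T₁ x = 1# , 0# , sym (cong₂ _⊞_ (*ᵥ-identity x) (*ᵥ-zeroˡ _))

    On-T₂ : ∀ x → On x (0ᵥ ⊞ σ.σᵥ x)
    On-T₂ x = 0# , 1# , sym (cong₂ _⊞_ (*ᵥ-zeroˡ x) (*ᵥ-identity _))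

  Carries : V {n} → V {n} → Set
  Carries x z = ∀ {v w} → Maps v w → On x v → On′ z w

  -- What remains of the collineation: a multiplicative map of K intertwining σ with σ′ or its inverse.
  record Intertwiner : Set where
    field
      θ      : Carrier → Carrier
      θ-1    : θ 1# ≡ 1#
      θ-inj  : Inj θ
      θ-≢0   : ∀ {c} → c ≢ 0# → θ c ≢ 0#
      θ-*    : ∀ d c → d ≢ 0# → c ≢ 0# → θ (d * c) ≡ θ d * θ c
      twines : (∀ c → c ≢ 0# → θ (σ c) ≡ σ′ (θ c)) ⊎ (∀ c → c ≢ 0# → θ c ≡ σ′ (θ (σ c)))

  -- A = (x, 0) and B = (y, 0) lie in T₁, C = (0, σ x) and D = (0, σ y) in T₂; A, C are on the
  -- ruling of x and B, D on that of y. All three scales start at A, and since C is not on AB nor D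
  -- on AC, they agree off zero.
  module Frame {x y : V {n}} (x-y : Indep₂ x y) {z₁ z₂ : V {n}} (z₁≢0 : z₁ ≢ 0ᵥ) (z₂≢0 : z₂ ≢ 0ᵥ)
               (carries₁ : Carries x z₁) (carries₂ : Carries y z₂)
               {A′ : 𝕍} (mA : Maps (x ⊞ 0ᵥ) A′)
               (sB : Scale (x ⊞ 0ᵥ) A′ (y ⊞ 0ᵥ)) (sC : Scale (x ⊞ 0ᵥ) A′ (0ᵥ ⊞ σ.σᵥ x)) (sD : Scale (x ⊞ 0ᵥ) A′ (0ᵥ ⊞ σ.σᵥ y)) where
    private
      A B C D : 𝕍
      A = x ⊞ 0ᵥ
      B = y ⊞ 0ᵥ
      C = 0ᵥ ⊞ σ.σᵥ x
      D = 0ᵥ ⊞ σ.σᵥ y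
      open Scale sB using (B′; θ) renaming (maps-B to mB; maps-θ to maps-θB; θ-1 to θB-1; θ-≢0 to θB-≢0; θ-inj to θB-inj)
      open Scale sC using () renaming (B′ to C′; maps-B to mC; θ to θC)
      open Scale sD using () renaming (B′ to D′; maps-B to mD; θ to θD)

      x≢0 : x ≢ 0ᵥ
      x≢0 = indep₂-≢0ˡ x-y
      y≢0 : y ≢ 0ᵥ
      y≢0 = indep₂-≢0ˡ (indep₂-sym x-y)
      A-B : Indep₂ A B
      A-B = indep-T₁ x-y
      A-C : Indep₂ A C
      A-C = indep-T₁T₂ x≢0 (σ.σᵥ-≢0 x≢0)
      A-D : Indep₂ A D
      A-D = indep-T₁T₂ x≢0 (σ.σᵥ-≢0 y≢0)
      B-C : Indep₂ B C
      B-C = indep-T₁T₂ y≢0 (σ.σᵥ-≢0 x≢0)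
      C-D : Indep₂ C D
      C-D = indep-T₂ (R.σ-indep x-y)
      C∉AB : ¬ (∃[ α ] ∃[ β ] C ≡ α *ᵥ A +ᵥ β *ᵥ B)
      C∉AB (α , β , e) = σ.σᵥ-≢0 x≢0 (proj₂ (⊞-inj (trans e (lin₁ α β x y))))
      D∉AC : ¬ (∃[ α ] ∃[ β ] D ≡ α *ᵥ A +ᵥ β *ᵥ C)
      D∉AC (α , β , e) = indep₂-≢ (R.σ-indep x-y) β (proj₂ (⊞-inj (trans e (R.S.lin-⊞ α β x (σ.σᵥ x)))))

      module ABC = Product mA A-B A-C B-C C∉AB sB sC
      module ACD = Product mA A-C A-D C-D D∉AC sC sD

      θD≡θ : ∀ d → d ≢ 0# → θD d ≡ θ d
      θD≡θ d d≢0 = trans (ACD.same-scale d d≢0) (ABC.same-scale d d≢0)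

      θ-* : ∀ d c → d ≢ 0# → c ≢ 0# → θ (d * c) ≡ θ d * θ c
      θ-* d c d≢0 c≢0 = trans (sym (ABC.same-scale _ (*-≢0 d≢0 c≢0))) (trans (ABC.product d c d≢0) (cong (θ d *_) (ABC.same-scale c c≢0)))

      -- If the rulings of x and y had the same image, B′ would lie on the line A′C′, and hence B on
      -- AC.
      z₁-z₂ : Indep₂ z₁ z₂
      z₁-z₂ = indep₂-intro z₁≢0 λ a e → absurd (maps-line⁻¹ mA mC mB A-C
          (R′.ruling-span z₁≢0 (maps-indep mA mC A-C) (carries₁ mA (On-T₁ x)) (carries₁ mC (On-T₂ x)) (R′.ruling-multiple e (carries₂ mB (On-T₁ y)))))
        where
        absurd : ∃[ α ] ∃[ β ] B ≡ α *ᵥ A +ᵥ β *ᵥ C → ⊥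
        absurd (α , β , e) = indep₂-≢ x-y α (proj₁ (⊞-inj (trans e (R.S.lin-⊞ α β x (σ.σᵥ x)))))

      ruling-of : ∀ {w v} → Maps v w → ∃[ x ] x ≢ 0ᵥ × On x v → ∃[ z ] On′ z w
      ruling-of mv (x , x≢0 , on) = let (z , _ , carry) = ruling-image x≢0 in z , carry mv on

      -- Points of the image line come from points of the original line. If all of those lie on
      -- rulings, so do all points of the image, as `transversal-line` requires.
      on-line : ∀ {u v u′ v′} → Maps u u′ → Maps v v′ → Indep₂ u v → (∀ α β → α *ᵥ u +ᵥ β *ᵥ v ≢ 0ᵥ → ∃[ x ] x ≢ 0ᵥ × On x (α *ᵥ u +ᵥ β *ᵥ v)) →
                ∀ c → ∃[ z ] On′ z (u′ +ᵥ c *ᵥ v′)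
      on-line {u} {v} {u′} {v′} mu mv ind on c = from (maps-surjective (+c≢0 {u′} {v′} c (maps-indep {u} {v} {u′} {v′} mu mv ind)))
        where
        from : ∃[ w ] Maps w (u′ +ᵥ c *ᵥ v′) → ∃[ z ] On′ z (u′ +ᵥ c *ᵥ v′)
        from (w , mw) = let (α , β , e) = maps-line⁻¹ mu mv mw ind (1# , c , cong (_+ᵥ c *ᵥ v′) (sym (*ᵥ-identity u′))) in
          ruling-of mw (subst (λ w → ∃[ x ] x ≢ 0ᵥ × On x w) (sym e) (on α β (subst (_≢ 0ᵥ) e (maps-source≢0 mw))))

      AB-on : ∀ α β → α *ᵥ A +ᵥ β *ᵥ B ≢ 0ᵥ → ∃[ x ] x ≢ 0ᵥ × On x (α *ᵥ A +ᵥ β *ᵥ B)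
      AB-on α β nz = α *ᵥ x +ᵥ β *ᵥ y , (λ e → nz (trans (lin₁ α β x y) (trans (cong (_⊞ 0ᵥ) e) ⊞-0))) ,
        subst (On _) (sym (lin₁ α β x y)) (On-T₁ _)

      CD-on : ∀ α β → α *ᵥ C +ᵥ β *ᵥ D ≢ 0ᵥ → ∃[ x ] x ≢ 0ᵥ × On x (α *ᵥ C +ᵥ β *ᵥ D)
      CD-on α β nz = v , (λ e → nz (trans CD≡ (trans (cong (λ v → 0ᵥ ⊞ σ.σᵥ v) e) (trans (cong (0ᵥ ⊞_) σ.σᵥ-0) ⊞-0)))) ,
          subst (On v) (sym CD≡) (On-T₂ v)
        where
        v : V {n}
        v = σ.σ⁻¹ α *ᵥ x +ᵥ σ.σ⁻¹ β *ᵥ y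
        CD≡ : α *ᵥ C +ᵥ β *ᵥ D ≡ 0ᵥ ⊞ σ.σᵥ v
        CD≡ = trans (lin₂ α β (σ.σᵥ x) (σ.σᵥ y)) (cong (0ᵥ ⊞_) (sym (trans (σ.σᵥ-+ (σ.σ⁻¹ α *ᵥ x) (σ.σ⁻¹ β *ᵥ y))
          (cong₂ _+ᵥ_ (trans (σ.σᵥ-* (σ.σ⁻¹ α) x) (cong (_*ᵥ σ.σᵥ x) (σ.σσ⁻¹ α))) (trans (σ.σᵥ-* (σ.σ⁻¹ β) y) (cong (_*ᵥ σ.σᵥ y) (σ.σσ⁻¹ β)))))))

      ω : Carrier
      ω = - θ (- 1#)

      neg≡0 : ∀ {x} → - x ≡ 0# → x ≡ 0#
      neg≡0 {x} e = trans (sym (+-identityʳ x)) (trans (cong (x +_) (sym e)) (-‿inverseʳ x))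

      -1≢0 : - 1# ≢ 0#
      -1≢0 e = 1≢0 (neg≡0 e)

      ω≢0 : ω ≢ 0#
      ω≢0 e = θB-≢0 -1≢0 (neg≡0 e)

      second : ∀ c → c ≢ 0# → Maps (C +ᵥ c *ᵥ D) (C′ +ᵥ (ω * θ c) *ᵥ D′)
      second c c≢0 = subst₂ (λ c e → Maps (C +ᵥ c *ᵥ D) (C′ +ᵥ e *ᵥ D′)) (solve 1 (λ c → :- (:- c) := c) refl c)
        (begin
          - θD (- c)           ≡⟨ cong -_ (θD≡θ (- c) -c≢0) ⟩
          - θ (- c)            ≡⟨ cong (λ c → - θ c) (solve 1 (λ c → :- c := (:- :1) :* c) refl c) ⟩
          - θ ((- 1#) * c)     ≡⟨ cong -_ (θ-* (- 1#) c -1≢0 c≢0) ⟩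
          - (θ (- 1#) * θ c)   ≡⟨ solve 2 (λ a b → :- (a :* b) := (:- a) :* b) refl (θ (- 1#)) (θ c) ⟩
          ω * θ c ∎) (ACD.difference (- c))
        where
        -c≢0 : - c ≢ 0#
        -c≢0 e = c≢0 (neg≡0 e)

      -- A + c B and C + σ c D are the points of T₁ and T₂ on the ruling of x + c y. That their
      -- images share a ruling is the link between θ c and θ (σ c).
      common : ∀ c → c ≢ 0# → ∃[ z ] On′ z (A′ +ᵥ θ c *ᵥ B′) × On′ z (C′ +ᵥ (ω * θ (σ c)) *ᵥ D′)
      common c c≢0 = from (ruling-image v≢0)
        where
        v : V {n}
        v = x +ᵥ c *ᵥ y
        v≢0 : v ≢ 0ᵥ
        v≢0 e = 1≢0 (proj₁ (x-y 1# c (trans (cong (_+ᵥ c *ᵥ y) (*ᵥ-identity x)) e)))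
        AB≡ : A +ᵥ c *ᵥ B ≡ v ⊞ 0ᵥ
        AB≡ = trans (cong (_+ᵥ c *ᵥ B) (sym (*ᵥ-identity A))) (trans (lin₁ 1# c x y) (cong (λ u → u +ᵥ c *ᵥ y ⊞ 0ᵥ) (*ᵥ-identity x)))
        CD≡ : C +ᵥ σ c *ᵥ D ≡ 0ᵥ ⊞ σ.σᵥ v
        CD≡ = trans (cong (_+ᵥ σ c *ᵥ D) (sym (*ᵥ-identity C))) (trans (lin₂ 1# (σ c) (σ.σᵥ x) (σ.σᵥ y))
          (cong (0ᵥ ⊞_) (trans (cong (_+ᵥ σ c *ᵥ σ.σᵥ y) (*ᵥ-identity _)) (sym (trans (σ.σᵥ-+ x (c *ᵥ y)) (cong (σ.σᵥ x +ᵥ_) (σ.σᵥ-* c y)))))))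
        from : ∃[ z ] z ≢ 0ᵥ × Carries v z → ∃[ z ] On′ z (A′ +ᵥ θ c *ᵥ B′) × On′ z (C′ +ᵥ (ω * θ (σ c)) *ᵥ D′)
        from (z , _ , carry) = z , carry (maps-θB c) (subst (On v) (sym AB≡) (On-T₁ v)) ,
          carry (second (σ c) (σ.σ-≢0 c≢0)) (subst (On v) (sym CD≡) (On-T₂ v))

      θσ1 : θ (σ 1#) ≡ 1#
      θσ1 = trans (cong θ σ.σ-1) θB-1

    intertwiner : Intertwiner
    intertwiner = conclude (carries₁ mA (On-T₁ x)) (carries₂ mB (On-T₁ y)) (carries₁ mC (On-T₂ x)) (carries₂ mD (On-T₂ y))
      where
      from : (∀ c → c ≢ 0# → θ (σ c) ≡ σ′ (θ c)) ⊎ (∀ c → c ≢ 0# → θ c ≡ σ′ (θ (σ c))) → Intertwiner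
      from tw = record { θ = θ ; θ-1 = θB-1 ; θ-inj = θB-inj ; θ-≢0 = θB-≢0 ; θ-* = θ-* ; twines = tw }

      vanish₂ : ∀ {u a b z} → u ≡ a *ᵥ z ⊞ b *ᵥ σ′.σᵥ z → b ≡ 0# → u ≡ a *ᵥ z ⊞ 0ᵥ
      vanish₂ {a = a} {z = z} e b≡0 = trans e (cong (a *ᵥ z ⊞_) (trans (cong (_*ᵥ σ′.σᵥ z) b≡0) (*ᵥ-zeroˡ _)))

      vanish₁ : ∀ {u a b z} → u ≡ a *ᵥ z ⊞ b *ᵥ σ′.σᵥ z → a ≡ 0# → u ≡ 0ᵥ ⊞ b *ᵥ σ′.σᵥ z
      vanish₁ {b = b} {z} e a≡0 = trans e (cong (_⊞ b *ᵥ σ′.σᵥ z) (trans (cong (_*ᵥ z) a≡0) (*ᵥ-zeroˡ _)))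

      sum₁ : ∀ {u v a b z z′} c → u ≡ a *ᵥ z ⊞ 0ᵥ → v ≡ b *ᵥ z′ ⊞ 0ᵥ → u +ᵥ c *ᵥ v ≡ a *ᵥ z +ᵥ (c * b) *ᵥ z′ ⊞ 0ᵥ
      sum₁ {a = a} {b} {z} {z′} c refl refl = trans (cong ((a *ᵥ z ⊞ 0ᵥ) +ᵥ_) (⊞-* c (b *ᵥ z′) 0ᵥ)) (trans (⊞-+ (a *ᵥ z) 0ᵥ (c *ᵥ b *ᵥ z′) (c *ᵥ 0ᵥ))
        (cong₂ _⊞_ (cong (a *ᵥ z +ᵥ_) (sym (*ᵥ-assoc c b z′))) (trans (+ᵥ-identityˡ _) (*ᵥ-zeroʳ c))))

      sum₂ : ∀ {u v a b z z′} c → u ≡ 0ᵥ ⊞ a *ᵥ z → v ≡ 0ᵥ ⊞ b *ᵥ z′ → u +ᵥ c *ᵥ v ≡ 0ᵥ ⊞ a *ᵥ z +ᵥ (c * b) *ᵥ z′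
      sum₂ {a = a} {b} {z} {z′} c refl refl = trans (cong ((0ᵥ ⊞ a *ᵥ z) +ᵥ_) (⊞-* c 0ᵥ (b *ᵥ z′))) (trans (⊞-+ 0ᵥ (a *ᵥ z) (c *ᵥ 0ᵥ) (c *ᵥ b *ᵥ z′))
        (cong₂ _⊞_ (trans (+ᵥ-identityˡ _) (*ᵥ-zeroʳ c)) (cong (a *ᵥ z +ᵥ_) (sym (*ᵥ-assoc c b z′)))))

      clash : ∀ {a b : Carrier} {u : 𝕍} → ¬ Indep₂ (a *ᵥ u) (b *ᵥ u)
      clash {a} {b} {u} ind = indep₂-≢0ˡ (indep₂-sym ind) (trans (cong (_*ᵥ u) (proj₁ (ind b (- a) (lem u)))) (*ᵥ-zeroˡ u))
        where
        lem : ∀ {N} (z : V {N}) → b *ᵥ a *ᵥ z +ᵥ (- a) *ᵥ b *ᵥ z ≡ 0ᵥ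
        lem []      = refl
        lem (x ∷ z) = cong₂ _∷_ (solve 3 (λ a b x → b :* (a :* x) :+ (:- a) :* (b :* x) := :0) refl a b x) (lem z)

      pull₁ : ∀ {u a z} → u ≡ a *ᵥ z ⊞ 0ᵥ → u ≡ a *ᵥ (z ⊞ 0ᵥ)
      pull₁ {a = a} {z} e = trans e (sym (trans (⊞-* a z 0ᵥ) (cong (a *ᵥ z ⊞_) (*ᵥ-zeroʳ a))))

      pull₂ : ∀ {u a z} → u ≡ 0ᵥ ⊞ a *ᵥ z → u ≡ a *ᵥ (0ᵥ ⊞ z)
      pull₂ {a = a} {z} e = trans e (sym (trans (⊞-* a 0ᵥ z) (cong (_⊞ a *ᵥ z) (*ᵥ-zeroʳ a))))

      conclude : On′ z₁ A′ → On′ z₂ B′ → On′ z₁ C′ → On′ z₂ D′ → Intertwiner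
      conclude (a₁ , b₁ , eA) (a₂ , b₂ , eB) (c₁ , d₁ , eC) (c₂ , d₂ , eD) = from (cases
          (R′.transversal-line z₁-z₂ (subst (_≢ 0ᵥ) eA (proj₁ mA)) (subst (_≢ 0ᵥ) eB (proj₁ mB))
            λ c _ → subst₂ (λ u v → ∃[ z ] On′ z (u +ᵥ c *ᵥ v)) eA eB (on-line mA mB A-B AB-on c))
          (R′.transversal-line z₁-z₂ (subst (_≢ 0ᵥ) eC (proj₁ mC)) (subst (_≢ 0ᵥ) eD (proj₁ mD))
            λ c _ → subst₂ (λ u v → ∃[ z ] On′ z (u +ᵥ c *ᵥ v)) eC eD (on-line mC mD C-D CD-on c)))
        where
        A′-C′ : Indep₂ A′ C′
        A′-C′ = maps-indep mA mC A-C
        nonzero : ∀ {u a b z} → u ≢ 0ᵥ → u ≡ a *ᵥ z ⊞ b *ᵥ σ′.σᵥ z → a ≡ 0# → b ≢ 0#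
        nonzero {z = z} u≢0 e refl refl = u≢0 (trans e (trans (cong₂ _⊞_ (*ᵥ-zeroˡ z) (*ᵥ-zeroˡ (σ′.σᵥ z))) ⊞-0))
        nonzero′ : ∀ {u a b z} → u ≢ 0ᵥ → u ≡ a *ᵥ z ⊞ b *ᵥ σ′.σᵥ z → b ≡ 0# → a ≢ 0#
        nonzero′ u≢0 e b≡0 a≡0 = nonzero u≢0 e a≡0 b≡0
        cases : (b₁ ≡ 0# × b₂ ≡ 0#) ⊎ (a₁ ≡ 0# × a₂ ≡ 0#) → (d₁ ≡ 0# × d₂ ≡ 0#) ⊎ (c₁ ≡ 0# × c₂ ≡ 0#) →
                (∀ c → c ≢ 0# → θ (σ c) ≡ σ′ (θ c)) ⊎ (∀ c → c ≢ 0# → θ c ≡ σ′ (θ (σ c)))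
        -- A′ and C′ are distinct points of the ruling of z₁, which meets each of T₁ and T₂ in one
        -- point; so they cannot both lie in T₁, nor both in T₂.
        cases (inj₁ (b₁≡0 , _)) (inj₁ (d₁≡0 , _)) = contradiction
          (subst₂ Indep₂ (pull₁ (vanish₂ eA b₁≡0)) (pull₁ (vanish₂ eC d₁≡0)) A′-C′) clash
        cases (inj₂ (a₁≡0 , _)) (inj₂ (c₁≡0 , _)) = contradiction
          (subst₂ Indep₂ (pull₂ (vanish₁ eA a₁≡0)) (pull₂ (vanish₁ eC c₁≡0)) A′-C′) clash
        -- A′, B′ lie in T₁ and C′, D′ in T₂: θ c is the ratio in the first half and θ (σ c) in the
        -- second, up to constants.
        cases (inj₁ (b₁≡0 , b₂≡0)) (inj₂ (c₁≡0 , c₂≡0)) = inj₁ (R′.compare-scales {p = θ} {λ c → θ (σ c)} z₁-z₂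
            (nonzero′ (proj₁ mA) eA b₁≡0) (*-≢0 ω≢0 (nonzero (proj₁ mD) eD c₂≡0)) θB-1 θσ1 λ c c≢0 → pick c (common c c≢0))
          where
          pick : ∀ c → ∃[ z ] On′ z (A′ +ᵥ θ c *ᵥ B′) × On′ z (C′ +ᵥ (ω * θ (σ c)) *ᵥ D′) →
                 ∃[ z ] ∃[ a ] ∃[ b ] a *ᵥ z ≡ a₁ *ᵥ z₁ +ᵥ (θ c * a₂) *ᵥ z₂ × b *ᵥ σ′.σᵥ z ≡ d₁ *ᵥ σ′.σᵥ z₁ +ᵥ (θ (σ c) * (ω * d₂)) *ᵥ σ′.σᵥ z₂
          pick c (z , (a , _ , e) , (_ , b , e′)) = z , a , b ,
            proj₁ (⊞-inj (trans (sym e) (sum₁ (θ c) (vanish₂ eA b₁≡0) (vanish₂ eB b₂≡0)))) ,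
            trans (proj₂ (⊞-inj (trans (sym e′) (sum₂ (ω * θ (σ c)) (vanish₁ eC c₁≡0) (vanish₁ eD c₂≡0)))))
              (cong (λ k → d₁ *ᵥ σ′.σᵥ z₁ +ᵥ k *ᵥ σ′.σᵥ z₂) (solve 3 (λ w s d → w :* s :* d := s :* (w :* d)) refl ω (θ (σ c)) d₂))
        -- The collineation exchanges the two sides here, so that θ (σ c) belongs to the first half
        -- and θ c to the second.
        cases (inj₂ (a₁≡0 , a₂≡0)) (inj₁ (d₁≡0 , d₂≡0)) = inj₂ (R′.compare-scales {p = λ c → θ (σ c)} {θ} z₁-z₂
            (nonzero′ (proj₁ mC) eC d₁≡0) (nonzero (proj₁ mB) eB a₂≡0) θσ1 θB-1 λ c c≢0 → pick c (common c c≢0))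
          where
          pick : ∀ c → ∃[ z ] On′ z (A′ +ᵥ θ c *ᵥ B′) × On′ z (C′ +ᵥ (ω * θ (σ c)) *ᵥ D′) →
                 ∃[ z ] ∃[ a ] ∃[ b ] a *ᵥ z ≡ c₁ *ᵥ z₁ +ᵥ (θ (σ c) * (ω * c₂)) *ᵥ z₂ × b *ᵥ σ′.σᵥ z ≡ b₁ *ᵥ σ′.σᵥ z₁ +ᵥ (θ c * b₂) *ᵥ σ′.σᵥ z₂
          pick c (z , (_ , b , e) , (a , _ , e′)) = z , a , b ,
            trans (proj₁ (⊞-inj (trans (sym e′) (sum₁ (ω * θ (σ c)) (vanish₂ eC d₁≡0) (vanish₂ eD d₂≡0)))))
              (cong (λ k → c₁ *ᵥ z₁ +ᵥ k *ᵥ z₂) (solve 3 (λ w s d → w :* s :* d := s :* (w :* d)) refl ω (θ (σ c)) c₂)) ,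
            proj₂ (⊞-inj (trans (sym e) (sum₂ (θ c) (vanish₁ eA a₁≡0) (vanish₁ eB a₂≡0))))

  intertwiner : Intertwiner
  intertwiner = from (indep-pair 2≤n)
    where
    from : ∃[ x ] ∃[ y ] Indep₂ {n} x y → Intertwiner
    from (x , y , x-y) = Frame.intertwiner x-y (proj₁ (proj₂ i₁)) (proj₁ (proj₂ i₂)) (proj₂ (proj₂ i₁)) (proj₂ (proj₂ i₂)) mA
        (scale mA (indep-T₁ x-y)) (scale mA (indep-T₁T₂ x≢0 (σ.σᵥ-≢0 x≢0))) (scale mA (indep-T₁T₂ x≢0 (σ.σᵥ-≢0 y≢0)))
      where
      x≢0 = indep₂-≢0ˡ x-y
      y≢0 = indep₂-≢0ˡ (indep₂-sym x-y)
      i₁ = ruling-image x≢0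
      i₂ = ruling-image y≢0
      A≢0 : x ⊞ 0ᵥ ≢ 0ᵥ
      A≢0 e = x≢0 (proj₁ (⊞-≡0 e))
      A′ : 𝕍
      A′ = vec (to (point (x ⊞ 0ᵥ) A≢0))
      mA : Maps (x ⊞ 0ᵥ) A′
      mA = maps-intro A≢0

-- Exponents coprime to t

length-filter-split : ∀ {A : Set} {P : A → Set} (P? : ∀ x → Dec (P x)) xs →
                      List.length (List.filter P? xs) ℕ.+ List.length (List.filter (λ x → ¬? (P? x)) xs) ≡ List.length xs
length-filter-split P? List.[] = refl
length-filter-split P? (x List.∷ xs) with P? x
... | yes _ = cong suc (length-filter-split P? xs)
... | no _  = trans (ℕₚ.+-suc _ _) (cong suc (length-filter-split P? xs))

unique⇒lookup-inj : ∀ {A : Set} {xs : List A} → Unique xs → Inj (List.lookup xs)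
unique⇒lookup-inj (x∉ AllPairs.∷ u) {zero}  {zero}  e = refl
unique⇒lookup-inj (x∉ AllPairs.∷ u) {zero}  {suc j} e = contradiction e (Allˡ.lookup x∉ (Membership.∈-lookup j))
unique⇒lookup-inj (x∉ AllPairs.∷ u) {suc i} {zero}  e = contradiction (sym e) (Allˡ.lookup x∉ (Membership.∈-lookup i))
unique⇒lookup-inj (x∉ AllPairs.∷ u) {suc i} {suc j} e = cong suc (unique⇒lookup-inj u e)

-- Injectivity is asked on members of the list only, since `t ∸_` is injective just on the numbers
-- up to t.
unique-length-≤ : ∀ {A B : Set} {xs : List A} {ys : List B} (f : A → B) → Unique xs →
                  (∀ {x y} → x ∈ˡ xs → y ∈ˡ xs → f x ≡ f y → x ≡ y) → (∀ {x} → x ∈ˡ xs → f x ∈ˡ ys) → List.length xs ≤ List.length ys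
unique-length-≤ {xs = xs} {ys} f u inj f∈ = injective⇒≤ {f = position} λ {i} {j} e → unique⇒lookup-inj u
  (inj (Membership.∈-lookup i) (Membership.∈-lookup j) (trans (Anyₚ.lookup-index (f∈ (Membership.∈-lookup i)))
    (trans (cong (List.lookup ys) e) (sym (Anyₚ.lookup-index (f∈ (Membership.∈-lookup j)))))))
  where
  position : Fin (List.length xs) → Fin (List.length ys)
  position i = Any.index (f∈ (Membership.∈-lookup {xs = xs} i))

coprime-∸ : ∀ {k t} → k ≤ t → Coprime k t → Coprime (t ∸ k) t
coprime-∸ {k} {t} k≤t cop (d∣t-k , d∣t) = cop
  (Divisibility.∣m+n∣m⇒∣n (subst (_ ∣_) (sym (ℕₚ.m∸n+n≡m k≤t)) d∣t) d∣t-k , d∣t)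

-- The exponents coprime to t are paired by k ↔ t − k.
module Exponents (t : ℕ) (3≤t : 3 ≤ t) where
  coprimes : List ℕ
  coprimes = List.filter (λ k → coprime? k t) (List.map suc (List.upTo t))

  small? : ∀ k → Dec (2 ℕ.* k < t)
  small? k = 2 ℕ.* k ℕₚ.<? t

  small large : List ℕ
  small = List.filter small? coprimes
  large = List.filter (λ k → ¬? (small? k)) coprimes

  coprimes⁺ : ∀ {k} → 0 < k → k ≤ t → Coprime k t → k ∈ˡ coprimes
  coprimes⁺ {suc k} _ k<t cop = Membership.∈-filter⁺ (λ k → coprime? k t) (Membership.∈-map⁺ suc (Membership.∈-upTo⁺ k<t)) cop

  coprimes⁻ : ∀ {k} → k ∈ˡ coprimes → 0 < k × k ≤ t × Coprime k t
  coprimes⁻ {k} k∈ with k∈′ , cop ← Membership.∈-filter⁻ (λ k → coprime? k t) {xs = List.map suc (List.upTo t)} k∈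
    with j , j∈ , refl ← Membership.∈-map⁻ suc k∈′ = s≤s z≤n , Membership.∈-upTo⁻ j∈ , cop

  unique-coprimes : Unique coprimes
  unique-coprimes = Uniqueₚ.filter⁺ (λ k → coprime? k t) (Uniqueₚ.map⁺ ℕₚ.suc-injective (Uniqueₚ.upTo⁺ t))

  unique-small : Unique small
  unique-small = Uniqueₚ.filter⁺ small? unique-coprimes

  unique-large : Unique large
  unique-large = Uniqueₚ.filter⁺ (λ k → ¬? (small? k)) unique-coprimes

  small⁻ : ∀ {k} → k ∈ˡ small → 0 < k × k ≤ t × Coprime k t × 2 ℕ.* k < t
  small⁻ k∈ = let (k∈′ , lt) = Membership.∈-filter⁻ small? {xs = coprimes} k∈ ; (p , le , cop) = coprimes⁻ k∈′ in p , le , cop , lt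

  coprime⇒<t : ∀ {k} → k ≤ t → Coprime k t → k < t
  coprime⇒<t k≤t cop with ℕₚ.m≤n⇒m<n∨m≡n k≤t
  ... | inj₁ k<t  = k<t
  ... | inj₂ refl = contradiction 3≤t λ le → ℕₚ.<⇒≱ (s≤s (s≤s z≤n)) (subst (3 ≤_) (cop (Divisibility.∣-refl , Divisibility.∣-refl)) le)

  double : ∀ k → 2 ℕ.* k ≡ k ℕ.+ k
  double k = cong (k ℕ.+_) (ℕₚ.+-identityʳ k)

  reflect-large : ∀ {k} → k ≤ t → Coprime k t → ¬ (2 ℕ.* k < t) → 2 ℕ.* (t ∸ k) < t
  reflect-large {k} k≤t cop ¬small = ℕₚ.+-cancelʳ-< (k ℕ.+ k) _ _ (begin-strict
      2 ℕ.* (t ∸ k) ℕ.+ (k ℕ.+ k)        ≡⟨ cong (2 ℕ.* (t ∸ k) ℕ.+_) (double k) ⟨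
      2 ℕ.* (t ∸ k) ℕ.+ 2 ℕ.* k          ≡⟨ ℕₚ.*-distribˡ-+ 2 (t ∸ k) k ⟨
      2 ℕ.* (t ∸ k ℕ.+ k)                ≡⟨ cong (2 ℕ.*_) (ℕₚ.m∸n+n≡m k≤t) ⟩
      2 ℕ.* t                            ≡⟨ double t ⟩
      t ℕ.+ t                            <⟨ ℕₚ.+-monoʳ-< t (subst (t <_) (double k) (ℕₚ.≤∧≢⇒< (ℕₚ.≮⇒≥ ¬small) t≢2k)) ⟩
      t ℕ.+ (k ℕ.+ k)                    ∎)
    where
    open ℕₚ.≤-Reasoning
    -- If t = 2 k, then k divides both k and t, so k = 1 and t = 2.
    t≢2k : t ≢ 2 ℕ.* k
    t≢2k e = ℕₚ.<⇒≱ (s≤s (s≤s (s≤s z≤n))) (subst (3 ≤_) (trans e (cong (2 ℕ.*_) (cop (Divisibility.∣-refl , divides 2 e)))) 3≤t)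

  reflect-small : ∀ {k} → k ≤ t → 2 ℕ.* k < t → ¬ (2 ℕ.* (t ∸ k) < t)
  reflect-small {k} k≤t lt lt′ = ℕₚ.<-irrefl {t ℕ.+ t} refl (begin-strict
      t ℕ.+ t                            ≡⟨ double t ⟨
      2 ℕ.* t                            ≡⟨ cong (2 ℕ.*_) (ℕₚ.m∸n+n≡m k≤t) ⟨
      2 ℕ.* (t ∸ k ℕ.+ k)                ≡⟨ ℕₚ.*-distribˡ-+ 2 (t ∸ k) k ⟩
      2 ℕ.* (t ∸ k) ℕ.+ 2 ℕ.* k          <⟨ ℕₚ.+-mono-< lt′ lt ⟩
      t ℕ.+ t                            ∎)
    where open ℕₚ.≤-Reasoning

  0<t∸k : ∀ {k} → k ≤ t → Coprime k t → 0 < t ∸ k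
  0<t∸k k≤t cop = ℕₚ.m<n⇒0<n∸m (coprime⇒<t k≤t cop)

  small⁺ : ∀ {k} → 0 < k → k ≤ t → Coprime k t → 2 ℕ.* k < t → k ∈ˡ small
  small⁺ p le cop lt = Membership.∈-filter⁺ small? (coprimes⁺ p le cop) lt

  reflect-inj : ∀ {j k} → j ≤ t → k ≤ t → t ∸ j ≡ t ∸ k → j ≡ k
  reflect-inj j≤ k≤ e = trans (sym (ℕₚ.m∸[m∸n]≡n j≤)) (trans (cong (t ∸_) e) (ℕₚ.m∸[m∸n]≡n k≤))

  large⁻ : ∀ {k} → k ∈ˡ large → 0 < k × k ≤ t × Coprime k t × ¬ (2 ℕ.* k < t)
  large⁻ k∈ = let (k∈′ , lt) = Membership.∈-filter⁻ (λ k → ¬? (small? k)) {xs = coprimes} k∈ ; (p , le , cop) = coprimes⁻ k∈′ in p , le , cop , lt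

  length-large : List.length large ≡ List.length small
  length-large = ℕₚ.≤-antisym
    (unique-length-≤ (t ∸_) unique-large (λ j∈ k∈ → reflect-inj (proj₁ (proj₂ (large⁻ j∈))) (proj₁ (proj₂ (large⁻ k∈))))
      λ {k} k∈ → let (p , le , cop , nl) = large⁻ k∈ in small⁺ (0<t∸k le cop) (ℕₚ.m∸n≤m t k) (coprime-∸ le cop) (reflect-large le cop nl))
    (unique-length-≤ (t ∸_) unique-small (λ j∈ k∈ → reflect-inj (proj₁ (proj₂ (small⁻ j∈))) (proj₁ (proj₂ (small⁻ k∈))))
      λ {k} k∈ → let (p , le , cop , lt) = small⁻ k∈ in Membership.∈-filter⁺ (λ k → ¬? (small? k))
        (coprimes⁺ (0<t∸k le cop) (ℕₚ.m∸n≤m t k) (coprime-∸ le cop)) (reflect-small le lt))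

  φ≡ : φ t ≡ List.length small ℕ.* 2
  φ≡ = begin
    φ t                                              ≡⟨ length-filter-split small? coprimes ⟨
    List.length small ℕ.+ List.length large          ≡⟨ cong (List.length small ℕ.+_) length-large ⟩
    List.length small ℕ.+ List.length small          ≡⟨ double (List.length small) ⟨
    2 ℕ.* List.length small                          ≡⟨ ℕₚ.*-comm 2 (List.length small) ⟩
    List.length small ℕ.* 2 ∎
    where open ≡-Reasoning

-- The orbits and their number

module Orbits {q t : ℕ} (E : FieldExtension q t) (3≤t : 3 ≤ t) (n : ℕ) (2≤n : 2 ≤ n) where
  open Over E 3≤t
  open LinearSets E n hiding (V; 0ᵥ; _+ᵥ_; _*ᵥ_; HasDimF)
  open Exponents t 3≤t
  open ≡-Reasoning

  -- Both alternatives are evaluated at g alone, where θ commutes with the power maps and cancels.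
  -- The first equates two conjugates of g; the second makes g a fixed element of `Frob (k + k′)`,
  -- which 0 < k + k′ < t forbids.
  same-exponent : ∀ {k k′} (le : k ≤ t) (cop : Coprime k t) (le′ : k′ ≤ t) (cop′ : Coprime k′ t) → 0 < k → 2 ℕ.* k < t → 2 ℕ.* k′ < t →
                  Standard.L n 2≤n (frobenius k le cop) ≅ Standard.L n 2≤n (frobenius k′ le′ cop′) → k ≡ k′
  same-exponent {k} {k′} le cop le′ cop′ 0<k lt lt′ (f , f-L) = compare twines
    where
    open Transport.Intertwiner (Transport.intertwiner E 3≤t n 2≤n (frobenius k le cop) (frobenius k′ le′ cop′) f f-L)
    g≢0 : g ≢ 0#
    g≢0 e = proj₂ ∃∉F (F.0# , trans ι-0 (sym e))
    ^-≢0 : ∀ {x} m → x ≢ 0# → x ^ m ≢ 0#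
    ^-≢0 zero    x≢0 = 1≢0
    ^-≢0 (suc m) x≢0 = *-≢0 x≢0 (^-≢0 m x≢0)
    θ-^ : ∀ {x} m → x ≢ 0# → θ (x ^ m) ≡ θ x ^ m
    θ-^ zero    x≢0 = θ-1
    θ-^ {x} (suc m) x≢0 = trans (θ-* x (x ^ m) x≢0 (^-≢0 m x≢0)) (cong (θ x *_) (θ-^ m x≢0))
    k+k′<t : k ℕ.+ k′ < t
    k+k′<t = ℕₚ.*-cancelˡ-< 2 (k ℕ.+ k′) t (subst₂ _<_ (sym (ℕₚ.*-distribˡ-+ 2 k k′)) (sym (double t)) (ℕₚ.+-mono-< lt lt′))
    compare : (∀ c → c ≢ 0# → θ (Frob k c) ≡ Frob k′ (θ c)) ⊎ (∀ c → c ≢ 0# → θ c ≡ Frob k′ (θ (Frob k c))) → k ≡ k′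
    compare (inj₁ tw) = conjugates-distinct (coprime⇒<t le cop) (coprime⇒<t le′ cop′)
      (θ-inj (trans (tw g g≢0) (sym (θ-^ (q ℕ.^ k′) g≢0))))
    compare (inj₂ tw) = contradiction (begin
        Frob (k ℕ.+ k′) g      ≡⟨ Frob-∘ k k′ g ⟩
        Frob k′ (Frob k g)     ≡⟨ θ-inj (trans (θ-^ (q ℕ.^ k′) (^-≢0 (q ℕ.^ k) g≢0)) (sym (tw g g≢0))) ⟩
        g ∎) (g-moved (k ℕ.+ k′) (ℕₚ.≤-trans 0<k (ℕₚ.m≤m+n k k′)) k+k′<t)

  private
    exponent : Fin (List.length small) → ℕ
    exponent = List.lookup small

    facts : ∀ i → 0 < exponent i × exponent i ≤ t × Coprime (exponent i) t × 2 ℕ.* exponent i < t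
    facts i = small⁻ (Membership.∈-lookup i)

    generator : Fin (List.length small) → Generator
    generator i = frobenius (exponent i) (proj₁ (proj₂ (facts i))) (proj₁ (proj₂ (proj₂ (facts i))))

    complete : ∀ L → PseudoregulusType L → ∃[ i ] L ≅ Standard.L n 2≤n (generator i)
    complete L P = from (small? S.k)
      where
      module S = Structure E 3≤t n 2≤n L P
      0<k : 0 < S.k
      0<k = ℕₚ.n≢0⇒n>0 λ e → ℕₚ.<⇒≱ (s≤s (s≤s z≤n)) (subst (3 ≤_) (S.k-coprime (subst (t ∣_) (sym e) (t Divisibility.∣0) , Divisibility.∣-refl)) 3≤t)
      k≤t = ℕₚ.<⇒≤ S.k<t
      at : ∀ {k} (k∈ : k ∈ˡ small) → exponent (Any.index k∈) ≡ k
      at k∈ = sym (Anyₚ.lookup-index k∈)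
      from : Dec (2 ℕ.* S.k < t) → ∃[ i ] L ≅ Standard.L n 2≤n (generator i)
      from (yes lt) = Any.index k∈ , S.classification _ (proj₁ (proj₂ (facts i))) (proj₁ (proj₂ (proj₂ (facts i)))) (at k∈)
        where
        k∈ = small⁺ 0<k k≤t S.k-coprime lt
        i = Any.index k∈
      from (no ¬lt) = Any.index k∈ , S.classification′ _ (proj₁ (proj₂ (facts i))) (proj₁ (proj₂ (proj₂ (facts i)))) (at k∈)
        where
        k∈ = small⁺ (0<t∸k k≤t S.k-coprime) (ℕₚ.m∸n≤m t S.k) (coprime-∸ k≤t S.k-coprime) (reflect-large k≤t S.k-coprime ¬lt)
        i = Any.index k∈

  orbits : HasExactlyOrbits (List.length small)
  orbits = record
    { representative = λ i → Standard.L n 2≤n (generator i)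
    ; isPseudo       = λ i → Standard.pseudoregulus n 2≤n (generator i)
    ; inequivalent   = λ i j iso → unique⇒lookup-inj unique-small
        (same-exponent {exponent i} {exponent j} (proj₁ (proj₂ (facts i))) (proj₁ (proj₂ (proj₂ (facts i))))
          (proj₁ (proj₂ (facts j))) (proj₁ (proj₂ (proj₂ (facts j)))) (proj₁ (facts i)) (proj₂ (proj₂ (proj₂ (facts i)))) (proj₂ (proj₂ (proj₂ (facts j)))) iso)
    ; complete       = complete }

theorem3p13 : ∀ (q n t : ℕ) → 2 ≤ n → 3 ≤ t → (E : FieldExtension q t) →
    2 ∣ φ t × LinearSets.HasExactlyOrbits E n (φ t / 2)
theorem3p13 q n t 2≤n 3≤t E = divides (List.length (Exponents.small t 3≤t)) (Exponents.φ≡ t 3≤t) ,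
  subst (LinearSets.HasExactlyOrbits E n) (sym half) (Orbits.orbits E 3≤t n 2≤n)
  where
  half : φ t / 2 ≡ List.length (Exponents.small t 3≤t)
  half = trans (cong (_/ 2) (Exponents.φ≡ t 3≤t)) (m*n/n≡m (List.length (Exponents.small t 3≤t)) 2)
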